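{- Let $k\in\mathbb{N}$ be fixed. Then the following holds for all $n$ sufficiently large. Let $V$ be a set of $n$ vertices and suppose $M_1,\dots,M_k$ are perfect matchings on $V$ such that $\sum_{i,j:\, i\neq j}|M_i\cap M_j|\le n^{1/8}$. Then the number of perfect matchings $M^*$ on $V$ such that $M^*\cup M_i$ forms a Hamilton cycle on $V$ for each $i\in[k]$ is $\Theta_k\left(n^{ -k/2}(n/e)^{n/2}\right)$.
   Context: A perfect matching on a finite set $V$ is a set of pairwise vertex-disjoint edges of the complete graph on $V$ covering all of $V$ (so $n=|V|$ is even). The sum $\sum_{i,j:\,i\ne j}$ is over ordered pairs $(i,j)\in[k]^2$ with $i\ne j$. "$n$ sufficiently large" means $n\ge n_0(k)$. $\Theta_k(\cdot)$ means bounded above and below up to positive multiplicative constants depending only on $k$. $[k]=\{1,\dots,k\}$. -}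

module Defs where

open import Data.Nat as ℕ using (ℕ; zero; suc; _!)
import Data.Nat.Properties as ℕ
import Data.Nat.DivMod as ℕ
import Data.Nat.Tactic.RingSolver as ℕ-Ring
open import Data.Integer as ℤ using (+_)
import Data.Integer.Properties as ℤ
open import Data.Rational.Unnormalised as ℚ using (ℚᵘ; 0ℚᵘ; 1ℚᵘ; ½; Positive; NonNegative; *≤*; *≡*)
import Data.Rational.Unnormalised.Properties as ℚ
open import Data.Rational.Unnormalised.Solver using (module +-*-Solver)
open import Data.Fin as Fin using (Fin; toℕ)
import Data.Fin.Properties as Fin
open import Data.Fin.Permutation using (Permutation′; _⟨$⟩ʳ_)
open import Data.Fin.Subset using (Subset; _∈_; _∩_; ∣_∣)
open import Data.List using (List; length; lookup; filter; cartesianProduct; allFin; map)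
open import Data.Nat.ListAction using (sum)
open import Data.List.Membership.Propositional renaming (_∈_ to _∈ᴸ_) using ()
open import Data.List.Relation.Unary.Unique.Propositional using (Unique)
open import Data.Product using (_×_; _,_; proj₁; proj₂; ∃; ∃-syntax; Σ-syntax)
open import Data.Sum using (_⊎_; inj₁; inj₂)
open import Function using (_⇔_)
open import Relation.Nullary using (¬_; yes; no; ¬?)
open import Relation.Nullary.Negation using (contradiction)
open import Relation.Binary.PropositionalEquality

-- Two Cauchy sequences are identified when each is ≤ the other.
record ℝ : Set where
  constructor mkℝ
  field
    seq    : ℕ → ℚᵘ
    cauchy : ∀ ε → .{{Positive ε}} →
             ∃[ N ] (∀ i j → i ℕ.≥ N → j ℕ.≥ N → ℚ.∣ seq i ℚ.- seq j ∣ ℚ.≤ ε)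

open ℝ public

infix  4 _≤_
infixl 7 _*_
infixr 8 _^_ _^1/_

_≤_ : ℝ → ℝ → Set
x ≤ y = ∀ ε → .{{Positive ε}} →
        ∃[ N ] (∀ i → i ℕ.≥ N → seq x i ℚ.≤ seq y i ℚ.+ ε)

abs≤ : ∀ {p q ε} → p ℚ.≤ q ℚ.+ ε → q ℚ.≤ p ℚ.+ ε → ℚ.∣ p ℚ.- q ∣ ℚ.≤ ε
abs≤ {p} {q} {ε} h h′ with ℚ.∣p∣≡p∨∣p∣≡-p (p ℚ.- q)
... | inj₁ eq = subst (ℚ._≤ ε) (sym eq)
  (ℚ.≤-trans (ℚ.+-monoˡ-≤ (ℚ.- q) h) (ℚ.≤-reflexive
    (solve 2 (λ q ε → ((q :+ ε) :- q) := ε) ℚ.≃-refl q ε)))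
  where open +-*-Solver
... | inj₂ eq = subst (ℚ._≤ ε) (sym eq)
  (ℚ.≤-trans (ℚ.≤-reflexive (solve 2 (λ p q → (:- (p :- q)) := (q :- p)) ℚ.≃-refl p q))
  (ℚ.≤-trans (ℚ.+-monoˡ-≤ (ℚ.- p) h′) (ℚ.≤-reflexive
    (solve 2 (λ p ε → ((p :+ ε) :- p) := ε) ℚ.≃-refl p ε))))
  where open +-*-Solver

-- Every positive rational exceeds some 1/(N+1).
archimedean : ∀ ε → .{{Positive ε}} → ∃[ N ] (∀ i → i ℕ.≥ N → (+ 1) ℚ./ suc i ℚ.≤ ε)
archimedean (ℚ.mkℚᵘ (+ suc a) d) = d , λ i i≥d → *≤* (ℤ.+≤+ (ℕ.≤-trans
  (ℕ.≤-reflexive (ℕ.*-identityˡ (suc d)))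
  (ℕ.≤-trans (ℕ.s≤s i≥d) (ℕ.m≤m+n (suc i) (a ℕ.* suc i)))))

fromℚ : ℚᵘ → ℝ
fromℚ q .seq _ = q
fromℚ q .cauchy ε = 0 , λ _ _ _ _ → abs≤ (ℚ.p≤p+q q ε {{ℚ.pos⇒nonNeg ε}}) (ℚ.p≤p+q q ε {{ℚ.pos⇒nonNeg ε}})

fromℕ : ℕ → ℝ
fromℕ n = fromℚ ((+ n) ℚ./ 1)

bound : (x : ℝ) → ∃[ B ] Σ[ _ ∈ Positive B ] ∃[ N ] (∀ i → i ℕ.≥ N → ℚ.∣ seq x i ∣ ℚ.≤ B)
bound x with cauchy x 1ℚᵘ
... | N , h = B , B>0 , N , λ i i≥N → begin
    ℚ.∣ seq x i ∣                                     ≃⟨ ℚ.∣-∣-cong (solve 2 (λ a b → a := ((a :- b) :+ b)) ℚ.≃-refl (seq x i) (seq x N)) ⟩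
    ℚ.∣ (seq x i ℚ.- seq x N) ℚ.+ seq x N ∣           ≤⟨ ℚ.∣p+q∣≤∣p∣+∣q∣ (seq x i ℚ.- seq x N) (seq x N) ⟩
    ℚ.∣ seq x i ℚ.- seq x N ∣ ℚ.+ ℚ.∣ seq x N ∣       ≤⟨ ℚ.+-monoˡ-≤ ℚ.∣ seq x N ∣ (h i N i≥N ℕ.≤-refl) ⟩
    B ∎
  where
  open +-*-Solver
  open ℚ.≤-Reasoning
  B = 1ℚᵘ ℚ.+ ℚ.∣ seq x N ∣
  B>0 : Positive B
  B>0 = ℚ.positive (ℚ.<-≤-trans (ℚ.positive⁻¹ 1ℚᵘ)
          (ℚ.p≤p+q 1ℚᵘ ℚ.∣ seq x N ∣ {{ℚ.∣-∣-nonNeg (seq x N)}}))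

-- ∣p∣ ≤ B and ∣q∣ ≤ ε/(2B) give ∣pq∣ ≤ ε/2.
halve : ∀ {p q} ε B .{{ε>0 : Positive ε}} {{B>0 : Positive B}} → ℚ.∣ p ∣ ℚ.≤ B →
        ℚ.∣ q ∣ ℚ.≤ (½ ℚ.* ε) ℚ.* (ℚ.1/ B) {{ℚ.pos⇒nonZero B}} → ℚ.∣ p ℚ.* q ∣ ℚ.≤ ½ ℚ.* ε
halve {p} {q} ε B p≤ q≤ = begin
    ℚ.∣ p ℚ.* q ∣              ≃⟨ ℚ.∣p*q∣≃∣p∣*∣q∣ p q ⟩
    ℚ.∣ p ∣ ℚ.* ℚ.∣ q ∣        ≤⟨ ℚ.*-mono-≤-nonNeg {{ℚ.∣-∣-nonNeg p}} {{ℚ.∣-∣-nonNeg q}} p≤ q≤ ⟩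
    B ℚ.* ((½ ℚ.* ε) ℚ.* B⁻¹)  ≃⟨ solve 3 (λ b e r → (b :* (e :* r)) := (e :* (b :* r))) ℚ.≃-refl B (½ ℚ.* ε) B⁻¹ ⟩
    (½ ℚ.* ε) ℚ.* (B ℚ.* B⁻¹)  ≃⟨ ℚ.*-congˡ {½ ℚ.* ε} (ℚ.*-inverseʳ B {{ℚ.pos⇒nonZero B}}) ⟩
    (½ ℚ.* ε) ℚ.* 1ℚᵘ          ≃⟨ ℚ.*-identityʳ (½ ℚ.* ε) ⟩
    ½ ℚ.* ε ∎
  where
  open +-*-Solver
  open ℚ.≤-Reasoning
  B⁻¹ = (ℚ.1/ B) {{ℚ.pos⇒nonZero B}}

tolerance>0 : ∀ ε B .{{_ : Positive ε}} {{_ : Positive B}} →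
              Positive ((½ ℚ.* ε) ℚ.* (ℚ.1/ B) {{ℚ.pos⇒nonZero B}})
tolerance>0 ε B = ℚ.pos*pos⇒pos (½ ℚ.* ε) {{ℚ.pos*pos⇒pos ½ ε}}
                    ((ℚ.1/ B) {{ℚ.pos⇒nonZero B}}) {{ℚ.1/pos⇒pos B}}

_*_ : ℝ → ℝ → ℝ
(x * y) .seq i = seq x i ℚ.* seq y i
(x * y) .cauchy ε {{ε>0}} with bound x | bound y
... | A , A>0 , N₁ , x≤A | B , B>0 , N₂ , y≤B
  with cauchy x _ {{tolerance>0 ε B {{ε>0}} {{B>0}}}} | cauchy y _ {{tolerance>0 ε A {{ε>0}} {{A>0}}}}
... | N₃ , hx | N₄ , hy = N , λ i j i≥N j≥N → begin
    ℚ.∣ seq x i ℚ.* seq y i ℚ.- seq x j ℚ.* seq y j ∣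
      ≃⟨ ℚ.∣-∣-cong (solve 4 (λ a b c d → (a :* b :- c :* d) := (a :* (b :- d) :+ d :* (a :- c)))
                     ℚ.≃-refl (seq x i) (seq y i) (seq x j) (seq y j)) ⟩
    ℚ.∣ seq x i ℚ.* (seq y i ℚ.- seq y j) ℚ.+ seq y j ℚ.* (seq x i ℚ.- seq x j) ∣
      ≤⟨ ℚ.∣p+q∣≤∣p∣+∣q∣ (seq x i ℚ.* (seq y i ℚ.- seq y j)) (seq y j ℚ.* (seq x i ℚ.- seq x j)) ⟩
    ℚ.∣ seq x i ℚ.* (seq y i ℚ.- seq y j) ∣ ℚ.+ ℚ.∣ seq y j ℚ.* (seq x i ℚ.- seq x j) ∣
      ≤⟨ ℚ.+-mono-≤
           (halve {seq x i} {seq y i ℚ.- seq y j} ε A {{ε>0}} {{A>0}} (x≤A i (≤₁ i≥N)) (hy i j (≤₄ i≥N) (≤₄ j≥N)))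
           (halve {seq y j} {seq x i ℚ.- seq x j} ε B {{ε>0}} {{B>0}} (y≤B j (≤₂ j≥N)) (hx i j (≤₃ i≥N) (≤₃ j≥N))) ⟩
    ½ ℚ.* ε ℚ.+ ½ ℚ.* ε
      ≃⟨ ℚ.*-distribʳ-+ ε ½ ½ ⟨
    (½ ℚ.+ ½) ℚ.* ε
      ≃⟨ ℚ.*-congʳ {ε} {½ ℚ.+ ½} {1ℚᵘ} (*≡* refl) ⟩
    1ℚᵘ ℚ.* ε
      ≃⟨ ℚ.*-identityˡ ε ⟩
    ε ∎
  where
  open +-*-Solver
  open ℚ.≤-Reasoning
  N = (N₁ ℕ.⊔ N₂) ℕ.⊔ (N₃ ℕ.⊔ N₄)
  ≤₁ : ∀ {i} → N ℕ.≤ i → N₁ ℕ.≤ i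
  ≤₁ h = ℕ.m⊔n≤o⇒m≤o N₁ N₂ (ℕ.m⊔n≤o⇒m≤o (N₁ ℕ.⊔ N₂) (N₃ ℕ.⊔ N₄) h)
  ≤₂ : ∀ {i} → N ℕ.≤ i → N₂ ℕ.≤ i
  ≤₂ h = ℕ.m⊔n≤o⇒n≤o N₁ N₂ (ℕ.m⊔n≤o⇒m≤o (N₁ ℕ.⊔ N₂) (N₃ ℕ.⊔ N₄) h)
  ≤₃ : ∀ {i} → N ℕ.≤ i → N₃ ℕ.≤ i
  ≤₃ h = ℕ.m⊔n≤o⇒m≤o N₃ N₄ (ℕ.m⊔n≤o⇒n≤o (N₁ ℕ.⊔ N₂) (N₃ ℕ.⊔ N₄) h)
  ≤₄ : ∀ {i} → N ℕ.≤ i → N₄ ℕ.≤ i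
  ≤₄ h = ℕ.m⊔n≤o⇒n≤o N₃ N₄ (ℕ.m⊔n≤o⇒n≤o (N₁ ℕ.⊔ N₂) (N₃ ℕ.⊔ N₄) h)

_^_ : ℝ → ℕ → ℝ
x ^ zero  = fromℕ 1
x ^ suc k = x * x ^ k

-- The reciprocal is only needed for reals all of whose approximants are at
-- least 1, where it is 1-Lipschitz.
≥1 : ℝ → Set
≥1 x = ∀ i → 1ℚᵘ ℚ.≤ seq x i

pos≥1 : ∀ {p} → 1ℚᵘ ℚ.≤ p → Positive p
pos≥1 h = ℚ.positive (ℚ.<-≤-trans (ℚ.positive⁻¹ 1ℚᵘ) h)

recip-≤ : ∀ p q .{{_ : ℚ.NonZero p}} .{{_ : ℚ.NonZero q}} → 1ℚᵘ ℚ.≤ p → 1ℚᵘ ℚ.≤ q →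
          ℚ.∣ ℚ.1/ p ℚ.- ℚ.1/ q ∣ ℚ.≤ ℚ.∣ p ℚ.- q ∣
recip-≤ p q 1≤p 1≤q = begin
    ℚ.∣ p⁻¹ ℚ.- q⁻¹ ∣
      ≃⟨ ℚ.∣-∣-cong (ℚ.≃-trans
           (ℚ.+-cong (ℚ.≃-sym (ℚ.≃-trans (ℚ.*-congˡ {p⁻¹} (ℚ.*-inverseˡ q)) (ℚ.*-identityʳ p⁻¹)))
             (ℚ.-‿cong (ℚ.≃-sym (ℚ.≃-trans (ℚ.*-congˡ {q⁻¹} (ℚ.*-inverseˡ p)) (ℚ.*-identityʳ q⁻¹)))))
           (solve 4 (λ a b p q → (a :* (b :* q) :- b :* (a :* p)) := (:- (a :* b :* (p :- q)))) ℚ.≃-refl p⁻¹ q⁻¹ p q)) ⟩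
    ℚ.∣ ℚ.- (p⁻¹ ℚ.* q⁻¹ ℚ.* (p ℚ.- q)) ∣       ≃⟨ ℚ.∣-p∣≃∣p∣ (p⁻¹ ℚ.* q⁻¹ ℚ.* (p ℚ.- q)) ⟩
    ℚ.∣ p⁻¹ ℚ.* q⁻¹ ℚ.* (p ℚ.- q) ∣             ≃⟨ ℚ.∣p*q∣≃∣p∣*∣q∣ (p⁻¹ ℚ.* q⁻¹) (p ℚ.- q) ⟩
    ℚ.∣ p⁻¹ ℚ.* q⁻¹ ∣ ℚ.* ℚ.∣ p ℚ.- q ∣         ≃⟨ ℚ.*-congʳ {ℚ.∣ p ℚ.- q ∣} (ℚ.0≤p⇒∣p∣≃p (ℚ.nonNegative⁻¹ (p⁻¹ ℚ.* q⁻¹) {{pq≥0}})) ⟩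
    (p⁻¹ ℚ.* q⁻¹) ℚ.* ℚ.∣ p ℚ.- q ∣             ≤⟨ ℚ.*-monoˡ-≤-nonNeg ℚ.∣ p ℚ.- q ∣ {{ℚ.∣-∣-nonNeg (p ℚ.- q)}}
                                                     (ℚ.*-mono-≤-nonNeg {{p⁻¹≥0}} {{q⁻¹≥0}} (inv≤1 p 1≤p) (inv≤1 q 1≤q)) ⟩
    (1ℚᵘ ℚ.* 1ℚᵘ) ℚ.* ℚ.∣ p ℚ.- q ∣             ≃⟨ ℚ.*-identityˡ ℚ.∣ p ℚ.- q ∣ ⟩
    ℚ.∣ p ℚ.- q ∣ ∎
  where
  open +-*-Solver
  open ℚ.≤-Reasoning
  p⁻¹ = ℚ.1/ p
  q⁻¹ = ℚ.1/ q
  inv≥0 : ∀ r .{{_ : ℚ.NonZero r}} → 1ℚᵘ ℚ.≤ r → NonNegative (ℚ.1/ r)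
  inv≥0 r {{nz}} h = ℚ.pos⇒nonNeg ((ℚ.1/ r) {{nz}}) {{ℚ.1/pos⇒pos r {{pos≥1 h}}}}
  inv≤1 : ∀ r .{{_ : ℚ.NonZero r}} → 1ℚᵘ ℚ.≤ r → ℚ.1/ r ℚ.≤ 1ℚᵘ
  inv≤1 r h = ℚ.1/-antimono-≤-pos {1ℚᵘ} {r} {{_}} {{pos≥1 h}} h
  p⁻¹≥0 = inv≥0 p 1≤p
  q⁻¹≥0 = inv≥0 q 1≤q
  pq≥0 = ℚ.nonNeg*nonNeg⇒nonNeg p⁻¹ {{p⁻¹≥0}} q⁻¹ {{q⁻¹≥0}}

recip : (x : ℝ) → ≥1 x → ℝ
recip x x≥1 .seq i = (ℚ.1/ seq x i) {{ℚ.pos⇒nonZero (seq x i) {{pos≥1 (x≥1 i)}}}}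
recip x x≥1 .cauchy ε with cauchy x ε
... | N , h = N , λ i j i≥N j≥N → ℚ.≤-trans
  (recip-≤ (seq x i) (seq x j) {{ℚ.pos⇒nonZero (seq x i) {{pos≥1 (x≥1 i)}}}} {{ℚ.pos⇒nonZero (seq x j) {{pos≥1 (x≥1 j)}}}} (x≥1 i) (x≥1 j))
  (h i j i≥N j≥N)

-- The largest a ≤ b with aᵈ ≤ m (or 0 if there is none).
searchRoot : (d m b : ℕ) → ℕ
searchRoot d m zero = zero
searchRoot d m (suc b) with suc b ℕ.^ d ℕ.≤? m
... | yes _ = suc b
... | no  _ = searchRoot d m b

-- ⌊ m^(1/d) ⌋
floorRoot : (d m : ℕ) → ℕ
floorRoot d m = searchRoot d m m

searchRoot-lower : ∀ d m b .{{_ : ℕ.NonZero d}} → searchRoot d m b ℕ.^ d ℕ.≤ m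
searchRoot-lower (suc d) m zero = ℕ.z≤n
searchRoot-lower d m (suc b) with suc b ℕ.^ d ℕ.≤? m
... | yes h = h
... | no  _ = searchRoot-lower d m b

searchRoot-upper : ∀ d m b a → a ℕ.≤ b → a ℕ.^ d ℕ.≤ m → a ℕ.≤ searchRoot d m b
searchRoot-upper d m zero    a a≤b _ = a≤b
searchRoot-upper d m (suc b) a a≤b h with suc b ℕ.^ d ℕ.≤? m
... | yes _ = a≤b
... | no ¬h with ℕ.m≤n⇒m<n∨m≡n a≤b
...   | inj₁ (ℕ.s≤s a≤b′) = searchRoot-upper d m b a a≤b′ h
...   | inj₂ refl = contradiction h ¬h

m≤m^d : ∀ m d .{{_ : ℕ.NonZero d}} → m ℕ.≤ m ℕ.^ d
m≤m^d zero    d = ℕ.z≤n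
m≤m^d (suc m) (suc d) = ℕ.m≤m*n (suc m) (suc m ℕ.^ d) {{ℕ.m^n≢0 (suc m) d}}

floorRoot-max : ∀ d m a .{{_ : ℕ.NonZero d}} → a ℕ.^ d ℕ.≤ m → a ℕ.≤ floorRoot d m
floorRoot-max d m a h = searchRoot-upper d m m a (ℕ.≤-trans (m≤m^d a d) h) h

-- With a = ⌊n^(1/d) x⌋ and b = ⌊n^(1/d) y⌋, we have a/x ≤ (b+1)/y.
floorRoot-compare : ∀ d n x y .{{_ : ℕ.NonZero d}} →
  floorRoot d (n ℕ.* x ℕ.^ d) ℕ.* y ℕ.≤ suc (floorRoot d (n ℕ.* y ℕ.^ d)) ℕ.* x
floorRoot-compare d n x y with ℕ.≤-total (floorRoot d (n ℕ.* x ℕ.^ d) ℕ.* y) (suc (floorRoot d (n ℕ.* y ℕ.^ d)) ℕ.* x)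
... | inj₁ h = h
... | inj₂ h with x
...   | zero = ℕ.≤-trans (ℕ.≤-reflexive (cong (ℕ._* y) a≡0)) ℕ.z≤n
  where
  a≡0 : floorRoot d (n ℕ.* 0 ℕ.^ d) ≡ 0
  a≡0 = trans (cong (floorRoot d) (trans (cong (n ℕ.*_) (zero^ d)) (ℕ.*-zeroʳ n))) refl
    where
    zero^ : ∀ d .{{_ : ℕ.NonZero d}} → 0 ℕ.^ d ≡ 0
    zero^ (suc _) = refl
...   | suc x′ = contradiction (floorRoot-max d _ (suc b) b+1) (ℕ.<⇒≱ ℕ.≤-refl)
  where
  X = suc x′
  a = floorRoot d (n ℕ.* X ℕ.^ d)
  b = floorRoot d (n ℕ.* y ℕ.^ d)
  swap : ∀ n p q → (n ℕ.* p) ℕ.* q ≡ (n ℕ.* q) ℕ.* p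
  swap = ℕ-Ring.solve-∀
  ^-distrib : ∀ u v d → (u ℕ.* v) ℕ.^ d ≡ u ℕ.^ d ℕ.* v ℕ.^ d
  ^-distrib u v zero = refl
  ^-distrib u v (suc d) rewrite ^-distrib u v d = four u v (u ℕ.^ d) (v ℕ.^ d)
    where
    four : ∀ u v p q → (u ℕ.* v) ℕ.* (p ℕ.* q) ≡ (u ℕ.* p) ℕ.* (v ℕ.* q)
    four = ℕ-Ring.solve-∀
  b+1 : suc b ℕ.^ d ℕ.≤ n ℕ.* y ℕ.^ d
  b+1 = ℕ.*-cancelʳ-≤ (suc b ℕ.^ d) (n ℕ.* y ℕ.^ d) (X ℕ.^ d) {{ℕ.m^n≢0 X d}} (begin
    suc b ℕ.^ d ℕ.* X ℕ.^ d        ≡⟨ ^-distrib (suc b) X d ⟨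
    (suc b ℕ.* X) ℕ.^ d            ≤⟨ ℕ.^-monoˡ-≤ d h ⟩
    (a ℕ.* y) ℕ.^ d                ≡⟨ ^-distrib a y d ⟩
    a ℕ.^ d ℕ.* y ℕ.^ d            ≤⟨ ℕ.*-monoˡ-≤ (y ℕ.^ d) (searchRoot-lower d (n ℕ.* X ℕ.^ d) (n ℕ.* X ℕ.^ d)) ⟩
    (n ℕ.* X ℕ.^ d) ℕ.* y ℕ.^ d    ≡⟨ swap n (X ℕ.^ d) (y ℕ.^ d) ⟩
    (n ℕ.* y ℕ.^ d) ℕ.* X ℕ.^ d    ∎)
    where open ℕ.≤-Reasoning

-- n^(1/d), as the limit of ⌊n^(1/d) (i+1)⌋ / (i+1).
_^1/_ : ℕ → (d : ℕ) → .{{ℕ.NonZero d}} → ℝ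
(n ^1/ d) .seq i = (+ floorRoot d (n ℕ.* suc i ℕ.^ d)) ℚ./ suc i
(n ^1/ d) .cauchy ε with archimedean ε
... | N , h = N , λ i j i≥N j≥N → abs≤ (close i j j≥N) (close j i i≥N)
  where
  approx : ℕ → ℕ
  approx i = floorRoot d (n ℕ.* suc i ℕ.^ d)
  close : ∀ i j → j ℕ.≥ N → (+ approx i) ℚ./ suc i ℚ.≤ (+ approx j) ℚ./ suc j ℚ.+ ε
  close i j j≥N = ℚ.≤-trans {_} {(+ approx j) ℚ./ suc j ℚ.+ (+ 1) ℚ./ suc j}
    (ℚ.≤-trans {_} {(+ suc (approx j)) ℚ./ suc j} (*≤* (ℤ.≤-trans (ℤ.≤-reflexive (sym (ℤ.pos-* (approx i) (suc j))))
                     (ℤ.≤-trans (ℤ.+≤+ (floorRoot-compare d n (suc i) (suc j)))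
                       (ℤ.≤-reflexive (ℤ.pos-* (suc (approx j)) (suc i))))))
      (ℚ.≤-reflexive (*≡* (split (approx j) (suc j)))))
    (ℚ.+-monoʳ-≤ ((+ approx j) ℚ./ suc j) (h j j≥N))
    where
    split : ∀ a s → + suc a ℤ.* (+ (s ℕ.* s)) ≡ (+ a ℤ.* + s ℤ.+ + 1 ℤ.* + s) ℤ.* + s
    split a s = begin
      + suc a ℤ.* + (s ℕ.* s)              ≡⟨ ℤ.pos-* (suc a) (s ℕ.* s) ⟨
      + (suc a ℕ.* (s ℕ.* s))              ≡⟨ cong +_ (nat a s) ⟩
      + ((a ℕ.* s ℕ.+ 1 ℕ.* s) ℕ.* s)      ≡⟨ ℤ.pos-* (a ℕ.* s ℕ.+ 1 ℕ.* s) s ⟩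
      + (a ℕ.* s ℕ.+ 1 ℕ.* s) ℤ.* + s      ≡⟨ cong (ℤ._* + s) (ℤ.pos-+ (a ℕ.* s) (1 ℕ.* s)) ⟩
      (+ (a ℕ.* s) ℤ.+ + (1 ℕ.* s)) ℤ.* + s ≡⟨ cong (ℤ._* + s) (cong₂ ℤ._+_ (ℤ.pos-* a s) (ℤ.pos-* 1 s)) ⟩
      (+ a ℤ.* + s ℤ.+ + 1 ℤ.* + s) ℤ.* + s ∎
      where
      open ≡-Reasoning
      nat : ∀ a s → suc a ℕ.* (s ℕ.* s) ≡ (a ℕ.* s ℕ.+ 1 ℕ.* s) ℕ.* s
      nat = ℕ-Ring.solve-∀

root≥1 : ∀ n d .{{_ : ℕ.NonZero n}} .{{_ : ℕ.NonZero d}} → ≥1 (n ^1/ d)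
root≥1 n d i = *≤* (subst₂ ℤ._≤_ (ℤ.pos-* 1 (suc i)) (ℤ.pos-* (floorRoot d (n ℕ.* suc i ℕ.^ d)) 1)
  (ℤ.+≤+ (ℕ.≤-trans (ℕ.≤-reflexive (ℕ.*-identityˡ (suc i)))
    (ℕ.≤-trans (floorRoot-max d _ (suc i) (ℕ.m≤n*m (suc i ℕ.^ d) n))
      (ℕ.≤-reflexive (sym (ℕ.*-identityʳ _)))))))

-- Partial sums of Σ 1/i!.
expSum : ℕ → ℚᵘ
expSum zero    = 1ℚᵘ
expSum (suc j) = expSum j ℚ.+ ((+ 1) ℚ./ (suc j !)) {{suc j ℕ.!≢0}}

1/! : ℕ → ℚᵘ
1/! j = ((+ 1) ℚ./ (j !)) {{j ℕ.!≢0}}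

1/!≥0 : ∀ j → NonNegative (1/! j)
1/!≥0 j = ℚ.nonNegative (nn (j !) {{j ℕ.!≢0}})
  where
  nn : ∀ m .{{_ : ℕ.NonZero m}} → 0ℚᵘ ℚ.≤ (+ 1) ℚ./ m
  nn (suc m) = *≤* (ℤ.+≤+ ℕ.z≤n)

expSum-mono : ∀ {i j} → i ℕ.≤ j → expSum i ℚ.≤ expSum j
expSum-mono {j = j} i≤j with ℕ.m≤n⇒m<n∨m≡n i≤j
... | inj₂ refl = ℚ.≤-refl
expSum-mono {j = suc j} _ | inj₁ (ℕ.s≤s i≤j) = ℚ.≤-trans (expSum-mono i≤j)
  (ℚ.p≤p+q (expSum j) (1/! (suc j)) {{1/!≥0 (suc j)}})

-- 1/(t+2)! ≤ 1/(t+1) - 1/(t+2), so the tail of the series telescopes.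
tail-step : ∀ t → 1/! (suc (suc t)) ℚ.+ (+ 1) ℚ./ suc (suc t) ℚ.≤ (+ 1) ℚ./ suc t
tail-step t = go (suc (suc t) !) {{suc (suc t) ℕ.!≢0}} (ℕ.*-monoʳ-≤ (suc (suc t)) (n≤n! (suc t)))
  where
  n≤n! : ∀ n → n ℕ.≤ n !
  n≤n! zero = ℕ.z≤n
  n≤n! (suc n) = ℕ.m≤m*n (suc n) (n !) {{n ℕ.!≢0}}
  go : ∀ F .{{_ : ℕ.NonZero F}} → suc (suc t) ℕ.* suc t ℕ.≤ F →
       (+ 1) ℚ./ F ℚ.+ (+ 1) ℚ./ suc (suc t) ℚ.≤ (+ 1) ℚ./ suc t
  go (suc f) h = *≤* (subst₂ ℤ._≤_
      (trans (ℤ.pos-* (1 ℕ.* b ℕ.+ 1 ℕ.* F) a)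
        (cong (ℤ._* + a) (trans (ℤ.pos-+ (1 ℕ.* b) (1 ℕ.* F)) (cong₂ ℤ._+_ (ℤ.pos-* 1 b) (ℤ.pos-* 1 F)))))
      (ℤ.pos-* 1 (F ℕ.* b))
      (ℤ.+≤+ (begin
        (1 ℕ.* b ℕ.+ 1 ℕ.* F) ℕ.* a   ≡⟨ expand b F a ⟩
        b ℕ.* a ℕ.+ F ℕ.* a           ≤⟨ ℕ.+-monoˡ-≤ (F ℕ.* a) h ⟩
        F ℕ.+ F ℕ.* a                 ≡⟨ collect F a ⟩
        1 ℕ.* (F ℕ.* b)               ∎)))
    where
    open ℕ.≤-Reasoning
    F = suc f
    a = suc t
    b = suc (suc t)
    expand : ∀ b F a → (1 ℕ.* b ℕ.+ 1 ℕ.* F) ℕ.* a ≡ b ℕ.* a ℕ.+ F ℕ.* a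
    expand = ℕ-Ring.solve-∀
    collect : ∀ F a → F ℕ.+ F ℕ.* a ≡ 1 ℕ.* (F ℕ.* suc a)
    collect = ℕ-Ring.solve-∀

expUpper : ℕ → ℚᵘ
expUpper t = expSum (suc t) ℚ.+ (+ 1) ℚ./ suc t

expUpper-anti : ∀ {i j} → i ℕ.≤ j → expUpper j ℚ.≤ expUpper i
expUpper-anti {j = j} i≤j with ℕ.m≤n⇒m<n∨m≡n i≤j
... | inj₂ refl = ℚ.≤-refl {expUpper j}
expUpper-anti {j = suc j} _ | inj₁ (ℕ.s≤s i≤j) = ℚ.≤-trans
  (ℚ.≤-trans (ℚ.≤-reflexive (ℚ.+-assoc (expSum (suc j)) (1/! (suc (suc j))) ((+ 1) ℚ./ suc (suc j))))
    (ℚ.+-monoʳ-≤ (expSum (suc j)) (tail-step j)))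
  (expUpper-anti i≤j)

e : ℝ
e .seq = expSum
e .cauchy ε with archimedean ε
... | N , h = suc N , λ where
    (suc i) (suc j) (ℕ.s≤s i≥N) (ℕ.s≤s j≥N) → abs≤ (close j i j≥N) (close i j i≥N)
  where
  close : ∀ i j → i ℕ.≥ N → expSum (suc j) ℚ.≤ expSum (suc i) ℚ.+ ε
  close i j i≥N with ℕ.≤-total j i
  ... | inj₁ j≤i = ℚ.≤-trans (expSum-mono (ℕ.s≤s j≤i))
                     (ℚ.p≤p+q (expSum (suc i)) ε {{ℚ.pos⇒nonNeg ε}})
  ... | inj₂ i≤j = ℚ.≤-trans (ℚ.p≤p+q (expSum (suc j)) ((+ 1) ℚ./ suc j))
                     (ℚ.≤-trans (expUpper-anti i≤j) (ℚ.+-monoʳ-≤ (expSum (suc i)) (h i i≥N)))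

e≥1 : ≥1 e
e≥1 i = expSum-mono {0} {i} ℕ.z≤n

-- n^(-k/2) (n/e)^(n/2); for even n the exponent n/2 is an integer.
asymptotic : (k n : ℕ) → .{{ℕ.NonZero n}} → ℝ
asymptotic k n = recip (n ^1/ 2) (root≥1 n 2) ^ k * (fromℕ n * recip e e≥1) ^ (n ℕ./ 2)

-- The edge {u,v} is listed once, as the pair (u,v) with u < v.
edges : (n : ℕ) → List (Fin n × Fin n)
edges n = filter (λ (u , v) → u Fin.<? v) (cartesianProduct (allFin n) (allFin n))

Edge : ℕ → Set
Edge n = Fin (length (edges n))

EdgeSet : ℕ → Set
EdgeSet n = Subset (length (edges n))

endpoints : ∀ n → Edge n → Fin n × Fin n
endpoints n = lookup (edges n)

Joins : ∀ n → Edge n → Fin n → Fin n → Set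
Joins n f u v = endpoints n f ≡ (u , v) ⊎ endpoints n f ≡ (v , u)

Covers : ∀ n → Edge n → Fin n → Set
Covers n f v = v ≡ proj₁ (endpoints n f) ⊎ v ≡ proj₂ (endpoints n f)

record IsPerfectMatching (n : ℕ) (M : EdgeSet n) : Set where
  field
    disjoint : ∀ f g → f ∈ M → g ∈ M → f ≢ g → ∀ v → ¬ (Covers n f v × Covers n g v)
    covering : ∀ v → ∃[ f ] f ∈ M × Covers n f v

next : ∀ {n} → Fin n → Fin n
next {n} i = (suc (toℕ i) ℕ.mod n) {{Fin.nonZeroIndex i}}

-- H consists of the edges π₀π₁, π₁π₂, …, πₙ₋₁π₀ of a cyclic ordering π of all vertices.
record IsHamiltonCycle (n : ℕ) (H : EdgeSet n) : Set where
  field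
    3≤n      : 3 ℕ.≤ n
    ordering : Permutation′ n
    edges⇔   : ∀ f → f ∈ H ⇔ (∃[ i ] Joins n f (ordering ⟨$⟩ʳ i) (ordering ⟨$⟩ʳ next i))

totalIntersection : ∀ k n → (Fin k → EdgeSet n) → ℕ
totalIntersection k n M =
  sum (map (λ (i , j) → ∣ M i ∩ M j ∣)
    (filter (λ (i , j) → ¬? (i Fin.≟ j)) (cartesianProduct (allFin k) (allFin k))))

HasCount : {A : Set} → (A → Set) → ℕ → Set
HasCount P N = ∃[ xs ] Unique xs × (∀ x → x ∈ᴸ xs ⇔ P x) × length xs ≡ N

-- If M* contains the edge uv, then deleting u and v and joining their two Mᵢ-neighbours, for every
-- i, turns the problem into the same problem on n - 2 vertices: M* ∪ Mᵢ is a Hamilton cycle exactly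
-- when the contracted union is one. A vertex whose k neighbours in the Mᵢ are distinct has n - 1 -
-- k admissible partners, so without coincidences the count would be, up to a constant, the product
-- P of m - 1 - k over the even m from some constant to n. Contracting along a typical pair creates
-- no new coincidence, and coincidences disappear when the recursion always branches at a vertex
-- that has one. A potential linear in the number of coincidences, and one exponential in it for the
-- rare states with many, show that the count is P up to a constant factor, provided that states of
-- some constant size and few coincidences have a solution at all. Such a solution is built by
-- induction on k, by contracting pairs until two of the matchings agree. Finally P is compared with
-- n^(-k/2) (n/e)^(n/2) through two-sided estimates of (1 + 1/m)^m, applied to P² so that only
-- integer powers occur.

module Submission where

-- The count may be off by a constant factor only, so relative errors must be summable over the
-- recursion. A surplus of k partners at every level would already change the order of magnitude by
-- a power of n, hence coincidences have to be charged for. A bounded number of partners near the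
-- pivot can create up to 2(k+1) new coincidences. With t pairs left, such partners are a fraction
-- of order 1/t, and a new coincidence costs a relative amount of order 1/t, so a correction γ/t in
-- the bounds, which changes by about γ/t² per level, pays for them. The linear potential breaks
-- down for the upper bound once the coincidences are comparable to t; the exponential one is
-- calibrated to beat the trivial bound (2t - 1)!! exactly there, and carries a factor 2^(-t) that
-- makes it harmless at the start. The vertex type stays `Fin n`: a list `L` of live vertices
-- shrinks while the involutions are rewritten, so contraction needs no renumbering.

module Finite where

  -- Duplicate-free lists, sums over lists, exact counting.

  open import Defs using (HasCount)
  open import Data.Nat
  open import Data.Nat.Properties
  open import Data.Nat.ListAction using (sum)
  open import Data.List using (List; []; _∷_; _++_; length; filter; map)
  open import Data.List.Properties using (filter-all; filter-notAll; length-++)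
  open import Data.List.Relation.Unary.Any using (Any; here; there)
  import Data.List.Relation.Unary.Any as Any
  import Data.List.Relation.Unary.All as All
  import Data.List.Relation.Unary.All.Properties as All
  open import Data.List.Relation.Unary.AllPairs using ([]; _∷_)
  open import Data.List.Membership.Propositional using (_∈_; _∉_; lose; find)
  open import Data.List.Membership.Propositional.Properties using (∈-filter⁺; ∈-filter⁻; ∈-++⁺ˡ; ∈-++⁺ʳ; ∈-++⁻)
  open import Data.List.Relation.Unary.Unique.Propositional using (Unique)
  import Data.List.Relation.Unary.Unique.Propositional.Properties as Unique
  open import Data.Product using (_×_; _,_; ∃-syntax)
  open import Data.Sum using (inj₁; inj₂)
  open import Function using (_⇔_; mk⇔; Equivalence)
  open import Relation.Nullary using (¬_; Dec; yes; no; ¬?; contradiction)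
  open import Relation.Unary using (Decidable)
  open import Relation.Binary using (DecidableEquality)
  open import Relation.Binary.PropositionalEquality

  module _ {A : Set} (_≟_ : DecidableEquality A) where

    _∖_ : List A → A → List A
    xs ∖ u = filter (λ x → ¬? (x ≟ u)) xs

    ∈-∖⁺ : ∀ {u x xs} → x ∈ xs → x ≢ u → x ∈ (xs ∖ u)
    ∈-∖⁺ {u} = ∈-filter⁺ (λ x → ¬? (x ≟ u))

    ∈-∖⁻ : ∀ {u x} xs → x ∈ (xs ∖ u) → x ∈ xs × x ≢ u
    ∈-∖⁻ {u} _ = ∈-filter⁻ (λ x → ¬? (x ≟ u))

    ∖-unique : ∀ {u xs} → Unique xs → Unique (xs ∖ u)
    ∖-unique {u} = Unique.filter⁺ (λ x → ¬? (x ≟ u))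

    length-∖ : ∀ {u xs} → Unique xs → u ∈ xs → suc (length (xs ∖ u)) ≡ length xs
    length-∖ {u} {x ∷ xs} (x∉ ∷ uq) u∈ with x ≟ u
    ... | yes refl = cong suc (cong length (filter-all (λ y → ¬? (y ≟ u)) (All.map (λ p q → p (sym q)) x∉)))
    length-∖ {u} {x ∷ xs} (x∉ ∷ uq) (here refl) | no ¬p = contradiction refl ¬p
    length-∖ {u} {x ∷ xs} (x∉ ∷ uq) (there u∈)  | no ¬p = cong suc (length-∖ uq u∈)

    unique-⊆-length : ∀ {xs ys : List A} → Unique xs → (∀ {x} → x ∈ xs → x ∈ ys) → length xs ≤ length ys
    unique-⊆-length {[]} _ _ = z≤n
    unique-⊆-length {x ∷ xs} {ys} (x∉ ∷ uq) sub = ≤-trans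
      (s≤s (unique-⊆-length uq λ y∈ → ∈-∖⁺ (sub (there y∈)) λ where refl → All.lookup x∉ y∈ refl))
      (filter-notAll (λ y → ¬? (y ≟ x)) ys (lose (sub (here refl)) (λ ¬p → ¬p refl)))

    mem? : (x : A) (xs : List A) → Dec (x ∈ xs)
    mem? x = Any.any? (x ≟_)

    -- The pigeonhole principle behind every later choice of a vertex away from a bounded
    -- neighbourhood.
    pick : ∀ {xs} ys → Unique xs → length ys < length xs → ∃[ x ] x ∈ xs × x ∉ ys
    pick {xs} ys uq lt with Any.any? (λ x → ¬? (mem? x ys)) xs
    ... | yes p = let x , x∈ , x∉ = find p in x , x∈ , x∉
    ... | no ¬p = contradiction (unique-⊆-length uq sub) (<⇒≱ lt)
      where
      sub : ∀ {x} → x ∈ xs → x ∈ ys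
      sub {x} x∈ with mem? x ys
      ... | yes q = q
      ... | no ¬q = contradiction (lose x∈ ¬q) ¬p

    length-filter-split : ∀ {P : A → Set} (P? : Decidable P) xs →
      length xs ≡ length (filter P? xs) + length (filter (λ x → ¬? (P? x)) xs)
    length-filter-split P? [] = refl
    length-filter-split P? (x ∷ xs) with P? x
    ... | yes _ = cong suc (length-filter-split P? xs)
    ... | no  _ = trans (cong suc (length-filter-split P? xs)) (sym (+-suc _ _))

  sum-≤ : ∀ {A : Set} {f g : A → ℕ} xs → (∀ {x} → x ∈ xs → f x ≤ g x) → sum (map f xs) ≤ sum (map g xs)
  sum-≤ [] _ = z≤n
  sum-≤ (x ∷ xs) h = +-mono-≤ (h (here refl)) (sum-≤ xs (λ y∈ → h (there y∈)))

  sum-const : ∀ {A : Set} c (xs : List A) → sum (map (λ _ → c) xs) ≡ length xs * c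
  sum-const c [] = refl
  sum-const c (x ∷ xs) = cong (c +_) (sum-const c xs)

  sum-+ : ∀ {A : Set} (f g : A → ℕ) xs → sum (map (λ x → f x + g x) xs) ≡ sum (map f xs) + sum (map g xs)
  sum-+ f g [] = refl
  sum-+ f g (x ∷ xs) rewrite sum-+ f g xs = four (f x) (g x) _ _
    where
    open import Data.Nat.Tactic.RingSolver
    four : ∀ a b c d → a + b + (c + d) ≡ a + c + (b + d)
    four = solve-∀

  sum-*ˡ : ∀ {A : Set} c (f : A → ℕ) xs → sum (map (λ x → c * f x) xs) ≡ c * sum (map f xs)
  sum-*ˡ c f [] = sym (*-zeroʳ c)
  sum-*ˡ c f (x ∷ xs) rewrite sum-*ˡ c f xs = sym (*-distribˡ-+ c (f x) _)

  sum-split : ∀ {A : Set} {P : A → Set} (P? : Decidable P) (f : A → ℕ) xs →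
    sum (map f xs) ≡ sum (map f (filter P? xs)) + sum (map f (filter (λ x → ¬? (P? x)) xs))
  sum-split P? f [] = refl
  sum-split P? f (x ∷ xs) with P? x
  ... | yes _ = trans (cong (f x +_) (sum-split P? f xs)) (sym (+-assoc (f x) _ _))
  ... | no  _ = trans (cong (f x +_) (sum-split P? f xs)) (swap (f x) (sum (map f (filter P? xs))) _)
    where
    open import Data.Nat.Tactic.RingSolver
    swap : ∀ a b c → a + (b + c) ≡ b + (a + c)
    swap = solve-∀

  hasCount-⇔ : ∀ {A : Set} {P Q : A → Set} {N} → (∀ a → P a ⇔ Q a) → HasCount P N → HasCount Q N
  hasCount-⇔ eq (xs , uq , mem , len) = xs , uq ,
    (λ a → mk⇔ (λ a∈ → Equivalence.to (eq a) (Equivalence.to (mem a) a∈))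
               (λ qa → Equivalence.from (mem a) (Equivalence.from (eq a) qa))) , len

  hasCount-∃ : ∀ {A B : Set} {Q : B → A → Set} {N : B → ℕ} {us : List B} → Unique us →
    (∀ {u} → u ∈ us → HasCount (Q u) (N u)) →
    (∀ {u u′ a} → Q u a → Q u′ a → u ≡ u′) →
    HasCount (λ a → ∃[ u ] u ∈ us × Q u a) (sum (map N us))
  hasCount-∃ {us = []} _ _ _ = [] , [] , (λ a → mk⇔ (λ ()) (λ where (_ , () , _))) , refl
  hasCount-∃ {A} {B} {Q} {N} {u ∷ us} (u∉ ∷ uq) h disj
    with h (here refl) | hasCount-∃ {N = N} uq (λ u∈ → h (there u∈)) disj
  ... | xs , uqx , memx , lenx | ys , uqy , memy , leny =
    xs ++ ys , Unique.++⁺ uqx uqy apart , mem , trans (length-++ xs) (cong₂ _+_ lenx leny)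
    where
    apart : ∀ {a} → ¬ (a ∈ xs × a ∈ ys)
    apart {a} (a∈xs , a∈ys) =
      let (u′ , u′∈ , q′) = Equivalence.to (memy a) a∈ys
      in All.lookup u∉ u′∈ (disj (Equivalence.to (memx a) a∈xs) q′)
    to : ∀ a → a ∈ xs ++ ys → ∃[ v ] v ∈ u ∷ us × Q v a
    to a a∈ with ∈-++⁻ xs a∈
    ... | inj₁ p = u , here refl , Equivalence.to (memx a) p
    ... | inj₂ p = let (v , v∈ , q) = Equivalence.to (memy a) p in v , there v∈ , q
    from : ∀ a → ∃[ v ] v ∈ u ∷ us × Q v a → a ∈ xs ++ ys
    from a (v , here refl , q) = ∈-++⁺ˡ (Equivalence.from (memx a) q)
    from a (v , there v∈ , q)  = ∈-++⁺ʳ xs (Equivalence.from (memy a) (v , v∈ , q))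
    mem : ∀ a → a ∈ xs ++ ys ⇔ (∃[ v ] v ∈ u ∷ us × Q v a)
    mem a = mk⇔ (to a) (from a)

  hasCount-image : ∀ {A B : Set} {P : A → Set} {Q : B → Set} {N} (f : A → B) →
    (∀ {a a′} → P a → P a′ → f a ≡ f a′ → a ≡ a′) → (∀ {a} → P a → Q (f a)) →
    (∀ {b} → Q b → ∃[ a ] P a × b ≡ f a) → HasCount P N → HasCount Q N
  hasCount-image {A} {B} {P} {Q} f inj pres surj (xs , uq , mem , len) =
    map f xs , uniq xs uq (λ a∈ → Equivalence.to (mem _) a∈) ,
    (λ b → mk⇔ (to b) (from b)) , trans (length-map f xs) len
    where
    open import Data.List.Properties using (length-map)
    open import Data.List.Membership.Propositional.Properties using (∈-map⁺; ∈-map⁻)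
    uniq : ∀ ys → Unique ys → (∀ {a} → a ∈ ys → P a) → Unique (map f ys)
    uniq [] _ _ = []
    uniq (y ∷ ys) (y∉ ∷ u) h = All.map⁺ (All.tabulate λ {z} z∈ eq →
        All.lookup y∉ z∈ (inj (h (here refl)) (h (there z∈)) eq))
      ∷ uniq ys u (λ a∈ → h (there a∈))
    to : ∀ b → b ∈ map f xs → Q b
    to b b∈ with ∈-map⁻ f b∈
    ... | a , a∈ , refl = pres (Equivalence.to (mem a) a∈)
    from : ∀ b → Q b → b ∈ map f xs
    from b q with surj q
    ... | a , p , refl = ∈-map⁺ f (Equivalence.from (mem a) p)

-- Contracting a pair in a matching, and its effect on connectivity.

module Switching where

  open Finite
  open import Data.Nat using (ℕ; suc) renaming (_+_ to _+ℕ_)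
  open import Data.Fin using (Fin)
  import Data.Fin.Properties as Fin
  open import Data.List using (List; length)
  open import Data.List.Relation.Unary.Any using (here)
  open import Data.List.Membership.Propositional using (_∈_)
  open import Data.List.Relation.Unary.Unique.Propositional using (Unique)
  open import Data.Product using (_×_; _,_; ∃-syntax)
  open import Data.Sum using (_⊎_; inj₁; inj₂)
  open import Function using (_∘_)
  open import Relation.Nullary using (Dec; yes; no; contradiction)
  open import Relation.Binary.PropositionalEquality

  -- A perfect matching is represented by the involution exchanging the ends of its edges.
  record IsMatching {n} (τ : Fin n → Fin n) : Set where
    field
      invol : ∀ x → τ (τ x) ≡ x
      nofix : ∀ x → τ x ≢ x

    injective : ∀ {x y} → τ x ≡ τ y → x ≡ y
    injective {x} {y} eq = trans (sym (invol x)) (trans (cong τ eq) (invol y))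

    flip : ∀ {x y} → τ x ≡ y → τ y ≡ x
    flip {x} refl = invol x

  open IsMatching

  module _ {n : ℕ} where

    private V = Fin n

    infix 4 _≟_
    _≟_ : (x y : V) → Dec (x ≡ y)
    _≟_ = Fin._≟_

    -- Replace the edges at u and v by uv and τ(u)τ(v).
    switch : (V → V) → V → V → V → V
    switch τ u v x with x ≟ u | x ≟ v | x ≟ τ u | x ≟ τ v
    ... | yes _ | _     | _     | _     = v
    ... | no _  | yes _ | _     | _     = u
    ... | no _  | no _  | yes _ | _     = τ v
    ... | no _  | no _  | no _  | yes _ = τ u
    ... | no _  | no _  | no _  | no _  = τ x

    -- A view of `switch` indexed by its value: abstracting `switch τ u v x` together with
    -- `position τ u v x` yields the value and the reason for it in one match, instead of four
    -- nested comparisons.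
    data Position (τ : V → V) (u v x : V) : V → Set where
      at-u   : x ≡ u → Position τ u v x v
      at-v   : x ≡ v → Position τ u v x u
      at-τu  : x ≡ τ u → x ≢ u → x ≢ v → Position τ u v x (τ v)
      at-τv  : x ≡ τ v → x ≢ u → x ≢ v → Position τ u v x (τ u)
      away   : x ≢ u → x ≢ v → x ≢ τ u → x ≢ τ v → Position τ u v x (τ x)

    position : ∀ τ u v x → Position τ u v x (switch τ u v x)
    position τ u v x with x ≟ u | x ≟ v | x ≟ τ u | x ≟ τ v
    ... | yes p | _     | _     | _     = at-u p
    ... | no p  | yes q | _     | _     = at-v q
    ... | no p  | no q  | yes r | _     = at-τu r p q
    ... | no p  | no q  | no r  | yes s = at-τv s p q
    ... | no p  | no q  | no r  | no s  = away p q r s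

    switch-u : ∀ τ u v → switch τ u v u ≡ v
    switch-u τ u v with u ≟ u
    ... | yes _ = refl
    ... | no ¬p = contradiction refl ¬p

    switch-away : ∀ τ {u v x} → x ≢ u → x ≢ v → x ≢ τ u → x ≢ τ v → switch τ u v x ≡ τ x
    switch-away τ {u} {v} {x} p q r s with x ≟ u | x ≟ v | x ≟ τ u | x ≟ τ v
    ... | yes p′ | _     | _     | _     = contradiction p′ p
    ... | no _  | yes q′ | _     | _     = contradiction q′ q
    ... | no _  | no _  | yes r′ | _     = contradiction r′ r
    ... | no _  | no _  | no _  | yes s′ = contradiction s′ s
    ... | no _  | no _  | no _  | no _  = refl

    module _ {τ : V → V} (m : IsMatching τ) {u v : V} (u≢v : u ≢ v) (τu≢v : τ u ≢ v) where

      private τv≢u : τ v ≢ u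
              τv≢u eq = τu≢v (flip m eq)

      switch-v : switch τ u v v ≡ u
      switch-v with v ≟ u | v ≟ v
      ... | yes p | _     = contradiction (sym p) u≢v
      ... | no _  | yes _ = refl
      ... | no _  | no ¬p = contradiction refl ¬p

      switch-τu : switch τ u v (τ u) ≡ τ v
      switch-τu with τ u ≟ u | τ u ≟ v | τ u ≟ τ u
      ... | yes p | _     | _     = contradiction p (nofix m u)
      ... | no _  | yes p | _     = contradiction p τu≢v
      ... | no _  | no _  | yes _ = refl
      ... | no _  | no _  | no ¬p = contradiction refl ¬p

      switch-τv : switch τ u v (τ v) ≡ τ u
      switch-τv with τ v ≟ u | τ v ≟ v | τ v ≟ τ u | τ v ≟ τ v
      ... | yes p | _     | _     | _ = contradiction p τv≢u
      ... | no _  | yes p | _     | _ = contradiction p (nofix m v)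
      ... | no _  | no _  | yes p | _ = contradiction (sym (injective m p)) u≢v
      ... | no _  | no _  | no _  | yes _ = refl
      ... | no _  | no _  | no _  | no ¬p = contradiction refl ¬p

      switch-matching : IsMatching (switch τ u v)
      switch-matching .invol x with switch τ u v x | position τ u v x
      ... | _ | at-u refl = switch-v
      ... | _ | at-v refl = switch-u τ u v
      ... | _ | at-τu refl _ _ = switch-τv
      ... | _ | at-τv refl _ _ = switch-τu
      ... | _ | away p q r s = trans (switch-away τ (r ∘ sym ∘ flip m) (s ∘ sym ∘ flip m) (p ∘ injective m) (q ∘ injective m)) (invol m x)
      switch-matching .nofix x with switch τ u v x | position τ u v x
      ... | _ | at-u refl = u≢v ∘ sym
      ... | _ | at-v refl = u≢v
      ... | _ | at-τu refl _ _ = u≢v ∘ sym ∘ injective m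
      ... | _ | at-τv refl _ _ = u≢v ∘ injective m
      ... | _ | away p q r s = nofix m x

      switch-values : ∀ x → x ≢ u → x ≢ v →
        switch τ u v x ≡ τ x ⊎ switch τ u v x ≡ τ v ⊎ switch τ u v x ≡ τ u
      switch-values x p q with switch τ u v x | position τ u v x
      ... | _ | at-u e = contradiction e p
      ... | _ | at-v e = contradiction e q
      ... | _ | at-τu _ _ _ = inj₂ (inj₁ refl)
      ... | _ | at-τv _ _ _ = inj₂ (inj₂ refl)
      ... | _ | away _ _ _ _ = inj₁ refl

      switch-≢u : ∀ {x} → x ≢ v → switch τ u v x ≢ u
      switch-≢u p eq = p (sym (trans (sym (switch-u τ u v)) (flip switch-matching eq)))

      switch-≢v : ∀ {x} → x ≢ u → switch τ u v x ≢ v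
      switch-≢v p eq = p (sym (trans (sym switch-v) (flip switch-matching eq)))

    data Reach (σ τ : V → V) (x : V) : V → Set where
      here  : Reach σ τ x x
      via-σ : ∀ {y} → Reach σ τ x y → Reach σ τ x (σ y)
      via-τ : ∀ {y} → Reach σ τ x y → Reach σ τ x (τ y)

    reach-trans : ∀ {σ τ x y z} → Reach σ τ x y → Reach σ τ y z → Reach σ τ x z
    reach-trans p here = p
    reach-trans p (via-σ q) = via-σ (reach-trans p q)
    reach-trans p (via-τ q) = via-τ (reach-trans p q)

    Connected : List V → (σ τ : V → V) → Set
    Connected L σ τ = ∀ {x y} → x ∈ L → y ∈ L → Reach σ τ x y

    Closed : List V → (V → V) → Set
    Closed L τ = ∀ {x} → x ∈ L → τ x ∈ L

    delete : V → V → List V → List V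
    delete u v L = _∖_ _≟_ (_∖_ _≟_ L u) v

    ∈-delete⁺ : ∀ {u v x L} → x ∈ L → x ≢ u → x ≢ v → x ∈ delete u v L
    ∈-delete⁺ p q r = ∈-∖⁺ _≟_ (∈-∖⁺ _≟_ p q) r

    ∈-delete⁻ : ∀ {u v x} L → x ∈ delete u v L → x ∈ L × x ≢ u × x ≢ v
    ∈-delete⁻ L p with ∈-∖⁻ _≟_ _ p
    ... | q , r with ∈-∖⁻ _≟_ L q
    ... | s , t = s , t , r

    delete-unique : ∀ {u v L} → Unique L → Unique (delete u v L)
    delete-unique = ∖-unique _≟_ ∘ ∖-unique _≟_

    length-delete : ∀ {u v L} → Unique L → u ∈ L → v ∈ L → u ≢ v → 2 +ℕ length (delete u v L) ≡ length L
    length-delete uq u∈ v∈ u≢v = trans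
      (cong suc (length-∖ _≟_ (∖-unique _≟_ uq) (∈-∖⁺ _≟_ v∈ (u≢v ∘ sym)))) (length-∖ _≟_ uq u∈)

    switch-closed : ∀ {τ u v L} → IsMatching τ → u ≢ v → τ u ≢ v → u ∈ L → v ∈ L → Closed L τ →
      Closed (delete u v L) (switch τ u v)
    switch-closed {τ} {u} {v} {L} m u≢v τu≢v u∈ v∈ cl {x} x∈ with ∈-delete⁻ L x∈
    ... | x∈L , x≢u , x≢v = ∈-delete⁺ inL (switch-≢u m u≢v τu≢v x≢v) (switch-≢v m u≢v τu≢v x≢u)
      where
      inL : switch τ u v x ∈ L
      inL with switch-values m u≢v τu≢v x x≢u x≢v
      ... | inj₁ e = subst (_∈ L) (sym e) (cl x∈L)
      ... | inj₂ (inj₁ e) = subst (_∈ L) (sym e) (cl v∈)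
      ... | inj₂ (inj₂ e) = subst (_∈ L) (sym e) (cl u∈)

    module _ {σ τ : V → V} (mσ : IsMatching σ) (m : IsMatching τ) {u v : V} (u≢v : u ≢ v) (τu≢v : τ u ≢ v)
             (σu : σ u ≡ v) where

      private τ′ = switch τ u v
              σv : σ v ≡ u
              σv = flip mσ σu

      -- Bypassing u and v: a visit to u is replaced by its τ-neighbour.
      private
        data Bypass (x : V) : V → Set where
          u↦ : x ≡ u → Bypass x (τ u)
          v↦ : x ≡ v → Bypass x (τ v)
          id↦ : x ≢ u → x ≢ v → Bypass x x

        bypass : ∀ x → ∃[ y ] Bypass x y
        bypass x with x ≟ u | x ≟ v
        ... | yes p | _ = τ u , u↦ p
        ... | no _ | yes q = τ v , v↦ q
        ... | no p | no q = x , id↦ p q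

        bypass-unique : ∀ {x y z} → Bypass x y → Bypass x z → y ≡ z
        bypass-unique (u↦ _) (u↦ _) = refl
        bypass-unique (u↦ p) (v↦ q) = contradiction (trans (sym p) q) u≢v
        bypass-unique (u↦ p) (id↦ q _) = contradiction p q
        bypass-unique (v↦ p) (u↦ q) = contradiction (trans (sym q) p) u≢v
        bypass-unique (v↦ _) (v↦ _) = refl
        bypass-unique (v↦ p) (id↦ _ q) = contradiction p q
        bypass-unique (id↦ p _) (u↦ q) = contradiction q p
        bypass-unique (id↦ _ p) (v↦ q) = contradiction q p
        bypass-unique (id↦ _ _) (id↦ _ _) = refl

        -- A σ-step along uv becomes the single τ′-step between τ u and τ v. A τ-step into or out of
        -- u or v disappears, because its two ends have the same bypass.
        project : ∀ {x y x′ y′} → Reach σ τ x y → Bypass x x′ → Bypass y y′ → Reach σ τ′ x′ y′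
        project here bx by rewrite bypass-unique bx by = here
        project (via-σ {y} r) bx by with bypass y
        ... | y″ , b with project r bx b | b
        ... | r′ | u↦ refl rewrite bypass-unique by (v↦ σu) = subst (Reach σ τ′ _) (switch-τu m u≢v τu≢v) (via-τ r′)
        ... | r′ | v↦ refl rewrite bypass-unique by (u↦ σv) = subst (Reach σ τ′ _) (switch-τv m u≢v τu≢v) (via-τ r′)
        ... | r′ | id↦ p q rewrite bypass-unique by (id↦ (λ e → q (trans (sym (flip mσ e)) σu)) (λ e → p (trans (sym (flip mσ e)) σv))) = via-σ r′
        project (via-τ {y} r) bx by with bypass y
        ... | y″ , b with project r bx b | b
        ... | r′ | u↦ refl rewrite bypass-unique by (id↦ (nofix m u) τu≢v) = r′
        ... | r′ | v↦ refl rewrite bypass-unique by (id↦ (λ e → τu≢v (flip m e)) (nofix m v)) = r′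
        ... | r′ | id↦ p q with y ≟ τ u | y ≟ τ v
        ... | yes refl | _ rewrite bypass-unique by (u↦ (invol m u)) = r′
        ... | no _ | yes refl rewrite bypass-unique by (v↦ (invol m v)) = r′
        ... | no s | no t rewrite bypass-unique by (id↦ (λ e → s (sym (flip m e))) (λ e → t (sym (flip m e)))) =
          subst (Reach σ τ′ _) (switch-away τ p q s t) (via-τ r′)

        -- The new edge between τ u and τ v stands for the path τ u, u, v, τ v. On u and v
        -- themselves τ′ agrees with σ.
        lift : ∀ {x y} → Reach σ τ′ x y → Reach σ τ x y
        lift here = here
        lift (via-σ r) = via-σ (lift r)
        lift (via-τ {y} r) with switch τ u v y | position τ u v y
        ... | _ | at-u refl = subst (Reach σ τ _) σu (via-σ (lift r))
        ... | _ | at-v refl = subst (Reach σ τ _) σv (via-σ (lift r))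
        ... | _ | at-τu refl _ _ = via-τ (subst (Reach σ τ _) (trans (cong σ (invol m u)) σu) (via-σ (via-τ (lift r))))
        ... | _ | at-τv refl _ _ = via-τ (subst (Reach σ τ _) (trans (cong σ (invol m v)) σv) (via-σ (via-τ (lift r))))
        ... | _ | away _ _ _ _ = via-τ (lift r)

      connected-switch⁺ : ∀ {L} → Connected L σ τ → Connected (delete u v L) σ τ′
      connected-switch⁺ {L} c x∈ y∈ with ∈-delete⁻ L x∈ | ∈-delete⁻ L y∈
      ... | x∈L , p , q | y∈L , r , s = project (c x∈L y∈L) (id↦ p q) (id↦ r s)

      connected-switch⁻ : ∀ {L} → Closed L τ → u ∈ L → v ∈ L → Connected (delete u v L) σ τ′ → Connected L σ τ
      connected-switch⁻ {L} cl u∈ v∈ c {x} {y} x∈ y∈ =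
        let (x₁ , bx) = bypass x ; (y₁ , by) = bypass y
        in reach-trans (start bx) (reach-trans (lift (c (inside x∈ bx) (inside y∈ by))) (end by))
        where
        inside : ∀ {x y} → x ∈ L → Bypass x y → y ∈ delete u v L
        inside x∈ (u↦ refl) = ∈-delete⁺ (cl u∈) (nofix m u) τu≢v
        inside x∈ (v↦ refl) = ∈-delete⁺ (cl v∈) (λ e → τu≢v (flip m e)) (nofix m v)
        inside x∈ (id↦ p q) = ∈-delete⁺ x∈ p q
        start : ∀ {x y} → Bypass x y → Reach σ τ x y
        start (u↦ refl) = via-τ here
        start (v↦ refl) = via-τ here
        start (id↦ _ _) = here
        end : ∀ {x y} → Bypass x y → Reach σ τ y x
        end (u↦ refl) = subst (Reach σ τ (τ u)) (invol m u) (via-τ here)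
        end (v↦ refl) = subst (Reach σ τ (τ v)) (invol m v) (via-τ here)
        end (id↦ _ _) = here

-- The recursion for the number of solutions, and its correctness.

module Counting where

  open Finite
  open Switching
  open import Defs using (HasCount)
  open import Data.Nat using (ℕ; zero; suc; s≤s; z≤n; _+_; _*_; _≤_; _<_)
  open import Data.Nat.Properties hiding (_≟_)
  open import Data.Nat.ListAction using (sum)
  open import Data.Fin using (Fin)
  import Data.Fin.Properties as Fin
  open import Data.List using (List; []; _∷_; _++_; length; filter; map; allFin)
  open import Data.List.Properties using (length-map; length-tabulate)
  open import Data.List.Relation.Unary.Any using (here; there)
  open import Data.List.Relation.Unary.All using ([]; _∷_)
  open import Data.List.Relation.Unary.AllPairs using ([]; _∷_)
  open import Data.List.Membership.Propositional using (_∈_; _∉_)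
  open import Data.List.Membership.Propositional.Properties using (∈-filter⁺; ∈-filter⁻; ∈-map⁺; ∈-map⁻; ∈-allFin)
  open import Data.List.Relation.Unary.Unique.Propositional using (Unique)
  import Data.List.Relation.Unary.Unique.Propositional.Properties as Unique
  open import Data.Vec using (Vec; lookup; tabulate)
  open import Data.Vec.Properties using (lookup∘tabulate; tabulate∘lookup; tabulate-cong)
  open import Data.Product using (_×_; _,_; proj₁; proj₂; ∃-syntax)
  open import Data.Sum using (_⊎_; inj₁; inj₂)
  open import Function using (_⇔_; mk⇔; _∘_)
  open import Relation.Nullary using (¬_; Dec; yes; no; ¬?; contradiction)
  open import Relation.Nullary.Decidable using (_×-dec_)
  open import Relation.Binary using (Decidable)
  open import Relation.Binary.PropositionalEquality

  open IsMatching

  _≢?_ : ∀ {k} → Decidable {A = Fin k} _≢_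
  i ≢? j = ¬? (i Fin.≟ j)

  vec-ext : ∀ {A : Set} {n} {σ ρ : Vec A n} → (∀ x → lookup σ x ≡ lookup ρ x) → σ ≡ ρ
  vec-ext {σ = σ} {ρ} eq = trans (sym (tabulate∘lookup σ)) (trans (tabulate-cong eq) (tabulate∘lookup ρ))

  module _ {n : ℕ} where

    private V = Fin n

    pair : (V → V) → V → V → V → V
    pair e u v x with x ≟ u | x ≟ v
    ... | yes _ | _ = v
    ... | no _ | yes _ = u
    ... | no _ | no _ = e x

    pair-u : ∀ e u v → pair e u v u ≡ v
    pair-u e u v with u ≟ u
    ... | yes _ = refl
    ... | no ¬p = contradiction refl ¬p

    pair-v : ∀ e {u v} → u ≢ v → pair e u v v ≡ u
    pair-v e {u} {v} u≢v with v ≟ u | v ≟ v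
    ... | yes p | _ = contradiction (sym p) u≢v
    ... | no _ | yes _ = refl
    ... | no _ | no ¬p = contradiction refl ¬p

    pair-else : ∀ e {u v x} → x ≢ u → x ≢ v → pair e u v x ≡ e x
    pair-else e {u} {v} {x} p q with x ≟ u | x ≟ v
    ... | yes p′ | _ = contradiction p′ p
    ... | no _ | yes q′ = contradiction q′ q
    ... | no _ | no _ = refl

    -- e records the edges already chosen outside L.
    record Outer (L : List V) (e : V → V) : Set where
      field
        leaves : ∀ {x} → x ∉ L → e x ∉ L
        return : ∀ {x} → x ∉ L → e (e x) ≡ x
        moves  : ∀ {x} → x ∉ L → e x ≢ x

    outer-pair : ∀ {L e u v} → u ≢ v → u ∈ L → v ∈ L → Outer L e → Outer (delete u v L) (pair e u v)
    outer-pair {L} {e} {u} {v} u≢v u∈ v∈ o = record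
      { leaves = λ x∉ x∈ → leaves′ x∉ x∈
      ; return = λ {x} → return′ x
      ; moves = λ {x} → moves′ x }
      where
      open Outer o
      off : ∀ {x} → x ∉ delete u v L → x ≢ u → x ≢ v → x ∉ L
      off x∉ p q x∈ = x∉ (∈-delete⁺ x∈ p q)
      ≢L : ∀ {x y} → x ∉ L → y ∈ L → x ≢ y
      ≢L x∉ y∈ refl = x∉ y∈
      leaves′ : ∀ {x} → x ∉ delete u v L → pair e u v x ∉ delete u v L
      leaves′ {x} x∉ x∈ with x ≟ u | x ≟ v
      ... | yes _ | _ = proj₂ (proj₂ (∈-delete⁻ L x∈)) refl
      ... | no _ | yes _ = proj₁ (proj₂ (∈-delete⁻ L x∈)) refl
      ... | no p | no q = leaves (off x∉ p q) (proj₁ (∈-delete⁻ L x∈))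
      return′ : ∀ x → x ∉ delete u v L → pair e u v (pair e u v x) ≡ x
      return′ x x∉ with x ≟ u | x ≟ v
      ... | yes refl | _ = pair-v e u≢v
      ... | no _ | yes refl = pair-u e u v
      ... | no p | no q = let x∉L = off x∉ p q in
        trans (pair-else e (≢L (leaves x∉L) u∈) (≢L (leaves x∉L) v∈)) (return x∉L)
      moves′ : ∀ x → x ∉ delete u v L → pair e u v x ≢ x
      moves′ x x∉ with x ≟ u | x ≟ v
      ... | yes refl | _ = u≢v ∘ sym
      ... | no _ | yes refl = u≢v
      ... | no p | no q = moves (off x∉ p q)

  module _ {n k : ℕ} where

    private V = Fin n

    switchAll : (Fin k → V → V) → V → V → Fin k → V → V
    switchAll τ u v i = switch (τ i) u v

    -- If τ i u = v, then joining u and v closes a cycle of length 2; `solves-valid` shows that no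
    -- solution does this while more than two vertices are live.
    Valid : (Fin k → V → V) → V → V → Set
    Valid τ u v = ∀ i → τ i u ≢ v

    valid? : ∀ τ u v → Dec (Valid τ u v)
    valid? τ u v = Fin.all? (λ i → ¬? (τ i u ≟ v))

    -- The edges already chosen are only asserted to exist, since `count` depends on `L` and `τ`
    -- alone; a witness is taken out when a solution is turned into a positive count.
    record State (L : List V) (τ : Fin k → V → V) : Set where
      field
        unique   : Unique L
        matching : ∀ i → IsMatching (τ i)
        closed   : ∀ i → Closed L (τ i)
        outer    : ∃[ e ] Outer L e

    state-switch : ∀ {L τ u v} → State L τ → u ∈ L → v ∈ L → u ≢ v → Valid τ u v →
      State (delete u v L) (switchAll τ u v)
    state-switch s u∈ v∈ u≢v val = record
      { unique = delete-unique unique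
      ; matching = λ i → switch-matching (matching i) u≢v (val i)
      ; closed = λ i → switch-closed (matching i) u≢v (val i) u∈ v∈ (closed i)
      ; outer = _ , outer-pair u≢v u∈ v∈ (proj₂ outer) }
      where open State s

    -- σ is a vector rather than a function, so that pointwise equal solutions are equal and can be
    -- listed without repetition.
    record Solves (L : List V) (e : V → V) (τ : Fin k → V → V) (σ : Vec V n) : Set where
      field
        matching  : IsMatching (lookup σ)
        closed    : Closed L (lookup σ)
        outside   : ∀ {x} → x ∉ L → lookup σ x ≡ e x
        connected : ∀ i → Connected L (lookup σ) (τ i)

    module _ {L : List V} {e : V → V} {τ : Fin k → V → V} {u v : V} (s : State L τ) (u∈ : u ∈ L) (v∈ : v ∈ L) (u≢v : u ≢ v) (val : Valid τ u v) where

      private module S = State s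

      solves-switch⁺ : ∀ {σ} → Solves L e τ σ → lookup σ u ≡ v →
        Solves (delete u v L) (pair e u v) (switchAll τ u v) σ
      solves-switch⁺ {σ} sol σu = record
        { matching = matching
        ; closed = λ x∈ → let (x∈L , p , q) = ∈-delete⁻ L x∈ in
            ∈-delete⁺ (closed x∈L) (λ eq → q (trans (sym (flip matching eq)) σu)) (λ eq → p (trans (sym (flip matching eq)) σv))
        ; outside = λ {x} → outside′ x
        ; connected = λ i → connected-switch⁺ matching (S.matching i) u≢v (val i) σu (connected i) }
        where
        open Solves sol
        σv : lookup σ v ≡ u
        σv = flip matching σu
        outside′ : ∀ x → x ∉ delete u v L → lookup σ x ≡ pair e u v x
        outside′ x x∉ with x ≟ u | x ≟ v
        ... | yes refl | _ = σu
        ... | no _ | yes refl = σv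
        ... | no p | no q = outside (λ x∈ → x∉ (∈-delete⁺ x∈ p q))

      solves-switch⁻ : ∀ {σ} → Solves (delete u v L) (pair e u v) (switchAll τ u v) σ →
        Solves L e τ σ × lookup σ u ≡ v
      solves-switch⁻ {σ} sol = record
        { matching = matching
        ; closed = λ {x} → closed′ x
        ; outside = λ {x} x∉ → trans (outside (x∉ ∘ proj₁ ∘ ∈-delete⁻ L))
            (pair-else e (λ where refl → x∉ u∈) (λ where refl → x∉ v∈))
        ; connected = λ i → connected-switch⁻ matching (S.matching i) u≢v (val i) σu (S.closed i) u∈ v∈ (connected i) }
        , σu
        where
        open Solves sol
        σu : lookup σ u ≡ v
        σu = trans (outside (λ p → proj₁ (proj₂ (∈-delete⁻ L p)) refl)) (pair-u e u v)
        closed′ : ∀ x → x ∈ L → lookup σ x ∈ L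
        closed′ x x∈ with x ≟ u | x ≟ v
        ... | yes refl | _ = subst (_∈ L) (sym σu) v∈
        ... | no _ | yes refl = subst (_∈ L) (sym (flip matching σu)) u∈
        ... | no p | no q = proj₁ (∈-delete⁻ L (closed (∈-delete⁺ x∈ p q)))

    -- R selects which pairs of matchings are watched: all distinct pairs in the counting, all but
    -- one pair while two matchings are being made to agree.
    Overlap : (R : Fin k → Fin k → Set) → (Fin k → V → V) → V → Set
    Overlap R τ w = ∃[ i ] ∃[ j ] R i j × τ i w ≡ τ j w

    overlap? : ∀ {R} → Decidable R → ∀ τ w → Dec (Overlap R τ w)
    overlap? R? τ w = Fin.any? (λ i → Fin.any? (λ j → R? i j ×-dec (τ i w ≟ τ j w)))

    overlapped : ∀ {R} → Decidable R → List V → (Fin k → V → V) → List V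
    overlapped R? L τ = filter (overlap? R? τ) L

    choices : List V → (Fin k → V → V) → V → List V
    choices L τ u = filter (valid? τ u) (_∖_ _≟_ L u)

    ∈-choices⁻ : ∀ {L τ u v} → v ∈ choices L τ u → v ∈ L × u ≢ v × Valid τ u v
    ∈-choices⁻ {L} {τ} {u} v∈ = let (p , val) = ∈-filter⁻ (valid? τ u) v∈ ; (q , v≢u) = ∈-∖⁻ _≟_ L p in
      q , v≢u ∘ sym , val

    ∈-choices⁺ : ∀ {L τ u v} → v ∈ L → u ≢ v → Valid τ u v → v ∈ choices L τ u
    ∈-choices⁺ {L} {τ} {u} v∈ u≢v val = ∈-filter⁺ (valid? τ u) (∈-∖⁺ _≟_ v∈ (u≢v ∘ sym)) val

    choices-unique : ∀ L τ u → Unique L → Unique (choices L τ u)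
    choices-unique L τ u uq = Unique.filter⁺ (valid? τ u) (∖-unique _≟_ uq)

    module _ {L τ u} (s : State L τ) (u∈ : u ∈ L) where

      open State s

      private
        invalid = filter (λ v → ¬? (valid? τ u v)) (_∖_ _≟_ L u)

        total : suc (length (choices L τ u) + length invalid) ≡ length L
        total = trans (cong suc (sym (length-filter-split _≟_ (valid? τ u) (_∖_ _≟_ L u)))) (length-∖ _≟_ unique u∈)

        nbrs = map (λ i → τ i u) (allFin k)

        length-nbrs : length nbrs ≡ k
        length-nbrs = trans (length-map _ (allFin k)) (length-tabulate (λ i → i))

        invalid≤k : length invalid ≤ k
        invalid≤k = subst (length invalid ≤_) length-nbrs (unique-⊆-length _≟_ (Unique.filter⁺ _ (∖-unique _≟_ unique)) sub)
          where
          sub : ∀ {x} → x ∈ invalid → x ∈ nbrs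
          sub {x} x∈ with proj₂ (∈-filter⁻ (λ v → ¬? (valid? τ u v)) {xs = _∖_ _≟_ L u} x∈)
          ... | ¬val with Fin.¬∀⟶∃¬ k _ (λ i → ¬? (τ i u ≟ x)) ¬val
          ... | i , ¬¬p with τ i u ≟ x
          ... | yes refl = ∈-map⁺ (λ i → τ i u) (∈-allFin i)
          ... | no ¬p = contradiction ¬p ¬¬p

      length-choices-< : length (choices L τ u) < length L
      length-choices-< = ≤-trans (s≤s (m≤m+n _ _)) (≤-reflexive total)

      length-choices-≥ : length L ≤ suc (length (choices L τ u) + k)
      length-choices-≥ = ≤-trans (≤-reflexive (sym total)) (s≤s (+-monoʳ-≤ _ invalid≤k))

      length-choices-≡ : ¬ Overlap _≢_ τ u → suc (length (choices L τ u) + k) ≡ length L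
      length-choices-≡ ¬ov = ≤-antisym (≤-trans (s≤s (+-monoʳ-≤ _ k≤)) (≤-reflexive total)) length-choices-≥
        where
        sub : ∀ {x} → x ∈ nbrs → x ∈ invalid
        sub x∈ with ∈-map⁻ (λ i → τ i u) x∈
        ... | i , _ , refl = ∈-filter⁺ (λ v → ¬? (valid? τ u v)) (∈-∖⁺ _≟_ (closed i u∈) (nofix (matching i) u)) (λ val → val i refl)
        inj : ∀ {i j} → τ i u ≡ τ j u → i ≡ j
        inj {i} {j} eq with i Fin.≟ j
        ... | yes p = p
        ... | no ¬p = contradiction (i , j , ¬p , eq) ¬ov
        k≤ : k ≤ length invalid
        k≤ = subst (_≤ length invalid) length-nbrs (unique-⊆-length _≟_ (Unique.map⁺ inj (Unique.allFin⁺ k)) sub)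

    private
      branch : (List V → (Fin k → V → V) → ℕ) → List V → List V → (Fin k → V → V) → ℕ
      branch f [] L τ = 0
      branch f (u ∷ _) L τ = sum (map (λ v → f (delete u v L) (switchAll τ u v)) (choices L τ u))

    -- The recursion branches on the partner of an overlapped vertex whenever there is one.
    count : ℕ → List V → (Fin k → V → V) → ℕ
    count 0 L τ = 1
    -- On two live vertices every τ i joins them, so `Valid` would reject the one edge that closes
    -- all the cycles; the last pair is therefore counted directly.
    count 1 L τ = 1
    count (suc (suc t)) L τ = branch (count (suc t)) (overlapped _≢?_ L τ ++ L) L τ

    count-pivot : ∀ t {L τ} → 0 < length L → ∃[ u ] u ∈ L × (Overlap _≢_ τ u ⊎ overlapped _≢?_ L τ ≡ []) ×
      count (suc (suc t)) L τ ≡ sum (map (λ v → count (suc t) (delete u v L) (switchAll τ u v)) (choices L τ u))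
    count-pivot t {L} {τ} pos = go (overlapped _≢?_ L τ) L pos refl
      where
      go : ∀ us L → 0 < length L → overlapped _≢?_ L τ ≡ us →
        ∃[ u ] u ∈ L × (Overlap _≢_ τ u ⊎ overlapped _≢?_ L τ ≡ []) ×
        branch (count (suc t)) (us ++ L) L τ ≡ sum (map (λ v → count (suc t) (delete u v L) (switchAll τ u v)) (choices L τ u))
      go [] (x ∷ L) pos eq = x , here refl , inj₂ eq , refl
      go (u ∷ us) L pos eq =
        let (p , q) = ∈-filter⁻ (overlap? _≢?_ τ) {xs = L} (subst (u ∈_) (sym eq) (here refl)) in u , p , inj₁ q , refl

    solves-[] : ∀ {e τ} → Outer [] e → ∀ σ → σ ∈ (tabulate e ∷ []) ⇔ Solves [] e τ σ
    solves-[] {e} {τ} o σ = mk⇔ (λ where (here refl) → sol) (λ s → here (vec-ext λ x →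
        trans (Solves.outside s (λ ())) (sym (lookup∘tabulate e x))))
      where
      open Outer o
      sol : Solves [] e τ (tabulate e)
      sol = record
        { matching = record
          { invol = λ x → trans (cong (lookup (tabulate e)) (lookup∘tabulate e x)) (trans (lookup∘tabulate e (e x)) (return (λ ())))
          ; nofix = λ x eq → moves (λ ()) (trans (sym (lookup∘tabulate e x)) eq) }
        ; closed = λ ()
        ; outside = λ {x} _ → lookup∘tabulate e x
        ; connected = λ _ () }

    solves-pair : ∀ {e τ u v} → u ≢ v → ∀ σ → Solves [] (pair e u v) τ σ ⇔ Solves (u ∷ v ∷ []) e τ σ
    solves-pair {e} {τ} {u} {v} u≢v σ = mk⇔ to from
      where
      to : Solves [] (pair e u v) τ σ → Solves (u ∷ v ∷ []) e τ σ
      to s = record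
        { matching = matching
        ; closed = λ where
            (here refl) → there (here σu)
            (there (here refl)) → here σv
        ; outside = λ x∉ → trans (outside (λ ())) (pair-else e (x∉ ∘ here) (x∉ ∘ there ∘ here))
        ; connected = λ i → λ where
            (here refl) (here refl) → here
            (here refl) (there (here refl)) → subst (Reach _ _ _) σu (via-σ here)
            (there (here refl)) (here refl) → subst (Reach _ _ _) σv (via-σ here)
            (there (here refl)) (there (here refl)) → here }
        where
        open Solves s
        σu : lookup σ u ≡ v
        σu = trans (outside (λ ())) (pair-u e u v)
        σv : lookup σ v ≡ u
        σv = trans (outside (λ ())) (pair-v e u≢v)
      from : Solves (u ∷ v ∷ []) e τ σ → Solves [] (pair e u v) τ σ
      from s = record
        { matching = matching ; closed = λ () ; outside = λ {x} _ → out x ; connected = λ _ () }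
        where
        open Solves s
        σu : lookup σ u ≡ v
        σu with closed (here refl)
        ... | here p = contradiction p (nofix matching u)
        ... | there (here p) = p
        out : ∀ x → lookup σ x ≡ pair e u v x
        out x with x ≟ u | x ≟ v
        ... | yes refl | _ = σu
        ... | no _ | yes refl = flip matching σu
        ... | no p | no q = outside λ where
          (here r) → p r
          (there (here r)) → q r

    -- If τ i u = σ u, then u and σ u form a set closed under both involutions, so a third vertex of
    -- `L` could not be reached from u.
    solves-valid : ∀ {L e τ σ u} → State L τ → u ∈ L → 2 < length L → Solves L e τ σ → Valid τ u (lookup σ u)
    solves-valid {L} {e} {τ} {σ} {u} s u∈ lt sol i eq
      with pick _≟_ (u ∷ lookup σ u ∷ []) (State.unique s) lt
    ... | x , x∈ , x∉ = x∉ (stuck (connected i u∈ x∈))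
      where
      open Solves sol
      stuck : ∀ {y} → Reach (lookup σ) (τ i) u y → y ∈ u ∷ lookup σ u ∷ []
      stuck here = here refl
      stuck (via-σ r) with stuck r
      ... | here refl = there (here refl)
      ... | there (here refl) = here (invol matching u)
      stuck (via-τ r) with stuck r
      ... | here refl = there (here eq)
      ... | there (here refl) = here (flip (State.matching s i) eq)

    Counted : ℕ → Set
    Counted t = ∀ {L e τ} → State L τ → Outer L e → length L ≡ 2 * t → HasCount (Solves L e τ) (count t L τ)

    -- Solutions are sorted by the partner v of the pivot u. Those with partner v are exactly the
    -- solutions of the contracted instance whose outer edges include uv.
    hasCount-step : ∀ t → Counted (suc t) → Counted (suc (suc t))
    hasCount-step t ih {L} {e} {τ} s o len
      with count-pivot t {L} {τ} (subst (0 <_) (sym len) (s≤s z≤n))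
    ... | u , u∈ , _ , eq = subst (HasCount _) (sym eq)
        (hasCount-⇔ (λ σ → mk⇔ to from) (hasCount-∃ (choices-unique L τ u (State.unique s)) sub disj))
      where
      four : 2 < 2 * suc (suc t)
      four = subst (2 <_) (*-comm (suc (suc t)) 2) (s≤s (s≤s (s≤s z≤n)))
      Q : V → Vec V n → Set
      Q v = Solves (delete u v L) (pair e u v) (switchAll τ u v)
      sub : ∀ {v} → v ∈ choices L τ u → HasCount (λ σ → v ∈ choices L τ u × Q v σ) (count (suc t) (delete u v L) (switchAll τ u v))
      sub {v} v∈ = let (v∈L , u≢v , val) = ∈-choices⁻ {L} {τ} v∈ in
        hasCount-⇔ {P = Q v} (λ σ → mk⇔ (λ q → v∈ , q) proj₂)
          (ih (state-switch s u∈ v∈L u≢v val) (outer-pair u≢v u∈ v∈L o)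
            (suc-injective (suc-injective (trans (length-delete (State.unique s) u∈ v∈L u≢v)
              (trans len (cong suc (+-suc (suc t) (suc t + 0))))))))
      back : ∀ {v σ} → v ∈ choices L τ u × Q v σ → Solves L e τ σ × lookup σ u ≡ v
      back (v∈ , q) = let (v∈L , u≢v , val) = ∈-choices⁻ {L} {τ} v∈ in solves-switch⁻ {τ = τ} s u∈ v∈L u≢v val q
      disj : ∀ {v v′ σ} → v ∈ choices L τ u × Q v σ → v′ ∈ choices L τ u × Q v′ σ → v ≡ v′
      disj p q = trans (sym (proj₂ (back p))) (proj₂ (back q))
      to : ∀ {σ} → ∃[ v ] v ∈ choices L τ u × v ∈ choices L τ u × Q v σ → Solves L e τ σ
      to (_ , _ , p) = proj₁ (back p)
      from : ∀ {σ} → Solves L e τ σ → ∃[ v ] v ∈ choices L τ u × v ∈ choices L τ u × Q v σ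
      from {σ} sol = v , v∈ , v∈ , solves-switch⁺ {τ = τ} s u∈ v∈L u≢v val sol refl
        where
        v = lookup σ u
        val = solves-valid s u∈ (subst (2 <_) (sym len) four) sol
        v∈L = Solves.closed sol u∈
        u≢v : u ≢ v
        u≢v = nofix (Solves.matching sol) u ∘ sym
        v∈ = ∈-choices⁺ {L} {τ} v∈L u≢v val

    hasCount : ∀ t {L e τ} → State L τ → Outer L e → length L ≡ 2 * t → HasCount (Solves L e τ) (count t L τ)
    hasCount zero {[]} s o len = _ ∷ [] , [] ∷ [] , solves-[] o , refl
    hasCount (suc zero) {u ∷ v ∷ []} {e} {τ} s o len =
      hasCount-⇔ (solves-pair u≢v) (_ ∷ [] , [] ∷ [] , solves-[] o′ , refl)
      where
      u≢v : u ≢ v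
      u≢v with State.unique s
      ... | (p ∷ []) ∷ _ = p
      o′ : Outer [] (pair e u v)
      o′ with outer-pair {e = e} u≢v (here refl) (there (here refl)) o
      ... | record { leaves = l ; return = i ; moves = f } = record
        { leaves = λ _ () ; return = λ {x} _ → i {x} none ; moves = λ {x} _ → f {x} none }
        where
        none : ∀ {x} → x ∉ delete u v (u ∷ v ∷ [])
        none x∈ with ∈-delete⁻ (u ∷ v ∷ []) x∈
        ... | here p , q , _ = q p
        ... | there (here p) , _ , q = q p
    hasCount (suc (suc t)) = hasCount-step t (hasCount (suc t))

-- How a contraction changes the set of coincidences.

module Overlaps where

  open Finite
  open Switching
  open Counting
  open import Data.Nat using (ℕ; zero; suc; s≤s; _+_; _*_; _^_; _≤_; _<_)
  open import Data.Nat.Properties hiding (_≟_)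
  open import Data.Nat.ListAction using (sum)
  open import Data.Nat.Tactic.RingSolver
  open import Data.Fin using (Fin)
  open import Data.List using (List; []; _∷_; _++_; length; filter; map; allFin)
  open import Data.List.Properties using (length-map; length-tabulate; length-++)
  open import Data.List.Relation.Unary.Any using (here; there)
  open import Data.List.Membership.Propositional using (_∈_)
  open import Data.List.Membership.Propositional.Properties using (∈-filter⁺; ∈-filter⁻; ∈-map⁺; ∈-allFin; ∈-++⁺ˡ; ∈-++⁺ʳ)
  open import Data.List.Relation.Unary.Unique.Propositional using (Unique)
  import Data.List.Relation.Unary.Unique.Propositional.Properties as Unique
  open import Data.Product using (_×_; _,_; proj₁; proj₂; ∃-syntax)
  open import Function using (_∘_)
  open import Relation.Nullary using (¬_; Dec; yes; no; ¬?; contradiction)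
  open import Relation.Binary using (Decidable)
  open import Relation.Binary.PropositionalEquality

  open IsMatching

  module _ {n k : ℕ} where

    private V = Fin n

    neighbours : (Fin k → V → V) → List V → List V
    neighbours τ [] = []
    neighbours τ (x ∷ xs) = map (λ i → τ i x) (allFin k) ++ neighbours τ xs

    ball : (Fin k → V → V) → ℕ → List V → List V
    ball τ zero xs = xs
    ball τ (suc r) xs = ball τ r xs ++ neighbours τ (ball τ r xs)

    ∈-neighbours : ∀ τ {x xs} i → x ∈ xs → τ i x ∈ neighbours τ xs
    ∈-neighbours τ i (here refl) = ∈-++⁺ˡ (∈-map⁺ (λ i → τ i _) (∈-allFin i))
    ∈-neighbours τ i (there x∈) = ∈-++⁺ʳ (map _ (allFin k)) (∈-neighbours τ i x∈)

    length-neighbours : ∀ τ xs → length (neighbours τ xs) ≡ length xs * k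
    length-neighbours τ [] = refl
    length-neighbours τ (x ∷ xs) = trans (length-++ (map _ (allFin k)))
      (cong₂ _+_ (trans (length-map _ (allFin k)) (length-tabulate (λ i → i))) (length-neighbours τ xs))

    length-ball : ∀ τ r xs → length (ball τ r xs) ≡ suc k ^ r * length xs
    length-ball τ zero xs = sym (*-identityˡ _)
    length-ball τ (suc r) xs = begin
      length (ball τ r xs ++ neighbours τ (ball τ r xs)) ≡⟨ length-++ (ball τ r xs) ⟩
      l + length (neighbours τ (ball τ r xs))            ≡⟨ cong (l +_) (length-neighbours τ (ball τ r xs)) ⟩
      l + l * k                                          ≡⟨ *-suc l k ⟨
      l * suc k                                          ≡⟨ cong (_* suc k) (length-ball τ r xs) ⟩
      suc k ^ r * length xs * suc k                      ≡⟨ swap (suc k ^ r) (length xs) (suc k) ⟩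
      suc k ^ suc r * length xs                          ∎
      where
      open ≡-Reasoning
      l = length (ball τ r xs)
      swap : ∀ a b c → a * b * c ≡ c * a * b
      swap = solve-∀

    -- Proofs use this inductive form of distance; `ball` is its enumeration, with repetitions,
    -- whose length is a plain power of k + 1.
    data Near (τ : Fin k → V → V) (xs : List V) : ℕ → V → Set where
      base : ∀ {r x} → x ∈ xs → Near τ xs r x
      step : ∀ {r x} i → Near τ xs r x → Near τ xs (suc r) (τ i x)

    weaken : ∀ {τ xs r x} → Near τ xs r x → Near τ xs (suc r) x
    weaken (base x∈) = base x∈
    weaken (step i p) = step i (weaken p)

    near⇒∈ball : ∀ {τ xs r x} → Near τ xs r x → x ∈ ball τ r xs
    near⇒∈ball {r = zero} (base x∈) = x∈
    near⇒∈ball {r = suc r} (base x∈) = ∈-++⁺ˡ (near⇒∈ball {r = r} (base x∈))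
    near⇒∈ball {τ} {xs} {suc r} (step i p) = ∈-++⁺ʳ (ball τ r xs) (∈-neighbours τ i (near⇒∈ball p))

    Far : (Fin k → V → V) → List V → ℕ → V → Set
    Far τ xs r x = ¬ Near τ xs r x

    far-weaken : ∀ {τ xs r x} → Far τ xs (suc r) x → Far τ xs r x
    far-weaken f = f ∘ weaken

    far-step : ∀ {τ xs r x} → (∀ i → IsMatching (τ i)) → ∀ i → Far τ xs (suc r) x → Far τ xs r (τ i x)
    far-step m i f p = f (subst (Near _ _ _) (invol (m i) _) (step i p))

    module _ {τ : Fin k → V → V} (m : ∀ i → IsMatching (τ i)) {u v : V} where

      far⇒valid : Far τ (u ∷ []) 1 v → Valid τ u v
      far⇒valid f i refl = f (step i (base (here refl)))

      -- If uv is at distance more than 3 then joining it creates no new coincidence.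
      switch-coincide-far : Far τ (u ∷ []) 3 v → ∀ {w} i j → w ≢ u → w ≢ v →
        switch (τ i) u v w ≡ switch (τ j) u v w → τ i w ≡ τ j w
      switch-coincide-far v∉ {w} i j w≢u w≢v eq
        with switch (τ i) u v w | position (τ i) u v w | switch (τ j) u v w | position (τ j) u v w
      ... | _ | at-u p | _ | _ = contradiction p w≢u
      ... | _ | at-v p | _ | _ = contradiction p w≢v
      ... | _ | _ | _ | at-u p = contradiction p w≢u
      ... | _ | _ | _ | at-v p = contradiction p w≢v
      ... | _ | at-τu p _ _ | _ | at-τu q _ _ = trans (flip (m i) (sym p)) (sym (flip (m j) (sym q)))
      ... | _ | at-τv p _ _ | _ | at-τv q _ _ = trans (flip (m i) (sym p)) (sym (flip (m j) (sym q)))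
      ... | _ | away _ _ _ _ | _ | away _ _ _ _ = eq
      ... | _ | at-τu p _ _ | _ | at-τv q _ _ =
        contradiction (subst (Near τ (u ∷ []) 3) (flip (m j) (trans (sym q) p)) (weaken (step j (step i (base (here refl)))))) v∉
      ... | _ | at-τv p _ _ | _ | at-τu q _ _ =
        contradiction (subst (Near τ (u ∷ []) 3) (flip (m i) (trans (sym p) q)) (weaken (step i (step j (base (here refl)))))) v∉
      -- Here w = τ i u, and its new i-partner τ i v equals τ j w, so v = τ i (τ j (τ i u)). Cases
      -- of this kind force the distance 3.
      ... | _ | at-τu refl _ _ | _ | away _ _ _ _ =
        contradiction (subst (Near τ (u ∷ []) 3) (flip (m i) eq) (step i (step j (step i (base (here refl)))))) v∉
      ... | _ | at-τv refl _ _ | _ | away _ _ _ _ =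
        contradiction (subst (Near τ (u ∷ []) 3) (trans (cong (τ i ∘ τ j) eq) (trans (cong (τ i) (invol (m j) _)) (invol (m i) _))) (step i (step j (step i (base (here refl)))))) v∉
      ... | _ | away _ _ _ _ | _ | at-τu refl _ _ =
        contradiction (subst (Near τ (u ∷ []) 3) (flip (m j) (sym eq)) (step j (step i (step j (base (here refl)))))) v∉
      ... | _ | away _ _ _ _ | _ | at-τv refl _ _ =
        contradiction (subst (Near τ (u ∷ []) 3) (trans (cong (τ j ∘ τ i) (sym eq)) (trans (cong (τ j) (invol (m i) _)) (invol (m j) _))) (step j (step i (step j (base (here refl)))))) v∉

      switch-near : ∀ {w} i → Far τ (u ∷ v ∷ []) 1 w → switch (τ i) u v w ≡ τ i w
      switch-near i w∉ = switch-away (τ i) (λ where refl → w∉ (base (here refl))) (λ where refl → w∉ (base (there (here refl))))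
        (λ where refl → w∉ (step i (base (here refl)))) (λ where refl → w∉ (step i (base (there (here refl)))))

      overlap-far : ∀ {R w} → Far τ (u ∷ []) 3 v → w ≢ u → w ≢ v → Overlap R (switchAll τ u v) w → Overlap R τ w
      overlap-far v∉ w≢u w≢v (i , j , r , eq) = i , j , r , switch-coincide-far v∉ i j w≢u w≢v eq

      overlap-away : ∀ {R w} → Far τ (u ∷ v ∷ []) 1 w → Overlap R (switchAll τ u v) w → Overlap R τ w
      overlap-away w∉ (i , j , r , eq) = i , j , r , trans (sym (switch-near i w∉)) (trans eq (switch-near j w∉))

    private variable
      L : List V
      τ : Fin k → V → V
      u v : V

    module _ {R : Fin k → Fin k → Set} (R? : Decidable R) (s : State L τ) where

      open State s

      private
        ov = overlapped R? L τ
        ov-unique : Unique ov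
        ov-unique = Unique.filter⁺ (overlap? R? τ) unique
        ov′ : V → V → List V
        ov′ u v = overlapped R? (delete u v L) (switchAll τ u v)
        ov′-unique : ∀ u v → Unique (ov′ u v)
        ov′-unique u v = Unique.filter⁺ (overlap? R? (switchAll τ u v)) (delete-unique unique)
        ∈-ov′ : ∀ {w} → w ∈ ov′ u v → w ∈ L × w ≢ u × w ≢ v × Overlap R (switchAll τ u v) w
        ∈-ov′ w∈ = let (p , q) = ∈-filter⁻ (overlap? R? _) {xs = delete _ _ L} w∈ ; (a , b , c) = ∈-delete⁻ L p in a , b , c , q

        far⊆ : ∀ {w} → Far τ (u ∷ []) 3 v → w ∈ ov′ u v → w ∈ _∖_ _≟_ ov u
        far⊆ v∉ w∈ = let (a , b , c , q) = ∈-ov′ w∈ in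
          ∈-∖⁺ _≟_ (∈-filter⁺ (overlap? R? τ) a (overlap-far matching v∉ b c q)) b

        near⊆ : ∀ {w} → w ∈ ov′ u v → w ∈ _∖_ _≟_ ov u ++ ball τ 1 (u ∷ v ∷ [])
        near⊆ {u} {v} {w} w∈ with mem? _≟_ w (ball τ 1 (u ∷ v ∷ [])) | ∈-ov′ w∈
        ... | yes p | _ = ∈-++⁺ʳ (_∖_ _≟_ ov u) p
        ... | no ¬p | a , b , c , q = ∈-++⁺ˡ (∈-∖⁺ _≟_ (∈-filter⁺ (overlap? R? τ) a (overlap-away matching (¬p ∘ near⇒∈ball) q)) b)

        ov∖ : V → ℕ
        ov∖ u = length (_∖_ _≟_ ov u)

        ov∖≤ : ov∖ u ≤ length ov
        ov∖≤ = unique-⊆-length _≟_ (∖-unique _≟_ ov-unique) (λ x∈ → proj₁ (∈-∖⁻ _≟_ ov x∈))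

        ov∖< : u ∈ L → Overlap R τ u → suc (ov∖ u) ≡ length ov
        ov∖< u∈ o = length-∖ _≟_ ov-unique (∈-filter⁺ (overlap? R? τ) u∈ o)

        far-∖ : Far τ (u ∷ []) 3 v → length (ov′ u v) ≤ ov∖ u
        far-∖ {u} {v} v∉ = unique-⊆-length _≟_ (ov′-unique u v) (far⊆ v∉)

        near-∖ : ∀ u v → length (ov′ u v) ≤ ov∖ u + suc k * 2
        near-∖ u v = ≤-trans (unique-⊆-length _≟_ (ov′-unique u v) near⊆)
          (≤-reflexive (trans (length-++ (_∖_ _≟_ ov u)) (cong (ov∖ u +_)
            (trans (length-ball τ 1 (u ∷ v ∷ [])) (cong (_* 2) (*-identityʳ (suc k)))))))

      overlapped-far : Far τ (u ∷ []) 3 v → length (ov′ u v) ≤ length ov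
      overlapped-far v∉ = ≤-trans (far-∖ v∉) ov∖≤

      -- The pivot leaves the list and a far partner adds nothing to it. This strict decrease is the
      -- gain from branching at an overlapped vertex.
      overlapped-far-< : u ∈ L → Overlap R τ u → Far τ (u ∷ []) 3 v → length (ov′ u v) < length ov
      overlapped-far-< u∈ o v∉ = ≤-trans (s≤s (far-∖ v∉)) (≤-reflexive (ov∖< u∈ o))

      -- A vertex can become overlapped only if one of its edges changed, so it lies within distance
      -- 1 of u or v; there are at most 2(k+1) such vertices.
      overlapped-near : ∀ u v → length (ov′ u v) ≤ length ov + suc k * 2
      overlapped-near u v = ≤-trans (near-∖ u v) (+-monoˡ-≤ _ ov∖≤)

      overlapped-near-< : u ∈ L → Overlap R τ u → ∀ v → length (ov′ u v) < length ov + suc k * 2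
      overlapped-near-< u∈ o v = ≤-trans (s≤s (near-∖ _ v)) (≤-reflexive (cong (_+ suc k * 2) (ov∖< u∈ o)))

    module _ (s : State L τ) {u : V} where

      open State s

      private
        after : V → ℕ
        after v = length (overlapped _≢?_ (delete u v L) (switchAll τ u v))

        -- All partners but the at most (k+1)³ within distance 3 of u leave at most s₁ coincidences,
        -- and a near one raises F by at most G. F is the identity for the linear potential and a
        -- power of `lam-of k` for the exponential one.
        sum-choices′ : ∀ (F : ℕ → ℕ) G → (∀ {a b} → a ≤ b → F a ≤ F b) → ∀ s₁ → F (s₁ + suc k * 2) ≤ F s₁ + G →
          (∀ {v} → Far τ (u ∷ []) 3 v → after v ≤ s₁) → (∀ v → after v ≤ s₁ + suc k * 2) →
          sum (map (λ v → F (after v)) (choices L τ u)) ≤ length (choices L τ u) * F s₁ + suc k ^ 3 * G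
        sum-choices′ F G mono s₁ FG good bad = begin
          sum (map (λ v → F (after v)) cs)       ≡⟨ sum-split near? (λ v → F (after v)) cs ⟩
          sum (map (λ v → F (after v)) nears) + sum (map (λ v → F (after v)) fars)
            ≤⟨ +-mono-≤ (sum-≤ nears (λ {v} _ → ≤-trans (mono (bad v)) FG))
                        (sum-≤ fars (λ v∈ → mono (good (proj₂ (∈-filter⁻ (λ v → ¬? (near? v)) {xs = cs} v∈) ∘ near⇒∈ball)))) ⟩
          sum (map (λ _ → F s₁ + G) nears) + sum (map (λ _ → F s₁) fars)
            ≡⟨ cong₂ _+_ (sum-const (F s₁ + G) nears) (sum-const (F s₁) fars) ⟩
          length nears * (F s₁ + G) + length fars * F s₁
            ≡⟨ regroup (length nears) (F s₁) G (length fars) ⟩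
          (length nears + length fars) * F s₁ + length nears * G
            ≡⟨ cong (λ l → l * F s₁ + length nears * G) (length-filter-split _≟_ near? cs) ⟨
          length cs * F s₁ + length nears * G
            ≤⟨ +-monoʳ-≤ (length cs * F s₁) (*-monoˡ-≤ G nears≤) ⟩
          length cs * F s₁ + suc k ^ 3 * G ∎
          where
          open ≤-Reasoning
          cs = choices L τ u
          near? : ∀ v → Dec (v ∈ ball τ 3 (u ∷ []))
          near? v = mem? _≟_ v (ball τ 3 (u ∷ []))
          nears = filter near? cs
          fars = filter (λ v → ¬? (near? v)) cs
          nears≤ : length nears ≤ suc k ^ 3
          nears≤ = ≤-trans (unique-⊆-length _≟_ (Unique.filter⁺ near? (choices-unique L τ u unique)) (proj₂ ∘ ∈-filter⁻ near? {xs = cs}))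
            (≤-reflexive (trans (length-ball τ 3 (u ∷ [])) (*-identityʳ _)))
          regroup : ∀ a f g b → a * (f + g) + b * f ≡ (a + b) * f + a * g
          regroup = solve-∀

      sum-choices : ∀ (F : ℕ → ℕ) G → (∀ {a b} → a ≤ b → F a ≤ F b) → ∀ {s₁} → F (s₁ + suc k * 2) ≤ F s₁ + G →
        length (overlapped _≢?_ L τ) ≡ s₁ →
        sum (map (λ v → F (after v)) (choices L τ u)) ≤ length (choices L τ u) * F s₁ + suc k ^ 3 * G
      sum-choices F G mono FG refl = sum-choices′ F G mono _ FG (overlapped-far _≢?_ s) (overlapped-near _≢?_ s u)

      sum-choices-overlap : u ∈ L → Overlap _≢_ τ u →
        ∀ (F : ℕ → ℕ) G → (∀ {a b} → a ≤ b → F a ≤ F b) → ∀ {s₁} → F (s₁ + suc k * 2) ≤ F s₁ + G →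
        length (overlapped _≢?_ L τ) ≡ suc s₁ →
        sum (map (λ v → F (after v)) (choices L τ u)) ≤ length (choices L τ u) * F s₁ + suc k ^ 3 * G
      sum-choices-overlap u∈ o F G mono {s₁} FG eq = sum-choices′ F G mono s₁ FG
        (λ v∉ → ≤-pred (≤-trans (overlapped-far-< _≢?_ s u∈ o v∉) (≤-reflexive eq)))
        (λ v → ≤-pred (≤-trans (overlapped-near-< _≢?_ s u∈ o v) (≤-reflexive (cong (_+ suc k * 2) eq))))

-- The arithmetic of one recursion step, for both potentials.

module Potential where

  open import Data.Nat
  open import Data.Nat.Properties
  open import Data.Nat.Tactic.RingSolver
  open import Relation.Binary.PropositionalEquality
  open import Relation.Nullary using (yes; no; contradiction)
  open ≤-Reasoning

  ^-distribʳ-* : ∀ d a b → (a * b) ^ d ≡ a ^ d * b ^ d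
  ^-distribʳ-* zero a b = refl
  ^-distribʳ-* (suc d) a b rewrite ^-distribʳ-* d a b = four a b (a ^ d) (b ^ d)
    where
    four : ∀ a b p q → a * b * (p * q) ≡ a * p * (b * q)
    four = solve-∀

  square-cancel-≤ : ∀ {m n} → m * m ≤ n * n → m ≤ n
  square-cancel-≤ {m} {n} h with m ≤? n
  ... | yes p = p
  ... | no ¬p = contradiction h (<⇒≱ (*-mono-< (≰⇒> ¬p) (≰⇒> ¬p)))

  module Lower (r q a H γ W N bb : ℕ) (a≤q : a ≤ q) (r<a : suc r ≤ a) (γ≤r : γ ≤ r) (bb≤γ : 2 * bb ≤ γ)
               .{{_ : NonZero r}} where

    private
      T = suc r

    -- The invariant `H (t + γ) ≤ W t N + 2 H s` says that N is at least (H/W)(1 + γ/t - 2s/t). From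
    -- r to r + 1 the slack γ/t drops by γ/(r(r + 1)); times a > r options this is at least γ/r,
    -- which covers the cost 2bb/r of the near partners.
    lower-zero : q * (H * (r + γ)) ≤ W * r * N + H * (2 * bb) → a * H * (T + γ) ≤ W * T * N
    lower-zero h = *-cancelʳ-≤ _ _ r (+-cancelʳ-≤ (T * H * γ) _ _ (begin
      a * H * (T + γ) * r + T * H * γ       ≤⟨ +-monoʳ-≤ _ (*-monoˡ-≤ γ (*-monoˡ-≤ H r<a)) ⟩
      a * H * (T + γ) * r + a * H * γ       ≡⟨ e₁ a H r γ ⟩
      T * (a * (H * (r + γ)))               ≤⟨ *-monoʳ-≤ T (*-monoˡ-≤ (H * (r + γ)) a≤q) ⟩
      T * (q * (H * (r + γ)))               ≤⟨ *-monoʳ-≤ T h ⟩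
      T * (W * r * N + H * (2 * bb))        ≤⟨ *-monoʳ-≤ T (+-monoʳ-≤ (W * r * N) (*-monoʳ-≤ H bb≤γ)) ⟩
      T * (W * r * N + H * γ)               ≡⟨ e₂ T W r N H γ ⟩
      W * T * N * r + T * H * γ             ∎))
      where
      e₁ : ∀ a H r γ → a * H * (suc r + γ) * r + a * H * γ ≡ suc r * (a * (H * (r + γ)))
      e₁ = solve-∀
      e₂ : ∀ T W r N H γ → T * (W * r * N + H * γ) ≡ W * T * N * r + T * H * γ
      e₂ = solve-∀

    lower-suc : ∀ s → q * (H * (r + γ)) ≤ W * r * N + H * (2 * (q * s + bb)) →
      a * H * (T + γ) ≤ W * T * N + a * H * (2 * suc s)
    lower-suc s h with T + γ ≤? 2 * suc s
    -- With this many coincidences the subtracted term alone exceeds the left-hand side.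
    ... | yes p = ≤-trans (*-monoʳ-≤ (a * H) p) (m≤n+m _ (W * T * N))
    ... | no ¬p = begin
      a * H * (T + γ)                       ≡⟨ cong (λ z → a * H * suc z) (sym rγ) ⟩
      a * H * suc (2 * suc s + Y)           ≡⟨ e₀ a H s Y ⟩
      a * H * (1 + Y) + a * H * (2 * suc s) ≤⟨ +-monoˡ-≤ (a * H * (2 * suc s)) main ⟩
      W * T * N + a * H * (2 * suc s)       ∎
      where
      2s≤ : 2 * suc s ≤ r + γ
      2s≤ = ≤-pred (≰⇒> ¬p)
      -- After the step the bracket r + γ - 2s equals 2 + Y, whereas before it T + γ - 2(s + 1) = 1
      -- + Y. A coincidence has weight 2 so that removing one outweighs the loss of one pair.
      Y = r + γ ∸ 2 * suc s
      rγ : 2 * suc s + Y ≡ r + γ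
      rγ = m+[n∸m]≡n 2s≤
      e₀ : ∀ a H s Y → a * H * suc (2 * suc s + Y) ≡ a * H * (1 + Y) + a * H * (2 * suc s)
      e₀ = solve-∀
      h′ : q * (H * (2 + Y)) ≤ W * r * N + H * γ
      h′ = +-cancelʳ-≤ (q * H * (2 * s)) _ _ (begin
        q * (H * (2 + Y)) + q * H * (2 * s)            ≡⟨ f₁ q H Y s ⟩
        q * (H * (2 * suc s + Y))                      ≡⟨ cong (λ z → q * (H * z)) rγ ⟩
        q * (H * (r + γ))                              ≤⟨ h ⟩
        W * r * N + H * (2 * (q * s + bb))             ≡⟨ f₂ (W * r * N) H q s bb ⟩
        W * r * N + H * (2 * bb) + q * H * (2 * s)     ≤⟨ +-monoˡ-≤ _ (+-monoʳ-≤ (W * r * N) (*-monoʳ-≤ H bb≤γ)) ⟩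
        W * r * N + H * γ + q * H * (2 * s)            ∎)
        where
        f₁ : ∀ q H Y s → q * (H * (2 + Y)) + q * H * (2 * s) ≡ q * (H * (2 * suc s + Y))
        f₁ = solve-∀
        f₂ : ∀ w H q s b → w + H * (2 * (q * s + b)) ≡ w + H * (2 * b) + q * H * (2 * s)
        f₂ = solve-∀
      main : a * H * (1 + Y) ≤ W * T * N
      main = *-cancelʳ-≤ _ _ r (+-cancelʳ-≤ (T * H * γ) _ _ (begin
        a * H * (1 + Y) * r + T * H * γ           ≤⟨ +-monoʳ-≤ _ (*-mono-≤ (*-monoˡ-≤ H r<a) γ≤r) ⟩
        a * H * (1 + Y) * r + a * H * r           ≤⟨ m≤m+n _ _ ⟩
        a * H * (1 + Y) * r + a * H * r + a * H * (2 + Y)   ≡⟨ g₁ a H Y r ⟩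
        T * (a * (H * (2 + Y)))                   ≤⟨ *-monoʳ-≤ T (*-monoˡ-≤ (H * (2 + Y)) a≤q) ⟩
        T * (q * (H * (2 + Y)))                   ≤⟨ *-monoʳ-≤ T h′ ⟩
        T * (W * r * N + H * γ)                   ≡⟨ g₂ T W r N H γ ⟩
        W * T * N * r + T * H * γ                 ∎))
        where
        g₁ : ∀ a H Y r → a * H * (1 + Y) * r + a * H * r + a * H * (2 + Y) ≡ suc r * (a * (H * (2 + Y)))
        g₁ = solve-∀
        g₂ : ∀ T W r N H γ → T * (W * r * N + H * γ) ≡ W * T * N * r + T * H * γ
        g₂ = solve-∀

  module Upper (k x γ q a H W N O bb bλ lam Q : ℕ) .{{_ : NonZero (γ + x)}}
               (a≤q : a ≤ q) (q≤ : q ≤ a + k) (r<a : suc (γ + x) ≤ a) (a+k : a + k ≡ suc (2 * (γ + x)))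
               (γ-def : γ ≡ 2 * suc k * bb) (a-big : 2 * bλ + k ≤ a) (4≤lam : 4 ≤ lam) where

    private
      r = γ + x
      T = suc r
      c = 2 * suc k

    -- The summed induction hypothesis `h` has a linear part, advanced by `h₁`, and an exponential
    -- part, advanced by `h₂`. Passing from Q to 2 Q halves the exponential part, and `h₂` may spend
    -- that factor 2.
    combine : ∀ Λ B s′ λs → Q * (r * N) + q * (4 * (r * O)) ≤ Q * (W * H * B) + 2 * (r * O) * Λ →
      T * B ≤ a * s′ * r → 2 * Λ + 2 * (a + k) ≤ (a + k) * λs + 4 * q →
      2 * Q * (T * N) + 4 * (T * ((a + k) * O)) ≤ 2 * Q * (W * (a * H) * s′) + 2 * (T * ((a + k) * O)) * λs
    combine Λ B s′ λs h h₁ h₂ = *-cancelʳ-≤ _ _ r (+-cancelʳ-≤ (8 * T * q * r * O + 4 * T * r * O * Λ) _ _ (begin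
      (2 * Q * (T * N) + 4 * (T * (m * O))) * r + (8 * T * q * r * O + 4 * T * r * O * Λ)
        ≡⟨ e₁ Q T N m O r q Λ ⟩
      2 * T * (Q * (r * N) + q * (4 * (r * O))) + 2 * T * r * O * (2 * Λ + 2 * m)
        ≤⟨ +-mono-≤ (*-monoʳ-≤ (2 * T) h) (*-monoʳ-≤ (2 * T * r * O) h₂) ⟩
      2 * T * (Q * (W * H * B) + 2 * (r * O) * Λ) + 2 * T * r * O * (m * λs + 4 * q)
        ≡⟨ e₂ Q T W H B m O r q Λ λs ⟩
      2 * Q * W * H * (T * B) + (2 * T * r * O * (m * λs) + (8 * T * q * r * O + 4 * T * r * O * Λ))
        ≤⟨ +-monoˡ-≤ _ (*-monoʳ-≤ (2 * Q * W * H) h₁) ⟩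
      2 * Q * W * H * (a * s′ * r) + (2 * T * r * O * (m * λs) + (8 * T * q * r * O + 4 * T * r * O * Λ))
        ≡⟨ e₃ Q T W H a s′ m O r q Λ λs ⟩
      (2 * Q * (W * (a * H) * s′) + 2 * (T * (m * O)) * λs) * r + (8 * T * q * r * O + 4 * T * r * O * Λ) ∎))
      where
      m = a + k
      e₁ : ∀ Q T N m O r q Λ → (2 * Q * (T * N) + 4 * (T * (m * O))) * r + (8 * T * q * r * O + 4 * T * r * O * Λ)
        ≡ 2 * T * (Q * (r * N) + q * (4 * (r * O))) + 2 * T * r * O * (2 * Λ + 2 * m)
      e₁ = solve-∀
      e₂ : ∀ Q T W H B m O r q Λ λs → 2 * T * (Q * (W * H * B) + 2 * (r * O) * Λ) + 2 * T * r * O * (m * λs + 4 * q)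
        ≡ 2 * Q * W * H * (T * B) + (2 * T * r * O * (m * λs) + (8 * T * q * r * O + 4 * T * r * O * Λ))
      e₂ = solve-∀
      e₃ : ∀ Q T W H a s′ m O r q Λ λs →
        2 * Q * W * H * (a * s′ * r) + (2 * T * r * O * (m * λs) + (8 * T * q * r * O + 4 * T * r * O * Λ))
        ≡ (2 * Q * (W * (a * H) * s′) + 2 * (T * (m * O)) * λs) * r + (8 * T * q * r * O + 4 * T * r * O * Λ)
      e₃ = solve-∀

    -- Per step 1 - γ/t rises by γ/(r(r + 1)); with a > r options this pays for bb new coincidences
    -- of weight c, since γ = c bb.
    linear-zero : T * (a * x + c * bb) ≤ a * (suc x) * r
    linear-zero = begin
      T * (a * x + c * bb)     ≡⟨ cong (λ z → T * (a * x + z)) (sym γ-def) ⟩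
      T * (a * x + γ)          ≡⟨ *-distribˡ-+ T (a * x) γ ⟩
      T * (a * x) + T * γ      ≤⟨ +-monoʳ-≤ (T * (a * x)) (*-monoˡ-≤ γ r<a) ⟩
      T * (a * x) + a * γ      ≡⟨ e₁ γ x a ⟩
      a * suc x * r            ∎
      where
      e₁ : ∀ γ x a → suc (γ + x) * (a * x) + a * γ ≡ a * suc x * (γ + x)
      e₁ = solve-∀

    -- At an overlapped pivot there may be k options too many, a relative excess of at most k/a. The
    -- coincidence that disappears has weight c = 2(k+1), which makes up for it as long as c(s + 1)
    -- ≤ T.
    linear-suc : ∀ s → 2 * suc k * suc s ≤ T → T * (q * x + c * (q * s + bb)) ≤ a * (suc x + c * suc s) * r
    linear-suc s h = begin
      T * (q * x + c * (q * s + bb))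
        ≤⟨ *-monoʳ-≤ T (+-mono-≤ (*-monoˡ-≤ x q≤) (*-monoʳ-≤ c (+-monoˡ-≤ bb (*-monoˡ-≤ s q≤)))) ⟩
      T * ((a + k) * x + c * ((a + k) * s + bb))
        ≡⟨ e₁ T a k x c s bb ⟩
      T * (a * x) + T * (c * bb) + a * c * s * T + T * (k * x + c * k * s)
        ≤⟨ +-mono-≤ (+-monoˡ-≤ (a * c * s * T) (+-monoʳ-≤ (T * (a * x)) (≤-trans (≤-reflexive (cong (T *_) (sym γ-def))) (*-monoˡ-≤ γ r<a))))
                    (*-monoˡ-≤ (k * x + c * k * s) r<a) ⟩
      T * (a * x) + a * γ + a * c * s * T + a * (k * x + c * k * s)
        ≡⟨ e₂ γ x a c s k ⟩
      a * suc x * r + a * (c * s) * r + a * (k * x + c * k * s + c * s)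
        ≤⟨ +-monoʳ-≤ (a * suc x * r + a * (c * s) * r) (*-monoʳ-≤ a E) ⟩
      a * suc x * r + a * (c * s) * r + a * (c * r)
        ≡⟨ e₃ a x r c s ⟩
      a * (suc x + c * suc s) * r ∎
      where
      e₁ : ∀ T a k x c s bb → T * ((a + k) * x + c * ((a + k) * s + bb))
        ≡ T * (a * x) + T * (c * bb) + a * c * s * T + T * (k * x + c * k * s)
      e₁ = solve-∀
      e₂ : ∀ γ x a c s k → suc (γ + x) * (a * x) + a * γ + a * c * s * suc (γ + x) + a * (k * x + c * k * s)
        ≡ a * suc x * (γ + x) + a * (c * s) * (γ + x) + a * (k * x + c * k * s + c * s)
      e₂ = solve-∀
      e₃ : ∀ a x r c s → a * suc x * r + a * (c * s) * r + a * (c * r) ≡ a * (suc x + c * suc s) * r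
      e₃ = solve-∀
      cs≤r : c * s ≤ r
      cs≤r = ≤-pred (≤-trans (s≤s (m≤m+n (c * s) (suc (2 * k)))) (≤-trans (≤-reflexive (g k s)) h))
        where
        g : ∀ k s → suc (2 * suc k * s + suc (2 * k)) ≡ 2 * suc k * suc s
        g = solve-∀
      E : k * x + c * k * s + c * s ≤ c * r
      E = begin
        k * x + c * k * s + c * s   ≡⟨ g₁ k x s ⟩
        k * x + suc k * (c * s)     ≤⟨ +-mono-≤ (*-monoʳ-≤ k (m≤n+m x γ)) (*-monoʳ-≤ (suc k) cs≤r) ⟩
        k * r + suc k * r           ≤⟨ m≤m+n _ r ⟩
        k * r + suc k * r + r       ≡⟨ g₂ k r ⟩
        c * r                       ∎
        where
        g₁ : ∀ k x s → k * x + 2 * suc k * k * s + 2 * suc k * s ≡ k * x + suc k * (2 * suc k * s)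
        g₁ = solve-∀
        g₂ : ∀ k r → k * r + suc k * r + r ≡ 2 * suc k * r
        g₂ = solve-∀

    -- The term 2λ^s - 4 of the invariant equals -2 at s = 0, so every option contributes
    -- negatively; the requirement falls to about half by the decay of 2^(-t), and the difference
    -- absorbs the near partners.
    exponential-zero : 2 * (a * 1 + bλ) + 2 * (a + k) ≤ (a + k) * 1 + 4 * a
    exponential-zero = begin
      2 * (a * 1 + bλ) + 2 * (a + k)  ≡⟨ e₁ a bλ k ⟩
      (4 * a + k) + (2 * bλ + k)      ≤⟨ +-monoʳ-≤ (4 * a + k) a-big ⟩
      (4 * a + k) + a                 ≡⟨ e₂ a k ⟩
      (a + k) * 1 + 4 * a             ∎
      where
      e₁ : ∀ a b k → 2 * (a * 1 + b) + 2 * (a + k) ≡ (4 * a + k) + (2 * b + k)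
      e₁ = solve-∀
      e₂ : ∀ a k → (4 * a + k) + a ≡ (a + k) * 1 + 4 * a
      e₂ = solve-∀

    -- Far and near partners each contribute at most (a + k) λ^s and the decay costs a factor 2,
    -- which explains the requirement λ ≥ 4.
    exponential-suc : ∀ ls → 2 * (q * ls + bλ * ls) + 2 * (a + k) ≤ (a + k) * (lam * ls) + 4 * q
    exponential-suc ls = +-mono-≤
      (begin
        2 * (q * ls + bλ * ls)          ≤⟨ *-monoʳ-≤ 2 (+-mono-≤ (*-monoˡ-≤ ls q≤) (*-monoˡ-≤ ls b≤)) ⟩
        2 * ((a + k) * ls + (a + k) * ls) ≡⟨ e₁ (a + k) ls ⟩
        (a + k) * (4 * ls)              ≤⟨ *-monoʳ-≤ (a + k) (*-monoˡ-≤ ls 4≤lam) ⟩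
        (a + k) * (lam * ls)            ∎)
      (begin
        2 * (a + k)     ≤⟨ *-monoʳ-≤ 2 (+-monoʳ-≤ a (≤-trans (m≤n+m k (2 * bλ)) a-big)) ⟩
        2 * (a + a)     ≡⟨ e₂ a ⟩
        4 * a           ≤⟨ *-monoʳ-≤ 4 a≤q ⟩
        4 * q           ∎)
      where
      e₁ : ∀ m l → 2 * (m * l + m * l) ≡ m * (4 * l)
      e₁ = solve-∀
      e₂ : ∀ a → 2 * (a + a) ≡ 4 * a
      e₂ = solve-∀
      b≤ : bλ ≤ a + k
      b≤ = ≤-trans (≤-trans (m≤m+n bλ (bλ + 0 + k)) (≤-reflexive (sym (+-assoc bλ (bλ + 0) k)))) (≤-trans a-big (m≤m+n a k))

-- Lower and upper bounds carried along the recursion.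

module Bounds where

  open Finite
  open Switching
  open Counting
  open Overlaps
  open Potential
  open import Data.Nat
  open import Data.Nat.Properties hiding (_≟_)
  open import Data.Nat.ListAction using (sum)
  open import Data.Nat.Tactic.RingSolver
  open import Data.Fin using (Fin)
  open import Data.List using (List; length; map)
  open import Data.List.Membership.Propositional using (_∈_)
  open import Data.List.Membership.Propositional.Properties using (∈-filter⁺; ∈-length)
  open import Data.Product using (_×_; _,_; ∃-syntax)
  open import Data.Sum using (_⊎_; inj₁; inj₂)
  open import Relation.Nullary using (¬_; yes; no)
  open import Relation.Binary.PropositionalEquality

  -- This is (2t - 1)!!, the number of all perfect matchings on 2t vertices.
  doubleFactorial : ℕ → ℕ
  doubleFactorial zero = 1
  doubleFactorial (suc t) = suc (2 * t) * doubleFactorial t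

  module _ {n k : ℕ} where

    private
      V = Fin n
      variable
        L : List V
        τ : Fin k → V → V

    defect : List V → (Fin k → V → V) → ℕ
    defect L τ = length (overlapped _≢?_ L τ)

    private
      halve-length : ∀ t {l} → 2 + l ≡ 2 * suc t → l ≡ 2 * t
      halve-length t eq = suc-injective (suc-injective (trans eq (cong suc (+-suc t (t + 0)))))

    child : ∀ t {u v} → State L τ → length L ≡ 2 * suc t → u ∈ L → v ∈ choices L τ u →
      State (delete u v L) (switchAll τ u v) × length (delete u v L) ≡ 2 * t
    child {L} {τ} t s len u∈ v∈ = let (v∈L , u≢v , val) = ∈-choices⁻ {L = L} {τ} v∈ in
      state-switch s u∈ v∈L u≢v val ,
      halve-length t (trans (length-delete (State.unique s) u∈ v∈L u≢v) len)

    -- The estimates distinguish just these two alternatives: a pivot whose own coincidence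
    -- disappears, or a state free of coincidences, where the number of options is known exactly.
    branching : ∀ t .{{_ : NonZero t}} → State L τ → length L ≡ 2 * suc t → ∃[ u ] u ∈ L ×
      ((∃[ s₁ ] Overlap _≢_ τ u × defect L τ ≡ suc s₁) ⊎ (defect L τ ≡ 0 × suc (length (choices L τ u) + k) ≡ 2 * suc t)) ×
      count (suc t) L τ ≡ sum (map (λ v → count t (delete u v L) (switchAll τ u v)) (choices L τ u))
    branching {L} {τ} (suc t) s len with count-pivot t {L} {τ} (subst (0 <_) (sym len) (s≤s z≤n))
    ... | u , u∈ , inj₁ o , eq = u , u∈ , inj₁ (_ , o , sym (suc-pred _ {{>-nonZero (∈-length (∈-filter⁺ (overlap? _≢?_ τ) u∈ o))}})) , eq
    ... | u , u∈ , inj₂ none , eq = u , u∈ , inj₂ (cong length none , trans (length-choices-≡ s u∈ ¬o) len) , eq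
      where
      ¬o : ¬ Overlap _≢_ τ u
      ¬o o with subst (u ∈_) none (∈-filter⁺ (overlap? _≢?_ τ) u∈ o)
      ... | ()

    choices≤ : ∀ t {u} → State L τ → length L ≡ 2 * suc t → u ∈ L → length (choices L τ u) ≤ suc (2 * t)
    choices≤ t s len u∈ = ≤-pred (≤-trans (length-choices-< s u∈) (≤-reflexive (trans len (cong suc (+-suc t (t + 0))))))

    count≤ : ∀ t {L : List V} {τ : Fin k → V → V} → State L τ → length L ≡ 2 * t → count t L τ ≤ doubleFactorial t
    count≤ zero s len = s≤s z≤n
    count≤ (suc zero) s len = s≤s z≤n
    count≤ (suc (suc t)) {L} {τ} s len = let (u , u∈ , _ , eq) = branching (suc t) s len in begin
      count (suc (suc t)) L τ                                 ≡⟨ eq ⟩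
      sum (map (λ v → count (suc t) (delete u v L) (switchAll τ u v)) (choices L τ u))
        ≤⟨ sum-≤ (choices L τ u) (λ v∈ → let (s′ , l′) = child (suc t) s len u∈ v∈ in count≤ (suc t) s′ l′) ⟩
      sum (map (λ _ → doubleFactorial (suc t)) (choices L τ u)) ≡⟨ sum-const (doubleFactorial (suc t)) (choices L τ u) ⟩
      length (choices L τ u) * doubleFactorial (suc t)        ≤⟨ *-monoˡ-≤ (doubleFactorial (suc t)) (choices≤ (suc t) s len u∈) ⟩
      doubleFactorial (suc (suc t))                           ∎
      where open ≤-Reasoning

  -- The number of partners of a vertex avoiding k forbidden ones, when t edges remain to be chosen.
  options : ℕ → ℕ → ℕ
  options k t = 2 * t ∸ suc k

  optionsProduct : (k t₀ d : ℕ) → ℕ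
  optionsProduct k t₀ zero = 1
  optionsProduct k t₀ (suc d) = options k (suc (d + t₀)) * optionsProduct k t₀ d

  -- `jumpCost` is the number of near partners times the coincidences each may create, and `jumpExp`
  -- its exponential analogue. `γ-of` multiplies the former by the weight 2(k+1) of a coincidence.
  -- The base `lam-of k` is 2^(2(k+1)), so its s-th power exceeds 2^t as soon as 2(k+1)s > t.
  jumpCost γ-of lam-of jumpExp : ℕ → ℕ
  jumpCost k = suc k ^ 3 * (suc k * 2)
  γ-of k = 2 * suc k * jumpCost k
  lam-of k = 4 ^ suc k
  jumpExp k = suc k ^ 3 * lam-of k ^ (suc k * 2)

  -- With z = t - γ and λ = `lam-of k`, division by 2^t t gives N ≤ W h (1 - γ/t + 2(k+1)s/t) +
  -- 2^(-t) O (2λ^s - 4). The 4 makes the last term negative at s = 0, which leaves room for near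
  -- partners.
  UpperBound : (k t h W N s O z : ℕ) → Set
  UpperBound k t h W N s O z = 2 ^ t * (t * N) + 4 * (t * O) ≤ 2 ^ t * (W * h * (z + 2 * suc k * s)) + 2 * (t * O) * lam-of k ^ s

  -- `γ<t₀` keeps the leading factor t - γ of the upper bound positive. `jump≤t₀` makes the number
  -- of options exceed the exponential cost of the near partners, and 3k, so that replacing an
  -- option count a by a + k costs at most a factor 4/3.
  record Large (k t₀ : ℕ) : Set where
    field
      γ<t₀ : γ-of k < t₀
      jump≤t₀ : 2 + 2 * jumpExp k + 3 * k ≤ t₀

  module _ {n k t₀ : ℕ} (large : Large k t₀) where

    open Large large

    private
      γ = γ-of k
      H = optionsProduct k t₀

      2≤t₀ : 2 ≤ t₀
      2≤t₀ = ≤-trans (≤-trans (m≤m+n 2 _) (≤-reflexive (+-assoc 2 (2 * jumpExp k) (3 * k)))) jump≤t₀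

      3k≤t₀ : 3 * k ≤ t₀
      3k≤t₀ = ≤-trans (m≤n+m (3 * k) (2 + 2 * jumpExp k)) jump≤t₀

      k≤t₀ : k ≤ t₀
      k≤t₀ = ≤-trans (m≤m+n k _) 3k≤t₀

    module _ (d : ℕ) where

      private
        r = d + t₀
        a = options k (suc r)

      instance
        r-nonZero : NonZero (d + t₀)
        r-nonZero = >-nonZero (≤-trans (s≤s z≤n) (≤-trans 2≤t₀ (m≤n+m t₀ d)))

      private
        t₀≤r : t₀ ≤ r
        t₀≤r = m≤n+m t₀ d

      options+k : options k (suc (d + t₀)) + k ≡ suc (2 * (d + t₀))
      options+k = trans (cong (λ z → z ∸ suc k + k) (cong suc (+-suc r (r + 0))))
        (m∸n+n≡m (≤-trans k≤t₀ (≤-trans t₀≤r (≤-trans (m≤m+n r (r + 0)) (n≤1+n _)))))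

      options> : suc (d + t₀) ≤ options k (suc (d + t₀))
      options> = +-cancelʳ-≤ k _ _ (≤-trans (s≤s (≤-trans (+-monoʳ-≤ r (≤-trans k≤t₀ t₀≤r)) (≤-reflexive (cong (r +_) (sym (+-identityʳ r))))))
        (≤-reflexive (sym options+k)))

      options≥t₀ : t₀ ≤ options k (suc (d + t₀))
      options≥t₀ = ≤-trans t₀≤r (≤-trans (n≤1+n r) options>)

      private
        options≤choices : ∀ {L : List (Fin n)} {τ : Fin k → Fin n → Fin n} {u} → State L τ → length L ≡ 2 * suc r → u ∈ L →
          a ≤ length (choices L τ u)
        options≤choices {L} {τ} {u} s len u∈ = +-cancelʳ-≤ k a (length (choices L τ u)) (≤-trans (≤-reflexive (trans options+k (sym e)))
            (≤-pred (≤-trans (≤-reflexive (sym len)) (length-choices-≥ s u∈))))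
          where
          e : pred (2 * suc r) ≡ suc (2 * r)
          e = +-suc r (r + 0)

        choices≤options+k : ∀ {L : List (Fin n)} {τ : Fin k → Fin n → Fin n} {u} → State L τ → length L ≡ 2 * suc r → u ∈ L →
          length (choices L τ u) ≤ a + k
        choices≤options+k s len u∈ = ≤-trans (choices≤ r s len u∈) (≤-reflexive (sym options+k))

        choices≡options : ∀ {q} → suc (q + k) ≡ 2 * suc r → q ≡ a
        choices≡options {q} eq = +-cancelʳ-≡ k q a (trans (suc-injective (trans eq (cong suc (+-suc r (r + 0))))) (sym options+k))

      lower-step : ∀ W →
        (∀ {L : List (Fin n)} {τ : Fin k → Fin n → Fin n} → State L τ → length L ≡ 2 * (d + t₀) →
          H d * (d + t₀ + γ) ≤ W * (d + t₀) * count (d + t₀) L τ + H d * (2 * defect L τ)) →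
        (∀ {L : List (Fin n)} {τ : Fin k → Fin n → Fin n} → State L τ → length L ≡ 2 * suc (d + t₀) →
          H (suc d) * (suc (d + t₀) + γ) ≤ W * suc (d + t₀) * count (suc (d + t₀)) L τ + H (suc d) * (2 * defect L τ))
      lower-step W ih {L} {τ} s len with branching r s len
      ... | u , u∈ , alt , eq = finish alt
        where
        open ≤-Reasoning
        q = length (choices L τ u)
        N′ S′ : Fin n → ℕ
        N′ v = count r (delete u v L) (switchAll τ u v)
        S′ v = defect (delete u v L) (switchAll τ u v)
        module P = Lower r q a (H d) γ W (count (suc r) L τ) (jumpCost k)
          (options≤choices s len u∈) options> (≤-trans (<⇒≤ γ<t₀) t₀≤r) (*-monoˡ-≤ (jumpCost k) (*-monoʳ-≤ 2 (s≤s (z≤n {k}))))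
        summed : q * (H d * (r + γ)) ≤ W * r * count (suc r) L τ + H d * (2 * sum (map S′ (choices L τ u)))
        summed = begin
          q * (H d * (r + γ))                                      ≡⟨ sum-const (H d * (r + γ)) (choices L τ u) ⟨
          sum (map (λ _ → H d * (r + γ)) (choices L τ u))
            ≤⟨ sum-≤ (choices L τ u) (λ v∈ → let (s′ , l′) = child r s len u∈ v∈ in ih s′ l′) ⟩
          sum (map (λ v → W * r * N′ v + H d * (2 * S′ v)) (choices L τ u))
            ≡⟨ sum-+ (λ v → W * r * N′ v) (λ v → H d * (2 * S′ v)) (choices L τ u) ⟩
          sum (map (λ v → W * r * N′ v) (choices L τ u)) + sum (map (λ v → H d * (2 * S′ v)) (choices L τ u))
            ≡⟨ cong₂ _+_ (trans (sum-*ˡ (W * r) N′ (choices L τ u)) (cong (W * r *_) (sym eq)))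
                 (trans (sum-*ˡ (H d) (λ v → 2 * S′ v) (choices L τ u)) (cong (H d *_) (sum-*ˡ 2 S′ (choices L τ u)))) ⟩
          W * r * count (suc r) L τ + H d * (2 * sum (map S′ (choices L τ u))) ∎
        finish : (∃[ s₁ ] Overlap _≢_ τ u × defect L τ ≡ suc s₁) ⊎ (defect L τ ≡ 0 × suc (q + k) ≡ 2 * suc r) →
          H (suc d) * (suc r + γ) ≤ W * suc r * count (suc r) L τ + H (suc d) * (2 * defect L τ)
        finish (inj₁ (s₁ , o , ds)) rewrite ds = P.lower-suc s₁ (≤-trans summed (+-monoʳ-≤ (W * r * count (suc r) L τ) (*-monoʳ-≤ (H d) (*-monoʳ-≤ 2
          (sum-choices-overlap s u∈ o (λ x → x) (suc k * 2) (λ p → p) ≤-refl ds)))))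
        finish (inj₂ (d0 , _)) rewrite d0 = ≤-trans (P.lower-zero (≤-trans summed (+-monoʳ-≤ (W * r * count (suc r) L τ) (*-monoʳ-≤ (H d) (*-monoʳ-≤ 2
          (≤-trans (sum-choices s {u = u} (λ x → x) (suc k * 2) (λ p → p) ≤-refl d0) (≤-reflexive (cong (_+ jumpCost k) (*-zeroʳ q)))))))))
          (m≤m+n _ _)

      private
        x = r ∸ γ
        rγ : γ + x ≡ r
        rγ = m+[n∸m]≡n (≤-trans (<⇒≤ γ<t₀) t₀≤r)
        lam = lam-of k
        Oℕ = doubleFactorial

      private
        -- As 2(k+1)s > t for t = r + 1, the power λ^s is at least 2^t, and the exponential term
        -- alone dominates the trivial bound (2t - 1)!!; the summand with 4 is covered by 4 ≤ 2^t.
        upper-many : ∀ W {h N s} → suc r < 2 * suc k * s → N ≤ Oℕ (suc r) → UpperBound k (suc r) h W N s (Oℕ (suc r)) (suc x)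
        upper-many W {h} {N} {s} lt N≤ = begin
          2 ^ suc r * (suc r * N) + 4 * (suc r * O)
            ≤⟨ +-mono-≤ (*-monoʳ-≤ (2 ^ suc r) (*-monoʳ-≤ (suc r) N≤)) (*-monoˡ-≤ (suc r * O) four) ⟩
          2 ^ suc r * (suc r * O) + 2 ^ suc r * (suc r * O)  ≡⟨ e (2 ^ suc r) (suc r * O) ⟩
          2 * (suc r * O) * 2 ^ suc r                        ≤⟨ *-monoʳ-≤ (2 * (suc r * O)) big ⟩
          2 * (suc r * O) * lam ^ s                          ≤⟨ m≤n+m _ _ ⟩
          2 ^ suc r * (W * h * (suc x + 2 * suc k * s)) + 2 * (suc r * O) * lam ^ s ∎
          where
          open ≤-Reasoning
          O = Oℕ (suc r)
          e : ∀ a b → a * b + a * b ≡ 2 * b * a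
          e = solve-∀
          four : 4 ≤ 2 ^ suc r
          four = ^-monoʳ-≤ 2 (≤-trans 2≤t₀ (≤-trans t₀≤r (n≤1+n r)))
          big : 2 ^ suc r ≤ lam ^ s
          big = begin
            2 ^ suc r             ≤⟨ ^-monoʳ-≤ 2 (<⇒≤ lt) ⟩
            2 ^ (2 * suc k * s)   ≡⟨ ^-*-assoc 2 (2 * suc k) s ⟨
            (2 ^ (2 * suc k)) ^ s ≡⟨ cong (_^ s) (^-*-assoc 2 2 (suc k)) ⟨
            lam ^ s               ∎

      upper-step : ∀ W →
        (∀ {L : List (Fin n)} {τ : Fin k → Fin n → Fin n} → State L τ → length L ≡ 2 * (d + t₀) →
          UpperBound k (d + t₀) (H d) W (count (d + t₀) L τ) (defect L τ) (doubleFactorial (d + t₀)) (d + t₀ ∸ γ)) →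
        (∀ {L : List (Fin n)} {τ : Fin k → Fin n → Fin n} → State L τ → length L ≡ 2 * suc (d + t₀) →
          UpperBound k (suc (d + t₀)) (H (suc d)) W (count (suc (d + t₀)) L τ) (defect L τ) (doubleFactorial (suc (d + t₀))) (suc (d + t₀ ∸ γ)))
      upper-step W ih {L} {τ} s len with suc r <? 2 * suc k * defect L τ
      ... | yes lt = upper-many W {H (suc d)} lt (count≤ (suc r) s len)
      ... | no ¬lt with branching r s len
      ... | u , u∈ , alt , eq = finish alt
        where
        open ≤-Reasoning
        q = length (choices L τ u)
        c = 2 * suc k
        N = count (suc r) L τ
        bλ = jumpExp k
        N′ S′ : Fin n → ℕ
        N′ v = count r (delete u v L) (switchAll τ u v)
        S′ v = defect (delete u v L) (switchAll τ u v)
        cs = choices L τ u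
        a-big : 2 * bλ + k ≤ a
        a-big = ≤-trans (+-mono-≤ (m≤n+m (2 * bλ) 2) (m≤m+n k (k + (k + 0)))) (≤-trans jump≤t₀ options≥t₀)
        4≤lam : 4 ≤ lam
        4≤lam = ^-monoʳ-≤ 4 {1} {suc k} (s≤s z≤n)
        nz : NonZero (γ + x)
        nz = subst NonZero (sym rγ) r-nonZero
        module P (q≥ : a ≤ q) (q≤ : q ≤ a + k) = Upper k x γ q a (H d) W N (Oℕ r) (jumpCost k) bλ lam (2 ^ r) {{nz}} q≥ q≤
          (subst (λ z → suc z ≤ a) (sym rγ) options>) (subst (λ z → a + k ≡ suc (2 * z)) (sym rγ) options+k) refl a-big 4≤lam
        module P′ = P (options≤choices s len u∈) (choices≤options+k s len u∈)
        summed : 2 ^ r * (r * N) + q * (4 * (r * Oℕ r)) ≤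
          2 ^ r * (W * H d * (q * x + c * sum (map S′ cs))) + 2 * (r * Oℕ r) * sum (map (λ v → lam ^ S′ v) cs)
        summed = begin
          2 ^ r * (r * N) + q * (4 * (r * Oℕ r))
            ≡⟨ cong₂ _+_ (trans (cong (λ z → 2 ^ r * (r * z)) eq) (trans (cong (2 ^ r *_) (sym (sum-*ˡ r N′ cs))) (sym (sum-*ˡ (2 ^ r) (λ v → r * N′ v) cs))))
                 (sym (sum-const (4 * (r * Oℕ r)) cs)) ⟩
          sum (map (λ v → 2 ^ r * (r * N′ v)) cs) + sum (map (λ _ → 4 * (r * Oℕ r)) cs)
            ≡⟨ sum-+ (λ v → 2 ^ r * (r * N′ v)) (λ _ → 4 * (r * Oℕ r)) cs ⟨
          sum (map (λ v → 2 ^ r * (r * N′ v) + 4 * (r * Oℕ r)) cs)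
            ≤⟨ sum-≤ cs (λ v∈ → let (s′ , l′) = child r s len u∈ v∈ in ih s′ l′) ⟩
          sum (map (λ v → 2 ^ r * (W * H d * (x + c * S′ v)) + 2 * (r * Oℕ r) * lam ^ S′ v) cs)
            ≡⟨ sum-+ (λ v → 2 ^ r * (W * H d * (x + c * S′ v))) (λ v → 2 * (r * Oℕ r) * lam ^ S′ v) cs ⟩
          sum (map (λ v → 2 ^ r * (W * H d * (x + c * S′ v))) cs) + sum (map (λ v → 2 * (r * Oℕ r) * lam ^ S′ v) cs)
            ≡⟨ cong₂ _+_ (trans (sum-*ˡ (2 ^ r) (λ v → W * H d * (x + c * S′ v)) cs) (cong (2 ^ r *_)
                   (trans (sum-*ˡ (W * H d) (λ v → x + c * S′ v) cs) (cong (W * H d *_)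
                     (trans (sum-+ (λ _ → x) (λ v → c * S′ v) cs) (cong₂ _+_ (sum-const x cs) (sum-*ˡ c S′ cs)))))))
                 (sum-*ˡ (2 * (r * Oℕ r)) (λ v → lam ^ S′ v) cs) ⟩
          2 ^ r * (W * H d * (q * x + c * sum (map S′ cs))) + 2 * (r * Oℕ r) * sum (map (λ v → lam ^ S′ v) cs) ∎
        summed′ : ∀ {B Λ} → sum (map S′ cs) ≤ B → sum (map (λ v → lam ^ S′ v) cs) ≤ Λ →
          2 ^ r * ((γ + x) * N) + q * (4 * ((γ + x) * Oℕ r)) ≤ 2 ^ r * (W * H d * (q * x + c * B)) + 2 * ((γ + x) * Oℕ r) * Λ
        summed′ {B} {Λ} hB hΛ = subst (λ z → 2 ^ r * (z * N) + q * (4 * (z * Oℕ r)) ≤ 2 ^ r * (W * H d * (q * x + c * B)) + 2 * (z * Oℕ r) * Λ) (sym rγ)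
          (≤-trans summed (+-mono-≤ (*-monoʳ-≤ (2 ^ r) (*-monoʳ-≤ (W * H d) (+-monoʳ-≤ (q * x) (*-monoʳ-≤ c hB)))) (*-monoʳ-≤ (2 * (r * Oℕ r)) hΛ)))
        mono-lam : ∀ {i j} → i ≤ j → lam ^ i ≤ lam ^ j
        mono-lam = ^-monoʳ-≤ lam {{>-nonZero (≤-trans (s≤s z≤n) 4≤lam)}}
        split-lam : ∀ s₁ → q * lam ^ s₁ + suc k ^ 3 * lam ^ (s₁ + suc k * 2) ≡ q * lam ^ s₁ + bλ * lam ^ s₁
        split-lam s₁ = cong (q * lam ^ s₁ +_) (trans (cong (suc k ^ 3 *_) (trans (^-distribˡ-+-* lam s₁ (suc k * 2)) (*-comm (lam ^ s₁) _)))
          (sym (*-assoc (suc k ^ 3) (lam ^ (suc k * 2)) (lam ^ s₁))))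
        convert : ∀ {s′} → 2 * 2 ^ r * (suc (γ + x) * N) + 4 * (suc (γ + x) * ((a + k) * Oℕ r)) ≤
            2 * 2 ^ r * (W * (a * H d) * (suc x + c * s′)) + 2 * (suc (γ + x) * ((a + k) * Oℕ r)) * lam ^ s′ →
          UpperBound k (suc r) (H (suc d)) W N s′ (Oℕ (suc r)) (suc x)
        convert {s′} h = subst₂ (λ z y → 2 * 2 ^ r * (suc z * N) + 4 * (suc z * (y * Oℕ r)) ≤
            2 * 2 ^ r * (W * (a * H d) * (suc x + c * s′)) + 2 * (suc z * (y * Oℕ r)) * lam ^ s′) rγ options+k h
        finish : (∃[ s₁ ] Overlap _≢_ τ u × defect L τ ≡ suc s₁) ⊎ (defect L τ ≡ 0 × suc (q + k) ≡ 2 * suc r) →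
          UpperBound k (suc r) (H (suc d)) W N (defect L τ) (Oℕ (suc r)) (suc x)
        finish (inj₁ (s₁ , o , ds)) = subst (λ z → UpperBound k (suc r) (H (suc d)) W N z (Oℕ (suc r)) (suc x)) (sym ds) (convert
          (P′.combine (q * lam ^ s₁ + bλ * lam ^ s₁) (q * x + c * (q * s₁ + jumpCost k)) (suc x + c * suc s₁) (lam ^ suc s₁)
            (summed′ (sum-choices-overlap s u∈ o (λ z → z) (suc k * 2) (λ p → p) ≤-refl ds)
              (≤-trans (sum-choices-overlap s u∈ o (lam ^_) (lam ^ (s₁ + suc k * 2)) mono-lam (m≤n+m _ _) ds) (≤-reflexive (split-lam s₁))))
            (P′.linear-suc s₁ (subst (c * suc s₁ ≤_) (cong suc (sym rγ)) (subst (λ z → c * z ≤ suc r) ds (≮⇒≥ ¬lt))))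
            (P′.exponential-suc (lam ^ s₁))))
        -- Without coincidences the number of options is exactly a. An excess of k at all such
        -- levels would accumulate to a power of t.
        finish (inj₂ (d0 , qa)) = subst (λ z → UpperBound k (suc r) (H (suc d)) W N z (Oℕ (suc r)) (suc x)) (sym d0) (convert
          (P′.combine (a * 1 + bλ) (a * x + c * jumpCost k) (suc x + c * 0) 1
            (≤-trans (summed′ {B = jumpCost k} {Λ = a * 1 + bλ}
                (≤-trans (sum-choices s {u = u} (λ z → z) (suc k * 2) (λ p → p) ≤-refl d0) (≤-reflexive (cong (_+ jumpCost k) (*-zeroʳ q))))
                (≤-trans (sum-choices s {u = u} (lam ^_) (lam ^ (suc k * 2)) mono-lam (m≤n+m _ _) d0) (≤-reflexive (cong (λ z → z * 1 + bλ) q≡a))))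
              (≤-reflexive (cong (λ z → 2 ^ r * (W * H d * (z * x + c * jumpCost k)) + 2 * ((γ + x) * Oℕ r) * (a * 1 + bλ)) q≡a)))
            (≤-trans P′.linear-zero (≤-reflexive (cong (λ z → a * z * (γ + x)) (sym (trans (cong (suc x +_) (*-zeroʳ c)) (+-identityʳ (suc x)))))))
            (≤-trans P′.exponential-zero (+-monoʳ-≤ ((a + k) * 1) (*-monoʳ-≤ 4 (options≤choices s len u∈))))))
          where
          q≡a : q ≡ a
          q≡a = choices≡options qa

-- The count is the product of the option numbers up to a constant.

module Theta where

  open Switching
  open Counting
  open Potential
  open Bounds
  open import Data.Nat
  open import Data.Nat.Properties hiding (_≟_)
  open import Data.Nat.Tactic.RingSolver
  open import Data.Fin using (Fin)
  open import Data.List using (List; length)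
  open import Relation.Nullary using (yes; no)
  open import Relation.Binary.PropositionalEquality

  -- The condition on the defect is the complement of the case in which the lower bound at t₀ is
  -- trivially true.
  Solvable-at : ℕ → ℕ → Set
  Solvable-at k t₀ = ∀ {n} {L : List (Fin n)} {τ : Fin k → Fin n → Fin n} → State L τ → length L ≡ 2 * t₀ →
    2 * defect L τ < t₀ + γ-of k → 1 ≤ count t₀ L τ

  module _ {k t₀ : ℕ} (large : Large k t₀) (solvable : Solvable-at k t₀) where

    open Large large

    private
      γ = γ-of k
      H = optionsProduct k t₀
      lam = lam-of k

      2+2j+3k≤t₀ : 2 + (2 * jumpExp k + 3 * k) ≤ t₀
      2+2j+3k≤t₀ = ≤-trans (≤-reflexive (sym (+-assoc 2 (2 * jumpExp k) (3 * k)))) jump≤t₀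

      3k≤t₀ : 3 * k ≤ t₀
      3k≤t₀ = ≤-trans (m≤n+m (3 * k) (2 + 2 * jumpExp k)) jump≤t₀

      instance
        t₀-nonZero : NonZero t₀
        t₀-nonZero = >-nonZero (≤-trans (s≤s z≤n) 2+2j+3k≤t₀)

    module _ {n : ℕ} where

      lower : ∀ d {L : List (Fin n)} {τ : Fin k → Fin n → Fin n} → State L τ → length L ≡ 2 * (d + t₀) →
        H d * (d + t₀ + γ) ≤ suc γ * (d + t₀) * count (d + t₀) L τ + H d * (2 * defect L τ)
      lower (suc d) = lower-step large d (suc γ) (lower d)
      lower zero {L} {τ} s len with t₀ + γ ≤? 2 * defect L τ
      ... | yes p = ≤-trans (*-monoʳ-≤ 1 p) (m≤n+m (1 * (2 * defect L τ)) (suc γ * t₀ * count t₀ L τ))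
      ... | no ¬p = ≤-trans (begin
        1 * (t₀ + γ)                        ≡⟨ *-identityˡ (t₀ + γ) ⟩
        t₀ + γ                              ≡⟨ cong (t₀ +_) (sym (*-identityʳ γ)) ⟩
        t₀ + γ * 1                          ≤⟨ +-monoʳ-≤ t₀ (*-monoʳ-≤ γ (>-nonZero⁻¹ t₀)) ⟩
        suc γ * t₀                          ≡⟨ *-identityʳ _ ⟨
        suc γ * t₀ * 1                      ≤⟨ *-monoʳ-≤ (suc γ * t₀) (solvable s len (≰⇒> ¬p)) ⟩
        suc γ * t₀ * count t₀ L τ           ∎) (m≤m+n _ _)
        where open ≤-Reasoning

      -- At the bottom of the recursion one multiple of t₀(2t₀ - 1)!! covers the count and four more
      -- cover the extra term of `UpperBound`.
      upperConstant : ℕ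
      upperConstant = 5 * (t₀ * doubleFactorial t₀)

      upper : ∀ d {L : List (Fin n)} {τ : Fin k → Fin n → Fin n} → State L τ → length L ≡ 2 * (d + t₀) →
        UpperBound k (d + t₀) (H d) upperConstant (count (d + t₀) L τ) (defect L τ) (doubleFactorial (d + t₀)) (d + t₀ ∸ γ)
      upper (suc d) {L} {τ} s len = subst (λ z → UpperBound k (suc (d + t₀)) (H (suc d)) upperConstant (count (suc (d + t₀)) L τ) (defect L τ) (doubleFactorial (suc (d + t₀))) z)
        (sym (+-∸-assoc 1 (≤-trans (<⇒≤ γ<t₀) (m≤n+m t₀ d)))) (upper-step large d upperConstant (upper d) s len)
      upper zero {L} {τ} s len = begin
        2 ^ t₀ * (t₀ * count t₀ L τ) + 4 * (t₀ * O)
          ≤⟨ +-mono-≤ (*-monoʳ-≤ (2 ^ t₀) (*-monoʳ-≤ t₀ (count≤ t₀ s len))) (m≤n*m (4 * (t₀ * O)) (2 ^ t₀) {{m^n≢0 2 t₀}}) ⟩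
        2 ^ t₀ * (t₀ * O) + 2 ^ t₀ * (4 * (t₀ * O))
          ≡⟨ e (2 ^ t₀) (t₀ * O) ⟩
        2 ^ t₀ * (5 * (t₀ * O) * 1 * 1)
          ≤⟨ *-monoʳ-≤ (2 ^ t₀) (*-monoʳ-≤ (5 * (t₀ * O) * 1) (≤-trans (m<n⇒0<n∸m γ<t₀) (m≤m+n (t₀ ∸ γ) _))) ⟩
        2 ^ t₀ * (5 * (t₀ * O) * 1 * (t₀ ∸ γ + 2 * suc k * defect L τ))
          ≤⟨ m≤m+n _ _ ⟩
        2 ^ t₀ * (5 * (t₀ * O) * 1 * (t₀ ∸ γ + 2 * suc k * defect L τ)) + 2 * (t₀ * O) * lam ^ defect L τ ∎
        where
        open ≤-Reasoning
        O = doubleFactorial t₀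
        e : ∀ Q P → Q * P + Q * (4 * P) ≡ Q * (5 * P * 1 * 1)
        e = solve-∀

    -- Under the smallness hypothesis the subtracted term 2Hs is at most half of Ht.
    lower-Θ : ∀ d {n} {L : List (Fin n)} {τ : Fin k → Fin n → Fin n} → State L τ → length L ≡ 2 * (d + t₀) →
      4 * suc k * defect L τ ≤ d + t₀ → H d ≤ 2 * suc γ * count (d + t₀) L τ
    lower-Θ d {L = L} {τ} s len small = *-cancelʳ-≤ _ _ t {{t-nonZero}} (+-cancelʳ-≤ (H d * t) _ _ (begin
      H d * t + H d * t                             ≡⟨ e₁ (H d) t ⟩
      2 * (H d * t)                                 ≤⟨ *-monoʳ-≤ 2 (*-monoʳ-≤ (H d) (m≤m+n t γ)) ⟩
      2 * (H d * (t + γ))                           ≤⟨ *-monoʳ-≤ 2 (lower d s len) ⟩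
      2 * (suc γ * t * N + H d * (2 * S))           ≡⟨ e₂ γ t N (H d) S ⟩
      2 * suc γ * N * t + H d * (4 * S)             ≤⟨ +-monoʳ-≤ (2 * suc γ * N * t) (*-monoʳ-≤ (H d) 4S≤t) ⟩
      2 * suc γ * N * t + H d * t                   ∎))
      where
      open ≤-Reasoning
      t = d + t₀
      N = count t L τ
      S = defect L τ
      t-nonZero : NonZero t
      t-nonZero = >-nonZero (≤-trans (>-nonZero⁻¹ t₀) (m≤n+m t₀ d))
      4S≤t : 4 * S ≤ t
      4S≤t = ≤-trans (*-monoˡ-≤ S (*-monoʳ-≤ 4 (s≤s (z≤n {k})))) small
      e₁ : ∀ a b → a * b + a * b ≡ 2 * (a * b)
      e₁ = solve-∀
      e₂ : ∀ γ t N H S → 2 * (suc γ * t * N + H * (2 * S)) ≡ 2 * suc γ * N * t + H * (4 * S)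
      e₂ = solve-∀

    private
      C₀ = doubleFactorial t₀ * 3 ^ t₀

      -- Since 3k ≤ a, the factor 2r + 1 = a + k is at most (4/3)a. This (4/3)^t and the (3/2)^t
      -- from `lam-small` multiply to the 2^t by which the exponential term is divided.
      doubleFactorial-growth : ∀ d → doubleFactorial (d + t₀) * 3 ^ (d + t₀) ≤ C₀ * (H d * 4 ^ (d + t₀))
      doubleFactorial-growth zero = m≤m*n C₀ _ {{subst NonZero (sym (*-identityˡ (4 ^ t₀))) (m^n≢0 4 t₀)}}
      doubleFactorial-growth (suc d) = begin
        suc (2 * r) * O * (3 * 3 ^ r)          ≡⟨ cong (λ z → z * O * (3 * 3 ^ r)) (sym (options+k {0} large d)) ⟩
        (a + k) * O * (3 * 3 ^ r)              ≡⟨ e₁ a k O (3 ^ r) ⟩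
        (3 * a + 3 * k) * (O * 3 ^ r)          ≤⟨ *-mono-≤ (+-monoʳ-≤ (3 * a) (≤-trans 3k≤t₀ (options≥t₀ {0} large d))) (doubleFactorial-growth d) ⟩
        (3 * a + a) * (C₀ * (H d * 4 ^ r))     ≡⟨ e₂ a C₀ (H d) (4 ^ r) ⟩
        C₀ * (a * H d * (4 * 4 ^ r))           ∎
        where
        open ≤-Reasoning
        r = d + t₀
        O = doubleFactorial r
        a = options k (suc r)
        e₁ : ∀ a k O p → (a + k) * O * (3 * p) ≡ (3 * a + 3 * k) * (O * p)
        e₁ = solve-∀
        e₂ : ∀ a C H p → (3 * a + a) * (C * (H * p)) ≡ C * (a * H * (4 * p))
        e₂ = solve-∀

      -- Squaring avoids half-integer exponents: from λ^(2s) ≤ 2^t the square of the left-hand side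
      -- is at most 8^t ≤ 9^t.
      lam-small : ∀ t s → 4 * suc k * s ≤ t → lam ^ s * 2 ^ t ≤ 3 ^ t
      lam-small t s h = square-cancel-≤ (begin
        lam ^ s * 2 ^ t * (lam ^ s * 2 ^ t)      ≡⟨ e (lam ^ s) (2 ^ t) ⟩
        lam ^ s * lam ^ s * (2 ^ t * 2 ^ t)      ≤⟨ *-monoˡ-≤ (2 ^ t * 2 ^ t) lam² ⟩
        2 ^ t * (2 ^ t * 2 ^ t)                  ≡⟨ cong (2 ^ t *_) (^-distribʳ-* t 2 2) ⟨
        2 ^ t * 4 ^ t                            ≡⟨ ^-distribʳ-* t 2 4 ⟨
        8 ^ t                                    ≤⟨ ^-monoˡ-≤ t (n≤1+n 8) ⟩
        9 ^ t                                    ≡⟨ ^-distribʳ-* t 3 3 ⟩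
        3 ^ t * 3 ^ t                            ∎)
        where
        open ≤-Reasoning
        e : ∀ a b → a * b * (a * b) ≡ a * a * (b * b)
        e = solve-∀
        lam² : lam ^ s * lam ^ s ≤ 2 ^ t
        lam² = begin
          lam ^ s * lam ^ s        ≡⟨ ^-distribʳ-* s lam lam ⟨
          (lam * lam) ^ s          ≡⟨ cong (_^ s) (trans (sym (^-distribʳ-* (suc k) 4 4)) (^-*-assoc 2 4 (suc k))) ⟩
          (2 ^ (4 * suc k)) ^ s    ≡⟨ ^-*-assoc 2 (4 * suc k) s ⟩
          2 ^ (4 * suc k * s)      ≤⟨ ^-monoʳ-≤ 2 h ⟩
          2 ^ t                    ∎

    upper-Θ : ∀ d {n} {L : List (Fin n)} {τ : Fin k → Fin n → Fin n} → State L τ → length L ≡ 2 * (d + t₀) →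
      4 * suc k * defect L τ ≤ d + t₀ → count (d + t₀) L τ ≤ (2 * (5 * (t₀ * doubleFactorial t₀)) + 2 * (doubleFactorial t₀ * 3 ^ t₀)) * H d
    upper-Θ d {n} {L} {τ} s len small = *-cancelʳ-≤ _ _ (2 ^ t * t) {{m*n≢0 (2 ^ t) t {{m^n≢0 2 t}} {{t-nonZero}}}} (begin
      N * (2 ^ t * t)                               ≡⟨ e₁ N (2 ^ t) t ⟩
      2 ^ t * (t * N)                               ≤⟨ m≤m+n _ _ ⟩
      2 ^ t * (t * N) + 4 * (t * O)                 ≤⟨ upper {n} d s len ⟩
      2 ^ t * (W * H d * (t ∸ γ + 2 * suc k * S)) + 2 * (t * O) * lam ^ S
        ≤⟨ +-mono-≤ (*-monoʳ-≤ (2 ^ t) (*-monoʳ-≤ (W * H d) (+-mono-≤ (m∸n≤m t γ) 2S≤t)))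
                    (≤-trans (≤-reflexive (e₂ t O (lam ^ S))) (*-monoʳ-≤ (2 * t) Olam)) ⟩
      2 ^ t * (W * H d * (t + t)) + 2 * t * (C₀ * (H d * 2 ^ t))   ≡⟨ e₃ (2 ^ t) W (H d) t C₀ ⟩
      (2 * W + 2 * C₀) * H d * (2 ^ t * t)          ∎)
      where
      open ≤-Reasoning
      t = d + t₀
      N = count t L τ
      S = defect L τ
      O = doubleFactorial t
      W = 5 * (t₀ * doubleFactorial t₀)
      t-nonZero : NonZero t
      t-nonZero = >-nonZero (≤-trans (>-nonZero⁻¹ t₀) (m≤n+m t₀ d))
      2S≤t : 2 * suc k * S ≤ t
      2S≤t = ≤-trans (*-monoˡ-≤ S (*-monoˡ-≤ (suc k) (s≤s (s≤s (z≤n {2}))))) small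
      Olam : O * lam ^ S ≤ C₀ * (H d * 2 ^ t)
      Olam = *-cancelʳ-≤ _ _ (2 ^ t) {{m^n≢0 2 t}} (begin
        O * lam ^ S * 2 ^ t             ≡⟨ *-assoc O _ _ ⟩
        O * (lam ^ S * 2 ^ t)           ≤⟨ *-monoʳ-≤ O (lam-small t S small) ⟩
        O * 3 ^ t                       ≤⟨ doubleFactorial-growth d ⟩
        C₀ * (H d * 4 ^ t)              ≡⟨ cong (λ z → C₀ * (H d * z)) (^-distribʳ-* t 2 2) ⟩
        C₀ * (H d * (2 ^ t * 2 ^ t))    ≡⟨ e₀ C₀ (H d) (2 ^ t) ⟩
        C₀ * (H d * 2 ^ t) * 2 ^ t      ∎)
        where
        e₀ : ∀ C H p → C * (H * (p * p)) ≡ C * (H * p) * p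
        e₀ = solve-∀
      e₁ : ∀ N q t → N * (q * t) ≡ q * (t * N)
      e₁ = solve-∀
      e₂ : ∀ t O l → 2 * (t * O) * l ≡ 2 * t * (O * l)
      e₂ = solve-∀
      e₃ : ∀ q W H t C → q * (W * H * (t + t)) + 2 * t * (C * (H * q)) ≡ (2 * W + 2 * C) * H * (q * t)
      e₃ = solve-∀

-- Existence of a solution: making two matchings share protected edges.

module Merging where

  open Finite
  open Switching
  open Counting
  open Overlaps
  open Bounds
  open import Data.Nat hiding (_≟_)
  open import Data.Nat.Properties hiding (_≟_)
  open import Data.Nat.Tactic.RingSolver
  open import Data.Fin using (Fin)
  import Data.Fin.Properties as Fin
  open import Data.List using (List; []; _∷_; length; filter)
  open import Data.List.Relation.Unary.Any using (here; there)
  import Data.List.Relation.Unary.All as All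
  open import Data.List.Relation.Unary.AllPairs using ([]; _∷_)
  open import Data.List.Membership.Propositional using (_∈_; _∉_)
  open import Data.List.Membership.Propositional.Properties using (∈-filter⁺; ∈-filter⁻)
  open import Data.List.Relation.Unary.Unique.Propositional using (Unique)
  open import Data.Product using (_×_; _,_; proj₁; proj₂; ∃-syntax)
  open import Data.Sum using (inj₁; inj₂)
  open import Function using (_∘_)
  open import Relation.Nullary using (¬_; yes; no; ¬?; contradiction)
  open import Relation.Nullary.Decidable using (_×-dec_)
  open import Relation.Binary using (Decidable)
  open import Relation.Binary.PropositionalEquality

  open IsMatching

  -- A bound for the number of vertices within distance 6 of l given ones.
  opaque
    ball₆ : ℕ → ℕ → ℕ
    ball₆ k l = suc k ^ 6 * l

    ball₆-mono : ∀ k {l l′} → l ≤ l′ → ball₆ k l ≤ ball₆ k l′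
    ball₆-mono k = *-monoʳ-≤ (suc k ^ 6)

  -- The coincidences other than that of τ f with τ g.
  Other : ∀ {k} (f g i j : Fin k) → Set
  Other f g i j = i ≢ j × ¬ (i ≡ f × j ≡ g) × ¬ (i ≡ g × j ≡ f)

  other? : ∀ {k} (f g : Fin k) → Decidable (Other f g)
  other? f g i j = ¬? (i Fin.≟ j) ×-dec (¬? ((i Fin.≟ f) ×-dec (j Fin.≟ g)) ×-dec ¬? ((i Fin.≟ g) ×-dec (j Fin.≟ f)))

  module _ {n k : ℕ} where

    private V = Fin n

    -- All admissible outer edges are quantified over, because each move adds a pair to them.
    Solvable : List V → (Fin k → V → V) → Set
    Solvable L τ = ∀ {e} → Outer L e → ∃[ σ ] Solves L e τ σ

    solvable-move : ∀ {L : List V} {τ : Fin k → V → V} {u v} → State L τ → u ∈ L → v ∈ L → u ≢ v → Valid τ u v →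
      Solvable (delete u v L) (switchAll τ u v) → Solvable L τ
    solvable-move s u∈ v∈ u≢v val sol o =
      let (σ , p) = sol (outer-pair u≢v u∈ v∈ o) in σ , proj₁ (solves-switch⁻ s u∈ v∈ u≢v val p)

    solvable⇒count : ∀ t {L : List V} {τ : Fin k → V → V} → State L τ → length L ≡ 2 * t → Solvable L τ → 1 ≤ count t L τ
    solvable⇒count t s len sol with State.outer s
    ... | e , o with hasCount t s o len | sol o
    ... | xs , _ , mem , eq | σ , p = subst (1 ≤_) eq (nonempty xs (Equivalence.from (mem σ) p))
      where
      open import Function using (Equivalence)
      nonempty : ∀ ys → σ ∈ ys → 1 ≤ length ys
      nonempty (_ ∷ _) _ = s≤s z≤n

    opaque
      unfolding ball₆
      length-ball₆ : ∀ (τ : Fin k → V → V) xs → length (ball τ 6 xs) ≡ ball₆ k (length xs)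
      length-ball₆ τ xs = length-ball τ 6 xs

    fresh : ∀ {L : List V} {τ : Fin k → V → V} xs → State L τ → ball₆ k (length xs) < length L → ∃[ v ] v ∈ L × Far τ xs 6 v
    fresh {L} {τ} xs s lt with pick _≟_ (ball τ 6 xs) (State.unique s) (≤-trans (s≤s (≤-reflexive (length-ball₆ τ xs))) lt)
    ... | v , v∈ , v∉ = v , v∈ , v∉ ∘ near⇒∈ball

    near-mono : ∀ {τ : Fin k → V → V} {xs ys r x} → (∀ {y} → y ∈ xs → y ∈ ys) → Near τ xs r x → Near τ ys r x
    near-mono f (base x∈) = base (f x∈)
    near-mono f (step i p) = step i (near-mono f p)

    far-near-≢ : ∀ {τ : Fin k → V → V} {xs r x y} → Far τ xs r x → Near τ xs r y → x ≢ y
    far-near-≢ f p refl = f p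

    length-child : ∀ t {L : List V} {τ : Fin k → V → V} {u v} → State L τ → length L ≡ 2 * suc t → u ∈ L → v ∈ L → u ≢ v →
      length (delete u v L) ≡ 2 * t
    length-child t s len u∈ v∈ u≢v = suc-injective (suc-injective (trans (length-delete (State.unique s) u∈ v∈ u≢v)
      (trans len (cong suc (+-suc t (t + 0))))))

    Distinct : (Fin k → V → V) → V → Set
    Distinct τ w = ∀ {i j} → i ≢ j → τ i w ≢ τ j w

    module Merge (f g : Fin k) {R : Fin k → Fin k → Set} (R? : Decidable R) where

      -- P collects vertices on which τ f and τ g agree, and which later moves do not disturb.
      record Protected (L : List V) (τ : Fin k → V → V) (P : List V) : Set where
        field
          P-unique : Unique P
          inside   : ∀ {x} → x ∈ P → x ∈ L
          double   : ∀ {x} → x ∈ P → τ f x ≡ τ g x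
          P-closed : ∀ {x} → x ∈ P → τ f x ∈ P
          clean    : ∀ {x} → x ∈ P → ¬ Overlap R τ x

      protected-[] : ∀ {L : List V} {τ : Fin k → V → V} → Protected L τ []
      protected-[] = record { P-unique = [] ; inside = λ () ; double = λ () ; P-closed = λ () ; clean = λ () }

      module _ {L : List V} {τ : Fin k → V → V} {P u v} (s : State L τ) (pr : Protected L τ P) (u∉ : u ∉ P) (v∉ : v ∉ P) (u≢v : u ≢ v) (val : Valid τ u v) where
        open State s
        open Protected pr

        private
          ∈≢ : ∀ {x y} → x ∈ P → y ∉ P → x ≢ y
          ∈≢ x∈ y∉ refl = y∉ x∈
          ∈≢τf : ∀ {x y} → x ∈ P → y ∉ P → x ≢ τ f y
          ∈≢τf x∈ y∉ eq = y∉ (subst (_∈ P) (flip (matching f) (sym eq)) (P-closed x∈))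
          ∈≢τg : ∀ {x y} → x ∈ P → y ∉ P → x ≢ τ g y
          ∈≢τg x∈ y∉ eq = y∉ (subst (_∈ P) (trans (double x∈) (flip (matching g) (sym eq))) (P-closed x∈))

          same-f : ∀ {x} → x ∈ P → switch (τ f) u v x ≡ τ f x
          same-f x∈ = switch-away (τ f) (∈≢ x∈ u∉) (∈≢ x∈ v∉) (∈≢τf x∈ u∉) (∈≢τf x∈ v∉)
          same-g : ∀ {x} → x ∈ P → switch (τ g) u v x ≡ τ g x
          same-g x∈ = switch-away (τ g) (∈≢ x∈ u∉) (∈≢ x∈ v∉) (∈≢τg x∈ u∉) (∈≢τg x∈ v∉)

        -- P is closed under τ f, hence under τ g, and avoids u and v, so the edges of these two
        -- matchings at P survive. The other matchings may change there, which is why cleanness is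
        -- supplied anew.
        protected-move : (∀ {x} → x ∈ P → ¬ Overlap R (switchAll τ u v) x) → Protected (delete u v L) (switchAll τ u v) P
        protected-move cl = record
          { P-unique = P-unique
          ; inside = λ x∈ → ∈-delete⁺ (inside x∈) (∈≢ x∈ u∉) (∈≢ x∈ v∉)
          ; double = λ x∈ → trans (same-f x∈) (trans (double x∈) (sym (same-g x∈)))
          ; P-closed = λ x∈ → subst (_∈ P) (sym (same-f x∈)) (P-closed x∈)
          ; clean = cl }

        protected-far : Far τ (u ∷ []) 3 v → Protected (delete u v L) (switchAll τ u v) P
        protected-far far = protected-move (λ x∈ → clean x∈ ∘ overlap-far matching far (∈≢ x∈ u∉) (∈≢ x∈ v∉))

      -- An overlapped vertex is outside the clean set P. Joining it to a vertex far from it and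
      -- outside P removes its coincidence and creates none. The outcome goes to a continuation
      -- because solvability is inherited backwards, from the smaller instance to the larger one.
      repair : ∀ o t {L : List V} {τ : Fin k → V → V} {P} → State L τ → length L ≡ 2 * t → Protected L τ P →
        length (overlapped R? L τ) ≤ o → ball₆ k (suc (length P)) + 2 * o < 2 * t →
        (∀ t′ {L′ : List V} {τ′ : Fin k → V → V} → State L′ τ′ → length L′ ≡ 2 * t′ → Protected L′ τ′ P → overlapped R? L′ τ′ ≡ [] → t ≤ t′ + o → Solvable L′ τ′) →
        Solvable L τ
      repair o t {L} {τ} s len pr ov≤ big cont with overlapped R? L τ in eq
      ... | [] = cont t s len pr eq (m≤m+n t o)
      repair (suc o) (suc t) {L} {τ} {P} s len pr ov≤ big cont | w ∷ ws
        with fresh (w ∷ P) s (≤-trans (s≤s (m≤m+n _ _)) (≤-trans big (≤-reflexive (sym len))))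
      ... | v , v∈ , far = solvable-move s w∈ v∈ w≢v val (repair o t s′ (length-child t s len w∈ v∈ w≢v) (protected-far s pr w∉ v∉ w≢v val far3)
          (≤-pred (≤-trans (overlapped-far-< R? s w∈ ovw far3) (≤-trans (≤-reflexive (cong length eq)) ov≤)))
          (+-cancelʳ-≤ 2 _ _ (subst₂ _≤_ (e₁ (ball₆ k (suc (length P))) o) (e₂ t) big))
          (λ t′ s″ l″ p″ e″ le → cont t′ s″ l″ p″ e″ (≤-trans (s≤s le) (≤-reflexive (sym (+-suc t′ o))))))
        where
        w∈ov : w ∈ overlapped R? L τ
        w∈ov = subst (w ∈_) (sym eq) (here refl)
        w∈ = proj₁ (∈-filter⁻ (overlap? R? τ) {xs = L} w∈ov)
        ovw = proj₂ (∈-filter⁻ (overlap? R? τ) {xs = L} w∈ov)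
        w∉ : w ∉ P
        w∉ w∈P = Protected.clean pr w∈P ovw
        v∉ : v ∉ P
        v∉ v∈P = far (base (there v∈P))
        far3 : Far τ (w ∷ []) 3 v
        far3 p = far (weaken (weaken (weaken (near-mono (λ where (here e) → here e) p))))
        w≢v : w ≢ v
        w≢v refl = far (base (here refl))
        val : Valid τ w v
        val = far⇒valid (State.matching s) (far-weaken (far-weaken far3))
        s′ = state-switch s w∈ v∈ w≢v val
        e₁ : ∀ K o → suc (K + 2 * suc o) ≡ suc (K + 2 * o) + 2
        e₁ = solve-∀
        e₂ : ∀ t → 2 * suc t ≡ 2 * t + 2
        e₂ = solve-∀
      repair (suc o) zero {L} s len pr ov≤ big cont | w ∷ ws = contradiction big (λ ())
      repair zero t s len pr () big cont | w ∷ ws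

    module Doubling (f g : Fin k) (f≢g : f ≢ g) where

      open Merge f g (other? f g) public

      private
        g≢f : g ≢ f
        g≢f = f≢g ∘ sym
        κ = suc k

      module _ (L : List V) (τ : Fin k → V → V) (P : List V) where

        record Generic : Set where
          field
            state     : State L τ
            protect   : Protected L τ P
            no-other  : overlapped (other? f g) L τ ≡ []
            distinct  : ∀ {x} → x ∈ L → x ∉ P → Distinct τ x

      module _ {L : List V} {τ : Fin k → V → V} {P} (G : Generic L τ P) {u v : V} (u∈ : u ∈ L) (v∈ : v ∈ L) (u∉ : u ∉ P) (v∉ : v ∉ P)
               (u≢v : u ≢ v) (far : Far τ (u ∷ []) 3 v) where

        open Generic G
        open State state

        private
          val : Valid τ u v
          val = far⇒valid matching (far-weaken (far-weaken far))

        generic-far : Generic (delete u v L) (switchAll τ u v) P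
        generic-far = record
          { state = state-switch state u∈ v∈ u≢v val
          ; protect = protected-far state protect u∉ v∉ u≢v val far
          ; no-other = none
          ; distinct = λ x∈ x∉ i≢j eq → let (x∈L , x≢u , x≢v) = ∈-delete⁻ L x∈ in
              distinct x∈L x∉ i≢j (switch-coincide-far matching far _ _ x≢u x≢v eq) }
          where
          zero-length : ∀ {A : Set} {xs : List A} → length xs ≤ 0 → xs ≡ []
          zero-length {xs = []} _ = refl
          none = zero-length (≤-trans (overlapped-far (other? f g) state far) (≤-reflexive (cong length no-other)))

      -- The continuation that awaits one more double edge; 2(k+1) bounds the pairs spent on
      -- repairs.
      Enlarged : ℕ → List V → Set
      Enlarged t P = ∀ t′ {L′ : List V} {τ′ : Fin k → V → V} {P′} → State L′ τ′ → length L′ ≡ 2 * t′ → Protected L′ τ′ P′ →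
        overlapped (other? f g) L′ τ′ ≡ [] → length P′ ≡ 2 + length P → t ≤ t′ + κ * 2 → Solvable L′ τ′

      module _ t {L : List V} {τ : Fin k → V → V} {P} (G : Generic L τ P) (len : length L ≡ 2 * suc t) {x x₂ a b : V}
        (x∈ : x ∈ L) (x∉ : x ∉ P) (ex : τ f x ≡ x₂) (ea : τ g x ≡ a) (eb : τ g x₂ ≡ b)
        (c₁ : ∀ i → τ i a ≢ b) (c₂ : ∀ i → τ i x ≢ b) (c₃ : ∀ i → τ i x₂ ≢ a)
        (a-far : ∀ i → τ i a ∉ P) (b-far : ∀ i → τ i b ∉ P) where

        open Generic G
        open State state
        open Protected protect

        private
          mf = matching f
          mg = matching g
          x₂∈ : x₂ ∈ L
          x₂∈ = subst (_∈ L) ex (closed f x∈)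
          x₂∉ : x₂ ∉ P
          x₂∉ p = x∉ (subst (_∈ P) (flip mf ex) (P-closed p))
          dx : Distinct τ x
          dx = distinct x∈ x∉
          dx₂ : Distinct τ x₂
          dx₂ = distinct x₂∈ x₂∉
          a∈ : a ∈ L
          a∈ = subst (_∈ L) ea (closed g x∈)
          b∈ : b ∈ L
          b∈ = subst (_∈ L) eb (closed g x₂∈)
          ∉g : ∀ {y z} → y ∉ P → τ g y ≡ z → z ∉ P
          ∉g y∉ eq p = y∉ (subst (_∈ P) (trans (double p) (flip mg eq)) (P-closed p))
          a∉ = ∉g x∉ ea
          b∉ = ∉g x₂∉ eb
          x≢x₂ : x ≢ x₂
          x≢x₂ refl = nofix mf _ ex
          a≢x₂ : a ≢ x₂
          a≢x₂ refl = dx g≢f (trans ea (sym ex))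
          b≢x : b ≢ x
          b≢x refl = dx₂ g≢f (trans eb (sym (flip mf ex)))
          a≢b : a ≢ b
          a≢b refl = x≢x₂ (injective mg (trans ea (sym eb)))
          x≢a : x ≢ a
          x≢a refl = nofix mg _ ea
          x₂≢b : x₂ ≢ b
          x₂≢b refl = nofix mg _ eb
          τ′ = switchAll τ a b
          s′ = state-switch state a∈ b∈ a≢b c₁
          m′ = State.matching s′
          x∈′ = ∈-delete⁺ {u = a} {v = b} x∈ x≢a (b≢x ∘ sym)
          x₂∈′ = ∈-delete⁺ {u = a} {v = b} x₂∈ (a≢x₂ ∘ sym) x₂≢b
          keep-x : ∀ i → i ≢ g → τ′ i x ≡ τ i x
          keep-x i i≢g = switch-away (τ i) x≢a (b≢x ∘ sym)
            (λ eq → dx i≢g (trans (flip (matching i) (sym eq)) (sym ea))) (λ eq → c₂ i (flip (matching i) (sym eq)))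
          keep-x₂ : ∀ i → i ≢ g → τ′ i x₂ ≡ τ i x₂
          keep-x₂ i i≢g = switch-away (τ i) (a≢x₂ ∘ sym) x₂≢b
            (λ eq → c₃ i (flip (matching i) (sym eq))) (λ eq → dx₂ i≢g (trans (flip (matching i) (sym eq)) (sym eb)))
          g-x : τ′ g x ≡ x₂
          g-x = trans (cong (τ′ g) (sym (flip mg ea))) (trans (switch-τu mg a≢b (c₁ g)) (flip mg eb))
          f-x : τ′ f x ≡ x₂
          f-x = trans (keep-x f f≢g) ex
          cleanAfter : ∀ {w} → Distinct τ w → (∀ i → i ≢ g → τ′ i w ≡ τ i w) → τ′ g w ≡ τ f w → ¬ Overlap (Other f g) τ′ w
          cleanAfter d keep gw (i , j , (i≢j , ¬fg , ¬gf) , eq) with i Fin.≟ g | j Fin.≟ g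
          ... | yes refl | yes refl = i≢j refl
          ... | no p | no q = d i≢j (trans (sym (keep i p)) (trans eq (keep j q)))
          ... | yes refl | no q with j Fin.≟ f
          ...   | yes refl = ¬gf (refl , refl)
          ...   | no r = d (r ∘ sym) (trans (sym gw) (trans eq (keep j q)))
          cleanAfter d keep gw (i , j , (i≢j , ¬fg , ¬gf) , eq) | no p | yes refl with i Fin.≟ f
          ...   | yes refl = ¬fg (refl , refl)
          ...   | no r = d r (trans (sym (keep i p)) (trans eq gw))
          away-P : ∀ {w} → w ∈ P → Far τ (a ∷ b ∷ []) 1 w
          away-P w∈ (base (here refl)) = a∉ w∈
          away-P w∈ (base (there (here refl))) = b∉ w∈
          away-P w∈ (step i (base (here refl))) = a-far i w∈
          away-P w∈ (step i (base (there (here refl)))) = b-far i w∈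
          P′ = x ∷ x₂ ∷ P
          pr₀ = protected-move state protect a∉ b∉ a≢b c₁ (λ w∈ → clean w∈ ∘ overlap-away matching (away-P w∈))
          module P₀ = Protected pr₀
          protected′ : Protected (delete a b L) τ′ P′
          protected′ = record
            { P-unique = (x≢x₂ All.∷ All.tabulate (λ w∈ → λ where refl → x∉ w∈)) ∷ (All.tabulate (λ w∈ → λ where refl → x₂∉ w∈) ∷ P₀.P-unique)
            ; inside = λ where
                (here refl) → x∈′
                (there (here refl)) → x₂∈′
                (there (there w∈)) → P₀.inside w∈
            ; double = λ where
                (here refl) → trans f-x (sym g-x)
                (there (here refl)) → trans (flip (m′ f) {x} f-x) (sym (flip (m′ g) {x} g-x))
                (there (there w∈)) → P₀.double w∈
            ; P-closed = λ where
                (here refl) → there (here f-x)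
                (there (here refl)) → here (flip (m′ f) {x} f-x)
                (there (there w∈)) → there (there (P₀.P-closed w∈))
            ; clean = λ where
                (here refl) → cleanAfter dx keep-x (trans g-x (sym ex))
                (there (here refl)) → cleanAfter dx₂ keep-x₂ (trans (flip (m′ g) {x} g-x) (sym (flip mf ex)))
                (there (there w∈)) → P₀.clean w∈ }

        -- Joining a and b replaces the g-edges xa and x₂b by xx₂, which is an f-edge already. The
        -- conditions `c₂` and `c₃` preserve the other matchings at x and x₂, while `a-far` and
        -- `b-far` preserve everything at P. The coincidences created elsewhere, at most 2(k+1), are
        -- left to `repair`.
        double-edge : ball₆ k (3 + length P) + 2 * (κ * 2) < 2 * t → Enlarged t P → Solvable L τ
        double-edge big cont = solvable-move state a∈ b∈ a≢b c₁
          (repair (κ * 2) t s′ (length-child t state len a∈ b∈ a≢b) protected′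
            (≤-trans (overlapped-near (other? f g) state a b) (≤-reflexive (cong (λ l → length l + κ * 2) no-other)))
            big (λ t′ s″ l″ p″ e″ le → cont t′ s″ l″ p″ e″ refl le))

      private
        <-two : ∀ {m} t → m < 2 * t → m < 2 * suc t
        <-two t lt = ≤-trans lt (*-monoʳ-≤ 2 (n≤1+n t))

        big⇒fresh : ∀ {l} t {m} → m ≡ 2 * t → ball₆ k (3 + l) + 2 * (κ * 2) < 2 * t → ball₆ k (suc l) < m
        big⇒fresh {l} t len big = ≤-trans (s≤s (≤-trans (ball₆-mono k {suc l} {3 + l} (s≤s (m≤n+m l 2))) (m≤m+n _ _))) (≤-trans big (≤-reflexive (sym len)))

      -- If p is free then joining p to a far vertex y makes τ(p)τ(y) an edge of the f-matching whose
      -- g-neighbours can be joined, and that turns it into an edge of both matchings.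
      grow-free : ∀ t {L : List V} {τ : Fin k → V → V} {P} → Generic L τ P → length L ≡ 2 * suc (suc t) →
        ∀ {p x a} → p ∈ L → p ∉ P → τ f p ≡ x → τ g x ≡ a →
        (∀ i → τ i p ≢ a) → (∀ i → τ i p ∉ P) → (∀ i → τ i a ∉ P) →
        ball₆ k (3 + length P) + 2 * (κ * 2) < 2 * t → Enlarged t P → Solvable L τ
      grow-free t {L} {τ} {P} G len {p} p∈ p∉ refl refl free p-far a-far big cont
        with fresh (p ∷ P) (Generic.state G) (big⇒fresh (suc (suc t)) len (<-two (suc t) (<-two t big)))
      ... | y , y∈ , far = solvable-move state p∈ y∈ p≢y (far⇒valid matching (far-weaken (far-weaken far3)))
          (double-edge t (generic-far G p∈ y∈ p∉ y∉ p≢y far3) (length-child (suc t) state len p∈ y∈ p≢y)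
            (∈-delete⁺ (closed f p∈) (nofix mf p) (≢-sym (y≢ (step f (base (here refl)))))) (p-far f)
            f-x g-x g-x₂ c₁ c₂ c₃ a-far′ b-far′ big cont)
        where
        open Generic G
        open State state
        mf = matching f
        mg = matching g
        y≢ : ∀ {w} → Near τ (p ∷ P) 6 w → y ≢ w
        y≢ = far-near-≢ far
        p≢y : p ≢ y
        p≢y = ≢-sym (y≢ (base (here refl)))
        y∉ : y ∉ P
        y∉ w = far (base (there w))
        far3 : Far τ (p ∷ []) 3 y
        far3 q = far (weaken (weaken (weaken (near-mono (λ where (here e) → here e) q))))
        dp = distinct p∈ p∉
        dy = distinct y∈ y∉
        τ′ = switchAll τ p y
        m′ = State.matching (Generic.state (generic-far G p∈ y∈ p∉ y∉ p≢y far3))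
        val = far⇒valid matching (far-weaken (far-weaken far3))
        x = τ f p
        a = τ g x
        x₂ = τ f y
        b = τ g x₂
        fstep : ∀ {r w} i → Far τ (p ∷ P) (suc r) w → Far τ (p ∷ P) r (τ i w)
        fstep = far-step matching
        x₂-far : Far τ (p ∷ P) 5 x₂
        x₂-far = fstep f far
        b-far4 : Far τ (p ∷ P) 4 b
        b-far4 = fstep g x₂-far
        near-p : ∀ {r} → Near τ (p ∷ P) r p
        near-p = base (here refl)
        f-x : τ′ f x ≡ x₂
        f-x = switch-τu mf p≢y (val f)
        g-x : τ′ g x ≡ a
        g-x = switch-away (τ g) (nofix mf p) (≢-sym (y≢ (step f near-p))) (dp f≢g)
          (≢-sym (far-near-≢ (fstep g far) (step f near-p)))
        g-x₂ : τ′ g x₂ ≡ b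
        g-x₂ = switch-away (τ g) (far-near-≢ x₂-far near-p) (nofix mf y) (far-near-≢ x₂-far (step g near-p)) (dy f≢g)
        keep-a : ∀ i → τ′ i a ≡ τ i a
        keep-a i = switch-away (τ i) (λ e → dp f≢g (sym (flip mg e))) (≢-sym (y≢ (step g (step f near-p))))
          (≢-sym (free i)) (≢-sym (far-near-≢ (fstep i far) (step g (step f near-p))))
        c₁ : ∀ i → τ′ i a ≢ b
        c₁ i e = far-near-≢ b-far4 (step i (step g (step f near-p))) (trans (sym e) (keep-a i))
        c₂ : ∀ i → τ′ i x ≢ b
        c₂ i e with i Fin.≟ f
        ... | yes refl = nofix mg x₂ (trans (sym e) f-x)
        ... | no i≢f = far-near-≢ b-far4 (step i (step f near-p)) (trans (sym e)
          (switch-away (τ i) (nofix mf p) (≢-sym (y≢ (step f near-p))) (dp (≢-sym i≢f)) (≢-sym (far-near-≢ (fstep i far) (step f near-p)))))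
        c₃ : ∀ i → τ′ i x₂ ≢ a
        c₃ i e with i Fin.≟ f
        ... | yes refl = nofix mg x (sym (trans (sym (flip (m′ f) {x} f-x)) e))
        ... | no i≢f = far-near-≢ (fstep i x₂-far) (step g (step f near-p)) (trans (sym
          (switch-away (τ i) (far-near-≢ x₂-far near-p) (nofix mf y) (far-near-≢ x₂-far (step i near-p)) (dy (≢-sym i≢f)))) e)
        a-far′ : ∀ i → τ′ i a ∉ P
        a-far′ i w = a-far i (subst (_∈ P) (keep-a i) w)
        b-far′ : ∀ i → τ′ i b ∉ P
        b-far′ i w with switch-values (matching i) p≢y (val i) b (far-near-≢ b-far4 near-p) (λ e → dy f≢g (sym (flip mg e)))
        ... | inj₁ e = fstep i b-far4 (base (there (subst (_∈ P) e w)))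
        ... | inj₂ (inj₁ e) = fstep i far (base (there (subst (_∈ P) e w)))
        ... | inj₂ (inj₂ e) = p-far i (subst (_∈ P) e w)

      -- Joining two vertices u and z far apart makes p = τ f u and q = τ f z the ends of an f-edge.
      -- The g-neighbour a of q stays far from the old surroundings of p, so no matching joins p to
      -- a: the configuration that `grow-free` asks for.
      grow-generic : ∀ t {L : List V} {τ : Fin k → V → V} {P} → Generic L τ P → length L ≡ 2 * suc (suc (suc t)) →
        ball₆ k (3 + length P) + 2 * (κ * 2) < 2 * t → Enlarged t P → Solvable L τ
      grow-generic t {L} {τ} {P} G len big cont
        with fresh P (Generic.state G) (≤-trans (s≤s (ball₆-mono k (n≤1+n (length P)))) (big⇒fresh (3 + t) len (<-two (2 + t) (<-two (suc t) (<-two t big)))))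
      ... | u , u∈ , ufar with fresh (u ∷ P) (Generic.state G) (big⇒fresh (3 + t) len (<-two (2 + t) (<-two (suc t) (<-two t big))))
      ... | z , z∈ , far = solvable-move state u∈ z∈ u≢z val
          (grow-free t (generic-far G u∈ z∈ u∉ z∉ u≢z far3) (length-child (suc (suc t)) state len u∈ z∈ u≢z)
            (∈-delete⁺ (closed f u∈) (nofix mf u) (≢-sym (z≢ (step f near-u)))) (λ w → ustep f ufar (base w))
            f-p g-q free p-far a-far big cont)
        where
        open Generic G
        open State state
        mf = matching f
        mg = matching g
        z≢ : ∀ {w} → Near τ (u ∷ P) 6 w → z ≢ w
        z≢ = far-near-≢ far
        near-u : ∀ {r} → Near τ (u ∷ P) r u
        near-u = base (here refl)
        u≢z : u ≢ z
        u≢z = ≢-sym (z≢ near-u)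
        u∉ : u ∉ P
        u∉ w = ufar (base w)
        z∉ : z ∉ P
        z∉ w = far (base (there w))
        far3 : Far τ (u ∷ []) 3 z
        far3 q = far (weaken (weaken (weaken (near-mono (λ where (here e) → here e) q))))
        val : Valid τ u z
        val = far⇒valid matching (far-weaken (far-weaken far3))
        du = distinct u∈ u∉
        dz = distinct z∈ z∉
        τ′ = switchAll τ u z
        m′ = State.matching (Generic.state (generic-far G u∈ z∈ u∉ z∉ u≢z far3))
        fstep : ∀ {r w} i → Far τ (u ∷ P) (suc r) w → Far τ (u ∷ P) r (τ i w)
        fstep = far-step matching
        ustep : ∀ {r w} i → Far τ P (suc r) w → Far τ P r (τ i w)
        ustep = far-step matching
        p = τ f u
        q = τ f z
        a = τ g q
        q-far : Far τ (u ∷ P) 5 q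
        q-far = fstep f far
        a-far4 : Far τ (u ∷ P) 4 a
        a-far4 = fstep g q-far
        f-p : τ′ f p ≡ q
        f-p = switch-τu mf u≢z (val f)
        g-q : τ′ g q ≡ a
        g-q = switch-away (τ g) (far-near-≢ q-far near-u) (nofix mf z) (far-near-≢ q-far (step g near-u)) (dz f≢g)
        free : ∀ i → τ′ i p ≢ a
        free i e with i Fin.≟ f
        ... | yes refl = nofix mg q (sym (trans (sym f-p) e))
        ... | no i≢f = far-near-≢ a-far4 (step i (step f near-u)) (trans (sym e)
          (switch-away (τ i) (nofix mf u) (≢-sym (z≢ (step f near-u))) (du (≢-sym i≢f)) (≢-sym (far-near-≢ (fstep i far) (step f near-u)))))
        outside : ∀ i w → w ≢ u → w ≢ z → τ i w ∉ P → τ′ i w ∉ P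
        outside i w w≢u w≢z w∉ m with switch-values (matching i) u≢z (val i) w w≢u w≢z
        ... | inj₁ e = w∉ (subst (_∈ P) e m)
        ... | inj₂ (inj₁ e) = fstep i far (base (there (subst (_∈ P) e m)))
        ... | inj₂ (inj₂ e) = ustep i ufar (base (subst (_∈ P) e m))
        p-far : ∀ i → τ′ i p ∉ P
        p-far i = outside i p (nofix mf u) (≢-sym (z≢ (step f near-u))) (λ w → ustep i (ustep f ufar) (base w))
        a-far : ∀ i → τ′ i a ∉ P
        a-far i = outside i a (far-near-≢ a-far4 near-u) (λ e → dz f≢g (sym (flip mg e))) (λ w → fstep i a-far4 (base (there w)))

      -- If f and g agree somewhere outside P, that edge is simply adopted. Otherwise no two
      -- matchings agree outside P, and a new double edge has to be built.
      grow : ∀ t {L : List V} {τ : Fin k → V → V} {P} → State L τ → length L ≡ 2 * (3 + t) → Protected L τ P →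
        overlapped (other? f g) L τ ≡ [] → ball₆ k (3 + length P) + 2 * (κ * 2) < 2 * t → Enlarged t P → Solvable L τ
      grow t {L} {τ} {P} s len pr none big cont with filter (λ w → (τ f w ≟ τ g w) ×-dec ¬? (mem? _≟_ w P)) L in eq
      ... | [] = grow-generic t (record { state = s ; protect = pr ; no-other = none ; distinct = dist }) len big cont
        where
        dist : ∀ {x} → x ∈ L → x ∉ P → Distinct τ x
        dist {x} x∈ x∉ {i} {j} i≢j e with i Fin.≟ f ×-dec j Fin.≟ g | i Fin.≟ g ×-dec j Fin.≟ f
        ... | yes (refl , refl) | _ with subst (x ∈_) eq (∈-filter⁺ _ x∈ (e , x∉))
        ...   | ()
        dist {x} x∈ x∉ {i} {j} i≢j e | _ | yes (refl , refl) with subst (x ∈_) eq (∈-filter⁺ _ x∈ (sym e , x∉))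
        ...   | ()
        dist {x} x∈ x∉ {i} {j} i≢j e | no p | no q
          with subst (x ∈_) none (∈-filter⁺ (overlap? (other? f g) τ) x∈ (i , j , (i≢j , p , q) , e))
        ...   | ()
      ... | w ∷ ws = cont (3 + t) s len protected′ none refl (≤-trans (m≤n+m t 3) (m≤m+n _ _))
        where
        open State s
        open Protected pr
        w∈fl : w ∈ filter (λ w → (τ f w ≟ τ g w) ×-dec ¬? (mem? _≟_ w P)) L
        w∈fl = subst (w ∈_) (sym eq) (here refl)
        w∈ = proj₁ (∈-filter⁻ (λ w → (τ f w ≟ τ g w) ×-dec ¬? (mem? _≟_ w P)) {xs = L} w∈fl)
        props = proj₂ (∈-filter⁻ (λ w → (τ f w ≟ τ g w) ×-dec ¬? (mem? _≟_ w P)) {xs = L} w∈fl)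
        w∉ = proj₂ props
        dbl = proj₁ props
        fw∉ : τ f w ∉ P
        fw∉ m = w∉ (subst (_∈ P) (invol (matching f) w) (P-closed m))
        no-overlap : ∀ {x} → x ∈ L → ¬ Overlap (Other f g) τ x
        no-overlap {x} x∈ o with subst (x ∈_) none (∈-filter⁺ (overlap? (other? f g) τ) x∈ o)
        ... | ()
        protected′ : Protected L τ (w ∷ τ f w ∷ P)
        protected′ = record
          { P-unique = (≢-sym (nofix (matching f) w) All.∷ All.tabulate (λ x∈ → λ where refl → w∉ x∈))
              ∷ (All.tabulate (λ x∈ → λ where refl → fw∉ x∈) ∷ P-unique)
          ; inside = λ where
              (here refl) → w∈
              (there (here refl)) → closed f w∈
              (there (there x∈)) → inside x∈
          ; double = λ where
              (here refl) → dbl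
              (there (here refl)) → trans (invol (matching f) w) (sym (trans (cong (τ g) dbl) (invol (matching g) w)))
              (there (there x∈)) → double x∈
          ; P-closed = λ where
              (here refl) → there (here refl)
              (there (here refl)) → here (invol (matching f) w)
              (there (there x∈)) → there (there (P-closed x∈))
          ; clean = λ where
              (here refl) → no-overlap w∈
              (there (here refl)) → no-overlap (closed f w∈)
              (there (there x∈)) → clean x∈ }

-- Existence of a solution: induction on the number of matchings.

module Existence where

  open Finite
  open Switching
  open Counting
  open Overlaps
  open Bounds
  open Theta
  open Merging
  open import Data.Nat hiding (_≟_)
  open import Data.Nat.Properties hiding (_≟_)
  open import Data.Nat.Tactic.RingSolver
  open import Data.Fin using (Fin; zero; suc)
  import Data.Fin.Properties as Fin
  open import Data.List using (List; []; _∷_; _++_; length; filter)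
  open import Data.List.Properties using (length-++)
  open import Data.List.Relation.Unary.Any using (here; there)
  import Data.List.Relation.Unary.All as All
  open import Data.List.Relation.Unary.AllPairs using ([]; _∷_)
  open import Data.List.Membership.Propositional using (_∈_; _∉_)
  open import Data.List.Membership.Propositional.Properties using (∈-filter⁺; ∈-filter⁻; ∈-++⁺ˡ; ∈-++⁺ʳ; ∈-++⁻)
  open import Data.List.Relation.Unary.Unique.Propositional using (Unique)
  import Data.List.Relation.Unary.Unique.Propositional.Properties as Unique
  open import Data.Product using (_×_; _,_; proj₁; proj₂; ∃-syntax)
  open import Data.Sum using (inj₁; inj₂)
  open import Function using (_∘_; Equivalence)
  open import Relation.Nullary using (¬_; yes; no; ¬?; contradiction)
  open import Relation.Nullary.Decidable using (_×-dec_)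
  open import Relation.Binary using (Decidable)
  open import Relation.Binary.PropositionalEquality

  open IsMatching

  opaque
    ball₃ : ℕ → ℕ
    ball₃ k = suc k ^ 3

  module _ {n k : ℕ} where

    private
      V = Fin n
      κ = suc k

    opaque
      unfolding ball₃
      length-ball₃ : ∀ (τ : Fin k → V → V) u → length (ball τ 3 (u ∷ [])) ≡ ball₃ k
      length-ball₃ τ u = trans (length-ball τ 3 (u ∷ [])) (*-identityʳ _)

    halve-child : ∀ t {L : List V} {τ : Fin k → V → V} {u v} → State L τ → length L ≡ 2 * t → u ∈ L → v ∈ L → u ≢ v →
      ∃[ t′ ] t ≡ suc t′ × length (delete u v L) ≡ 2 * t′
    halve-child (suc t) s len u∈ v∈ u≢v = t , refl , length-child t s len u∈ v∈ u≢v
    halve-child zero {_ ∷ _} s () u∈ v∈ u≢v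

    few-partner : k ≤ 1 → ∀ t {L : List V} {τ : Fin k → V → V} {u} → State L τ → length L ≡ 2 * suc (suc t) → u ∈ L →
      ∃[ v ] v ∈ L × u ≢ v × Valid τ u v
    few-partner k≤1 t {L} {τ} {u} s len u∈ with pick _≟_ (ball τ 1 (u ∷ [])) (State.unique s) (≤-trans (s≤s small) (≤-reflexive (sym len)))
      where
      small : length (ball τ 1 (u ∷ [])) ≤ suc (t + suc (suc (t + 0)))
      small = ≤-trans (≤-reflexive (trans (length-ball τ 1 (u ∷ [])) (trans (*-identityʳ _) (*-identityʳ _))))
        (s≤s (≤-trans k≤1 (≤-trans (s≤s z≤n) (m≤n+m (suc (suc (t + 0))) t))))
    ... | v , v∈ , v∉ = v , v∈ , (λ where refl → far (base (here refl))) , far⇒valid (State.matching s) far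
      where
      far : Far τ (u ∷ []) 1 v
      far = v∉ ∘ near⇒∈ball

    -- With at most one matching, any partner outside the closed neighbourhood of u will do. That
    -- neighbourhood has at most two vertices, while at least four are live before the base cases.
    solvable-few : k ≤ 1 → ∀ t {L : List V} {τ : Fin k → V → V} → State L τ → length L ≡ 2 * t → Solvable L τ
    solvable-few k≤1 zero {[]} s len o = _ , Equivalence.to (solves-[] o _) (here refl)
    solvable-few k≤1 (suc zero) {u ∷ v ∷ []} {τ} s len {e} o =
      let (σ , p) = solvable-few k≤1 zero {[]} {τ} s₀ refl o′ in σ , Equivalence.to (solves-pair u≢v σ) p
      where
      u≢v : u ≢ v
      u≢v with State.unique s
      ... | (p All.∷ All.[]) ∷ _ = p
      none : ∀ {x} → x ∉ delete u v (u ∷ v ∷ [])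
      none x∈ with ∈-delete⁻ (u ∷ v ∷ []) x∈
      ... | here p , q , _ = q p
      ... | there (here p) , _ , q = q p
      o′ : Outer [] (pair e u v)
      o′ = let o″ = outer-pair {e = e} u≢v (here refl) (there (here refl)) o in
        record { leaves = λ _ () ; return = λ {x} _ → Outer.return o″ {x} none ; moves = λ {x} _ → Outer.moves o″ {x} none }
      s₀ : State [] τ
      s₀ = record { unique = [] ; matching = State.matching s ; closed = λ _ () ; outer = _ , o′ }
    solvable-few k≤1 (suc (suc t)) {u ∷ L} {τ} s len =
      let (v , v∈ , u≢v , val) = few-partner k≤1 t s len (here refl)
      in solvable-move s (here refl) v∈ u≢v val
        (solvable-few k≤1 (suc t) (state-switch s (here refl) v∈ u≢v val) (length-child (suc t) s len (here refl) v∈ u≢v))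

    module Merged (f g : Fin k) (f≢g : f ≢ g) where

      open Doubling {n} f g f≢g

      private
        o? = other? f g
        -- Up to three pairs build a double edge and up to 2(k+1) pairs repair the coincidences it
        -- causes.
        cost = 3 + κ * 2

      grow-many : ∀ j t {L : List V} {τ : Fin k → V → V} {P} → State L τ → length L ≡ 2 * t → Protected L τ P →
        overlapped o? L τ ≡ [] → ball₆ k (3 + (j * 2 + length P)) + 2 * (κ * 2) + 2 * (j * cost) < 2 * t →
        (∀ t′ {L′ : List V} {τ′ : Fin k → V → V} {P′} → State L′ τ′ → length L′ ≡ 2 * t′ → Protected L′ τ′ P′ →
          overlapped o? L′ τ′ ≡ [] → length P′ ≡ j * 2 + length P → Solvable L′ τ′) →
        Solvable L τ
      grow-many zero t s len pr none big cont = cont t s len pr none refl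
      grow-many (suc j) t {L} {τ} {P} s len pr none big cont with t ∸ 3 | m+[n∸m]≡n 3≤t
        where
        3≤t : 3 ≤ t
        3≤t = *-cancelˡ-≤ 2 (≤-trans (≤-trans (≤-trans (m≤m+n 6 _) (≤-reflexive (e j κ))) (m≤n+m _ _)) (<⇒≤ big))
          where
          e : ∀ j κ → 6 + (2 * (κ * 2) + 2 * (j * (3 + κ * 2))) ≡ 2 * (suc j * (3 + κ * 2))
          e = solve-∀
      ... | t₁ | refl = grow t₁ s len pr none big₁ λ t′ {L′} {τ′} {P′} s′ len′ pr′ none′ lP le →
          grow-many j t′ s′ len′ pr′ none′ (big₂ t′ P′ lP le)
            λ t″ s″ l″ p″ n″ eq → cont t″ s″ l″ p″ n″ (trans eq (trans (cong (j * 2 +_) lP) (trans (+-suc (j * 2) (suc (length P))) (cong suc (+-suc (j * 2) (length P))))))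
        where
        X = ball₆ k (3 + (suc j * 2 + length P))
        e₁ : ∀ Y j κ → Y + 2 * (κ * 2) + 2 * (suc j * (3 + κ * 2)) ≡ Y + 2 * (κ * 2) + (2 * (κ * 2) + 2 * (j * (3 + κ * 2))) + 6
        e₁ = solve-∀
        e₂ : ∀ t₁ → 2 * (3 + t₁) ≡ 2 * t₁ + 6
        e₂ = solve-∀
        shifted : suc (X + 2 * (κ * 2) + (2 * (κ * 2) + 2 * (j * cost))) ≤ 2 * t₁
        shifted = +-cancelʳ-≤ 6 _ _ (subst₂ _≤_ (cong suc (e₁ X j κ)) (e₂ t₁) big)
        big₁ : ball₆ k (3 + length P) + 2 * (κ * 2) < 2 * t₁
        big₁ = ≤-trans (s≤s (≤-trans (+-monoˡ-≤ (2 * (κ * 2)) (ball₆-mono k (+-monoʳ-≤ 3 (m≤n+m (length P) (suc j * 2))))) (m≤m+n _ _))) shifted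
        big₂ : ∀ t′ (P′ : List V) → length P′ ≡ 2 + length P → t₁ ≤ t′ + κ * 2 →
          ball₆ k (3 + (j * 2 + length P′)) + 2 * (κ * 2) + 2 * (j * cost) < 2 * t′
        big₂ t′ P′ lP le = +-cancelʳ-≤ (2 * (κ * 2)) _ _ (≤-trans (≤-reflexive (trans
            (cong (λ z → suc (ball₆ k z + 2 * (κ * 2) + 2 * (j * cost) + 2 * (κ * 2))) (trans (cong (λ z → 3 + (j * 2 + z)) lP) (e₄ j (length P))))
            (cong suc (e₃ X (2 * (κ * 2)) (2 * (j * cost)))))) (≤-trans shifted (≤-trans (*-monoʳ-≤ 2 le) (≤-reflexive (*-distribˡ-+ 2 t′ (κ * 2))))))
          where
          e₃ : ∀ Y a b → Y + a + b + a ≡ Y + a + (a + b)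
          e₃ = solve-∀
          e₄ : ∀ j l → 3 + (j * 2 + (2 + l)) ≡ 3 + (suc j * 2 + l)
          e₄ = solve-∀

      -- P and the ball of radius 3 around u have `length P + ball₃ k` entries together, so while
      -- `L` is longer some vertex outside P can be joined to another without disturbing P.
      shrink : ∀ t {L : List V} {τ : Fin k → V → V} {P} → State L τ → length L ≡ 2 * t → Protected L τ P →
        (∀ t′ {L′ : List V} {τ′ : Fin k → V → V} → State L′ τ′ → length L′ ≡ 2 * t′ → Protected L′ τ′ P →
          length L′ ≤ length P + ball₃ k → Solvable L′ τ′) →
        Solvable L τ
      shrink zero {P = P} s len pr cont = cont zero s len pr (subst (_≤ length P + ball₃ k) (sym len) z≤n)
      shrink (suc t) {L} {τ} {P} s len pr cont with length L ≤? length P + ball₃ k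
      ... | yes small = cont (suc t) s len pr small
      ... | no ¬small with pick _≟_ P (State.unique s) (≤-trans (s≤s (m≤m+n _ _)) (≰⇒> ¬small))
      ... | u , u∈ , u∉ with pick _≟_ (P ++ ball τ 3 (u ∷ [])) (State.unique s)
                               (≤-trans (s≤s (≤-reflexive (trans (length-++ P) (cong (length P +_) (length-ball₃ τ u))))) (≰⇒> ¬small))
      ... | v , v∈ , v∉ = solvable-move s u∈ v∈ u≢v val
          (shrink t (state-switch s u∈ v∈ u≢v val) (length-child t s len u∈ v∈ u≢v) (protected-far s pr u∉ (v∉ ∘ ∈-++⁺ˡ) u≢v val far) cont)
        where
        far : Far τ (u ∷ []) 3 v
        far = v∉ ∘ ∈-++⁺ʳ P ∘ near⇒∈ball
        u≢v : u ≢ v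
        u≢v refl = far (base (here refl))
        val : Valid τ u v
        val = far⇒valid (State.matching s) (far-weaken (far-weaken far))

      cleanDoubles : List V → (Fin k → V → V) → List V
      cleanDoubles L τ = filter (λ w → (τ f w ≟ τ g w) ×-dec ¬? (overlap? o? τ w)) L

      singles : List V → (Fin k → V → V) → List V
      singles L τ = filter (λ w → ¬? (τ f w ≟ τ g w)) L

      private
        ∈-clean⁻ : ∀ {L : List V} {τ w} → w ∈ cleanDoubles L τ → w ∈ L × τ f w ≡ τ g w × ¬ Overlap (Other f g) τ w
        ∈-clean⁻ {L} {τ} = ∈-filter⁻ (λ w → (τ f w ≟ τ g w) ×-dec ¬? (overlap? o? τ w)) {xs = L}
        ∈-clean⁺ : ∀ {L : List V} {τ w} → w ∈ L → τ f w ≡ τ g w → ¬ Overlap (Other f g) τ w → w ∈ cleanDoubles L τ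
        ∈-clean⁺ {L} {τ} w∈ d c = ∈-filter⁺ (λ w → (τ f w ≟ τ g w) ×-dec ¬? (overlap? o? τ w)) w∈ (d , c)
        ∈-singles⁻ : ∀ {L : List V} {τ w} → w ∈ singles L τ → w ∈ L × τ f w ≢ τ g w
        ∈-singles⁻ {L} {τ} = ∈-filter⁻ (λ w → ¬? (τ f w ≟ τ g w)) {xs = L}
        ∈-singles⁺ : ∀ {L : List V} {τ w} → w ∈ L → τ f w ≢ τ g w → w ∈ singles L τ
        ∈-singles⁺ {L} {τ} = ∈-filter⁺ (λ w → ¬? (τ f w ≟ τ g w))

      module _ {L : List V} {τ : Fin k → V → V} (s : State L τ) (u v : V) where
        open State s

        -- Only vertices within distance 1 of u or v can lose the property.
        cleanDoubles-move : length (cleanDoubles L τ) ≤ length (cleanDoubles (delete u v L) (switchAll τ u v)) + κ * 2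
        cleanDoubles-move = ≤-trans (unique-⊆-length _≟_ (Unique.filter⁺ _ unique) sub)
          (≤-reflexive (trans (length-++ (cleanDoubles (delete u v L) (switchAll τ u v)))
            (cong (length (cleanDoubles (delete u v L) (switchAll τ u v)) +_) (trans (length-ball τ 1 (u ∷ v ∷ [])) (cong (_* 2) (*-identityʳ κ))))))
          where
          sub : ∀ {w} → w ∈ cleanDoubles L τ → w ∈ cleanDoubles (delete u v L) (switchAll τ u v) ++ ball τ 1 (u ∷ v ∷ [])
          sub {w} w∈ with mem? _≟_ w (ball τ 1 (u ∷ v ∷ []))
          ... | yes m = ∈-++⁺ʳ (cleanDoubles (delete u v L) (switchAll τ u v)) m
          ... | no ¬m = let (w∈L , d , c) = ∈-clean⁻ {L} {τ} w∈
                            away = ¬m ∘ near⇒∈ball in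
            ∈-++⁺ˡ (∈-clean⁺ {delete u v L} {switchAll τ u v} (∈-delete⁺ w∈L (λ where refl → away (base (here refl))) (λ where refl → away (base (there (here refl)))))
              (trans (switch-near matching f away) (trans d (sym (switch-near matching g away))))
              (λ o → c (overlap-away matching away o)))

      private
        -- A double edge at x cannot end at u, where the two matchings differ. That it does not end
        -- at v either is left to the caller: v may differ too, or be an end of a double edge that
        -- is given up.
        still-double : ∀ {τ : Fin k → V → V} → (∀ i → IsMatching (τ i)) → ∀ {u v x} → x ≢ u → x ≢ v → x ≢ τ f v → x ≢ τ g v →
          τ f u ≢ τ g u → τ f x ≡ τ g x → switch (τ f) u v x ≡ switch (τ g) u v x
        still-double {τ} m {u} p q rf rg nu d = trans (switch-away (τ f) p q
            (λ e → nu (trans (sym e) (sym (flip (m g) (trans (sym d) (flip (m f) (sym e))))))) rf)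
          (trans d (sym (switch-away (τ g) p q (λ e → nu (trans (flip (m f) (trans d (flip (m g) (sym e)))) e)) rg)))

      -- Eliminating the vertices at which the two matchings differ. If u cannot be joined to the next
      -- vertex v but one on its alternating path, then u is first joined to one end of a double edge,
      -- whose other end takes the place of u.
      merge : ∀ d t {L : List V} {τ : Fin k → V → V} → State L τ → length L ≡ 2 * t → length (singles L τ) ≤ d →
        ball₆ k 2 + d * (κ * 2 + κ * 2) < length (cleanDoubles L τ) →
        (∀ t′ {L′ : List V} {τ′ : Fin k → V → V} → State L′ τ′ → length L′ ≡ 2 * t′ → singles L′ τ′ ≡ [] →
          length (cleanDoubles L τ) ≤ length (cleanDoubles L′ τ′) + d * (κ * 2 + κ * 2) → length L′ ≤ length L → Solvable L′ τ′) →
        Solvable L τ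
      merge d t {L} {τ} s len few many cont with singles L τ in eq
      ... | [] = cont t s len eq (m≤m+n _ _) ≤-refl
      -- The two matchings differ at v = τ g (τ f u) as well, so no double edge ends at u or v and
      -- joining them creates no new difference. Neither τ f nor τ g joins u to v; only a third
      -- matching can be in the way.
      merge (suc d) t {L} {τ} s len few many cont | u ∷ us with valid? τ u (τ g (τ f u))
      ... | yes val = finish (halve-child t s len u∈ v∈ u≢v)
        where
        open State s
        u∈s : u ∈ singles L τ
        u∈s = subst (u ∈_) (sym eq) (here refl)
        u∈ = proj₁ (∈-singles⁻ {L} {τ} u∈s)
        nu = proj₂ (∈-singles⁻ {L} {τ} u∈s)
        v = τ g (τ f u)
        v∈ = closed g (closed f u∈)
        u≢v : u ≢ v
        u≢v e = nu (sym (flip (matching g) (sym e)))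
        s′ = state-switch s u∈ v∈ u≢v val
        nv : τ f v ≢ τ g v
        nv e = u≢v (injective (matching f) (sym (trans e (invol (matching g) (τ f u)))))
        fewer : length (singles (delete u v L) (switchAll τ u v)) ≤ d
        fewer = ≤-pred (≤-trans (s≤s (unique-⊆-length _≟_ (Unique.filter⁺ _ (State.unique s′)) sub))
            (≤-trans (≤-reflexive (length-∖ _≟_ (Unique.filter⁺ _ unique) u∈s)) (subst (λ z → length z ≤ suc d) (sym eq) few)))
          where
          sub : ∀ {x} → x ∈ singles (delete u v L) (switchAll τ u v) → x ∈ _∖_ _≟_ (singles L τ) u
          sub {x} x∈ with ∈-singles⁻ {delete u v L} {switchAll τ u v} x∈
          ... | x∈′ , nx with ∈-delete⁻ L x∈′
          ... | x∈L , p , q = ∈-∖⁺ _≟_ (∈-singles⁺ {L} {τ} x∈L (λ e → nx (still-double matching p q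
              (λ r → nv (trans (sym r) (sym (flip (matching g) (trans (sym e) (flip (matching f) (sym r)))))))
              (λ r → nv (trans (flip (matching f) (trans e (flip (matching g) (sym r)))) r)) nu e))) p
        finish : (∃[ t′ ] t ≡ suc t′ × length (delete u v L) ≡ 2 * t′) → Solvable L τ
        finish (t′ , refl , len′) = solvable-move s u∈ v∈ u≢v val (merge d t′ s′ len′ fewer
          (+-cancelʳ-≤ (κ * 2) _ _ (≤-trans (≤-trans (≤-reflexive (cong suc (+-assoc (ball₆ k 2) (d * c) (κ * 2))))
              (s≤s (+-monoʳ-≤ (ball₆ k 2) (≤-trans (+-monoʳ-≤ (d * c) (m≤m+n (κ * 2) (κ * 2))) (≤-reflexive (+-comm (d * c) c)))))) (≤-trans many (cleanDoubles-move s u v))))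
          (λ t″ s″ l″ none le lL → cont t″ s″ l″ none
            (≤-trans (cleanDoubles-move s u v) (≤-trans (+-monoˡ-≤ (κ * 2) le) (≤-trans (≤-reflexive (+-assoc _ (d * c) (κ * 2)))
              (+-monoʳ-≤ _ (≤-trans (+-monoʳ-≤ (d * c) (m≤m+n (κ * 2) (κ * 2))) (≤-reflexive (+-comm (d * c) c)))))))
            (≤-trans lL (≤-trans (m≤n+m _ 2) (≤-reflexive (length-delete unique u∈ v∈ u≢v))))))
          where c = κ * 2 + κ * 2
      merge (suc d) t {L} {τ} s len few many cont | u ∷ us | no ¬val
        with pick _≟_ (ball τ 6 (u ∷ τ g (τ f u) ∷ [])) (Unique.filter⁺ (λ w → (τ f w ≟ τ g w) ×-dec ¬? (overlap? o? τ w)) (State.unique s))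
               (≤-trans (s≤s (≤-trans (≤-reflexive (length-ball₆ τ (u ∷ τ g (τ f u) ∷ []))) (m≤m+n _ _))) many)
      ... | a , a∈c , a∉ = finish (halve-child t s len u∈ a∈ u≢a)
        where
        open State s
        mf = matching f
        mg = matching g
        u∈s : u ∈ singles L τ
        u∈s = subst (u ∈_) (sym eq) (here refl)
        u∈ = proj₁ (∈-singles⁻ {L} {τ} u∈s)
        nu = proj₂ (∈-singles⁻ {L} {τ} u∈s)
        v = τ g (τ f u)
        v∈ = closed g (closed f u∈)
        u≢v : u ≢ v
        u≢v e = nu (sym (flip mg (sym e)))
        a∈ = proj₁ (∈-clean⁻ {L} {τ} a∈c)
        da = proj₁ (proj₂ (∈-clean⁻ {L} {τ} a∈c))
        ca = proj₂ (proj₂ (∈-clean⁻ {L} {τ} a∈c))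
        far : Far τ (u ∷ v ∷ []) 6 a
        far = a∉ ∘ near⇒∈ball
        near-u : ∀ {r} → Near τ (u ∷ v ∷ []) r u
        near-u = base (here refl)
        near-v : ∀ {r} → Near τ (u ∷ v ∷ []) r v
        near-v = base (there (here refl))
        fstep : ∀ {r w} i → Far τ (u ∷ v ∷ []) (suc r) w → Far τ (u ∷ v ∷ []) r (τ i w)
        fstep = far-step matching
        u≢a : u ≢ a
        u≢a e = far (subst (Near τ (u ∷ v ∷ []) 6) e near-u)
        v≢a : v ≢ a
        v≢a e = far (subst (Near τ (u ∷ v ∷ []) 6) e near-v)
        val : Valid τ u a
        val i e = far (subst (Near τ (u ∷ v ∷ []) 6) e (step i near-u))
        τ′ = switchAll τ u a
        L′ = delete u a L
        s′ = state-switch s u∈ a∈ u≢a val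
        m′ = State.matching s′
        w = τ f a
        w-far : Far τ (u ∷ v ∷ []) 5 w
        w-far = fstep f far
        w≢v : w ≢ v
        w≢v = far-near-≢ w-far near-v
        f-w : τ′ f w ≡ τ f u
        f-w = switch-τv mf u≢a (val f)
        g-w : τ′ g w ≡ τ g u
        g-w = trans (cong (τ′ g) da) (switch-τv mg u≢a (val g))
        w∈ : w ∈ L′
        w∈ = ∈-delete⁺ (closed f a∈) (far-near-≢ w-far near-u) (nofix mf a)
        v∈′ : v ∈ L′
        v∈′ = ∈-delete⁺ v∈ (≢-sym u≢v) v≢a
        f-v : τ′ f v ≡ τ f v
        f-v = switch-away (τ f) (≢-sym u≢v) v≢a (nofix mg (τ f u)) (≢-sym w≢v)
        g-v : τ′ g v ≡ τ f u
        g-v = trans (switch-away (τ g) (≢-sym u≢v) v≢a (λ e → nofix mf u (injective mg e)) (λ e → w≢v (trans da (sym e)))) (invol mg (τ f u))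
        nv′ : τ′ f v ≢ τ′ g v
        nv′ e = u≢v (injective mf (sym (trans (sym f-v) (trans e g-v))))
        nw′ : τ′ f w ≢ τ′ g w
        nw′ e = nu (trans (sym f-w) (trans e g-w))
        val′ : Valid τ′ w v
        val′ i e with i Fin.≟ f | i Fin.≟ g
        ... | yes refl | _ = nofix mg (τ f u) (sym (trans (sym f-w) e))
        ... | no _ | yes refl = nofix mf u (injective mg (sym (trans (sym g-w) e)))
        -- The double edge aw is clean, so τ i a differs from w and the third matching at w is
        -- unchanged; it leads to a vertex far from v.
        ... | no i≢f | no i≢g = far-near-≢ (fstep i w-far) near-v (trans (sym
          (switch-away (τ i) (far-near-≢ w-far near-u) (nofix mf a) (far-near-≢ w-far (step i near-u))
            (λ r → ca (f , i , (≢-sym i≢f , (λ where (_ , q) → i≢g q) , (λ where (p , _) → f≢g p)) , r)))) e)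
        s″ = state-switch s′ w∈ v∈′ w≢v val′
        τ″ = switchAll τ′ w v
        L″ = delete w v L′
        fewer : length (singles L″ τ″) ≤ d
        fewer = ≤-pred (≤-trans (s≤s (unique-⊆-length _≟_ (Unique.filter⁺ _ (State.unique s″)) sub))
            (≤-trans (≤-reflexive (length-∖ _≟_ (Unique.filter⁺ _ unique) u∈s)) (subst (λ z → length z ≤ suc d) (sym eq) few)))
          where
          sub : ∀ {x} → x ∈ singles L″ τ″ → x ∈ _∖_ _≟_ (singles L τ) u
          sub {x} x∈ with ∈-singles⁻ {L″} {τ″} x∈
          ... | x∈″ , nx with ∈-delete⁻ L′ x∈″
          ... | x∈′ , x≢w , x≢v with ∈-delete⁻ L x∈′
          ... | x∈L , x≢u , x≢a = ∈-∖⁺ _≟_ (∈-singles⁺ {L} {τ} x∈L λ e →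
              let e′ = still-double matching x≢u x≢a x≢w (λ r → x≢w (trans r (sym da))) nu e in
              nx (still-double m′ x≢w x≢v
                (λ r → nv′ (trans (sym r) (sym (flip (m′ g) {x} {v} (trans (sym e′) (flip (m′ f) {v} {x} (sym r)))))))
                (λ r → nv′ (trans (flip (m′ f) {x} {v} (trans e′ (flip (m′ g) {v} {x} (sym r)))) r)) nw′ e′)) x≢u
        c = κ * 2 + κ * 2
        loses : length (cleanDoubles L τ) ≤ length (cleanDoubles L″ τ″) + c
        loses = ≤-trans (cleanDoubles-move s u a) (≤-trans (+-monoˡ-≤ (κ * 2) (cleanDoubles-move s′ w v)) (≤-reflexive (+-assoc _ (κ * 2) (κ * 2))))
        finish : (∃[ t′ ] t ≡ suc t′ × length L′ ≡ 2 * t′) → Solvable L τ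
        finish (t′ , refl , len′) with halve-child t′ s′ len′ w∈ v∈′ w≢v
        ... | t″ , refl , len″ = solvable-move s u∈ a∈ u≢a val (solvable-move s′ w∈ v∈′ w≢v val′ (merge d t″ s″ len″ fewer
          (+-cancelʳ-≤ c _ _ (≤-trans (≤-reflexive (cong suc (trans (+-assoc (ball₆ k 2) (d * c) c) (cong (ball₆ k 2 +_) (+-comm (d * c) c))))) (≤-trans many loses)))
          (λ t‴ {L‴} {τ‴} s‴ l‴ none le lL → cont t‴ s‴ l‴ none
            (≤-trans loses (≤-trans (+-monoˡ-≤ c le) (≤-reflexive (trans (+-assoc _ (d * c) c) (cong (length (cleanDoubles L‴ τ‴) +_) (+-comm (d * c) c))))))
            (≤-trans lL (≤-trans (m≤n+m _ 2) (≤-trans (≤-reflexive (length-delete (State.unique s′) w∈ v∈′ w≢v))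
              (≤-trans (m≤n+m _ 2) (≤-reflexive (length-delete unique u∈ a∈ u≢a)))))))))
      merge zero t s len () many cont | u ∷ us

      private
        -- At most `ball₃ k` differing vertices are merged, with at most two moves each, and a move
        -- spoils at most 2(k+1) clean doubles.
        loss = ball₃ k * (κ * 2 + κ * 2)

      -- Once many double edges are protected and nearly everything else is used up, only boundedly
      -- many differences remain to be merged. The clean doubles that survive bound the remaining
      -- size from below, and all other coincidences are confined to the few vertices that are not
      -- clean doubles.
      reduce : ∀ j t {L : List V} {τ : Fin k → V → V} → State L τ → length L ≡ 2 * t → overlapped o? L τ ≡ [] →
        ball₆ k (3 + (j * 2 + 0)) + 2 * (κ * 2) + 2 * (j * cost) < 2 * t → ball₆ k 2 + loss < j * 2 →
        (∀ t′ {L′ : List V} {τ′ : Fin k → V → V} → State L′ τ′ → length L′ ≡ 2 * t′ → singles L′ τ′ ≡ [] →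
          j * 2 ≤ length L′ + loss → length (overlapped o? L′ τ′) ≤ ball₃ k + loss → Solvable L′ τ′) →
        Solvable L τ
      reduce j t s len none big enough cont = grow-many j t s len protected-[] none big
        λ t₁ {L₁} {τ₁} {P} s₁ len₁ pr₁ none₁ lP₀ →
          let lP = trans lP₀ (+-identityʳ (j * 2)) in
          shrink t₁ s₁ len₁ pr₁ λ t₂ {L₂} {τ₂} s₂ len₂ pr₂ small →
            let P≤ = P≤clean pr₂ in
            merge (ball₃ k) t₂ s₂ len₂ (few-singles s₂ pr₂ small) (≤-trans enough (≤-trans (≤-reflexive (sym lP)) P≤))
              λ t₃ {L₃} {τ₃} s₃ len₃ no le L≤ → cont t₃ s₃ len₃ no
                (≤-trans (≤-trans (≤-reflexive (sym lP)) P≤) (≤-trans le (+-monoˡ-≤ loss (unique-⊆-length _≟_ (Unique.filter⁺ _ (State.unique s₃)) (proj₁ ∘ ∈-clean⁻ {L₃} {τ₃})))))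
                (few-overlaps s₃ (≤-trans L≤ (≤-trans small (≤-trans (+-monoˡ-≤ (ball₃ k) (≤-trans P≤ le))
                  (≤-reflexive (trans (+-assoc _ loss (ball₃ k)) (cong (length (cleanDoubles L₃ τ₃) +_) (+-comm loss (ball₃ k)))))))))
        where
        P≤clean : ∀ {L : List V} {τ : Fin k → V → V} {P} → Protected L τ P → length P ≤ length (cleanDoubles L τ)
        P≤clean {L} {τ} pr = unique-⊆-length _≟_ P-unique (λ x∈ → ∈-clean⁺ {L} {τ} (inside x∈) (double x∈) (clean x∈))
          where open Protected pr
        few-singles : ∀ {L : List V} {τ : Fin k → V → V} {P} → State L τ → Protected L τ P → length L ≤ length P + ball₃ k →
          length (singles L τ) ≤ ball₃ k
        few-singles {L} {τ} {P} s pr small = +-cancelˡ-≤ (length P) _ _ (≤-trans (≤-reflexive (sym (length-++ P)))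
            (≤-trans (unique-⊆-length _≟_ (Unique.++⁺ P-unique (Unique.filter⁺ _ (State.unique s)) apart) sub) small))
          where
          open Protected pr
          apart : ∀ {x} → ¬ (x ∈ P × x ∈ singles L τ)
          apart (x∈ , x∈′) = proj₂ (∈-singles⁻ {L} {τ} x∈′) (double x∈)
          sub : ∀ {x} → x ∈ P ++ singles L τ → x ∈ L
          sub x∈ with ∈-++⁻ P x∈
          ... | inj₁ p = inside p
          ... | inj₂ q = proj₁ (∈-singles⁻ {L} {τ} q)
        few-overlaps : ∀ {L : List V} {τ : Fin k → V → V} → State L τ → length L ≤ length (cleanDoubles L τ) + (ball₃ k + loss) →
          length (overlapped o? L τ) ≤ ball₃ k + loss
        few-overlaps {L} {τ} s le = +-cancelˡ-≤ (length (cleanDoubles L τ)) _ _ (≤-trans (≤-reflexive (sym (length-++ (cleanDoubles L τ))))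
            (≤-trans (unique-⊆-length _≟_ (Unique.++⁺ (Unique.filter⁺ _ (State.unique s)) (Unique.filter⁺ _ (State.unique s)) apart) sub) le))
          where
          apart : ∀ {x} → ¬ (x ∈ cleanDoubles L τ × x ∈ overlapped o? L τ)
          apart (x∈ , x∈′) = proj₂ (proj₂ (∈-clean⁻ {L} {τ} x∈)) (proj₂ (∈-filter⁻ (overlap? o? τ) {xs = L} x∈′))
          sub : ∀ {x} → x ∈ cleanDoubles L τ ++ overlapped o? L τ → x ∈ L
          sub x∈ with ∈-++⁻ (cleanDoubles L τ) x∈
          ... | inj₁ p = proj₁ (∈-clean⁻ {L} {τ} p)
          ... | inj₂ q = proj₁ (∈-filter⁻ (overlap? o? τ) {xs = L} q)

  none⇒¬ : ∀ {n k} {R : Fin k → Fin k → Set} (R? : Decidable R) {L : List (Fin n)} {τ : Fin k → Fin n → Fin n} →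
    overlapped R? L τ ≡ [] → ∀ {x} → x ∈ L → ¬ Overlap R τ x
  none⇒¬ R? {L} {τ} none {x} x∈ o with subst (x ∈_) none (∈-filter⁺ (overlap? R? τ) x∈ o)
  ... | ()

  ¬⇒none : ∀ {n k} {R : Fin k → Fin k → Set} (R? : Decidable R) {L : List (Fin n)} {τ : Fin k → Fin n → Fin n} →
    (∀ {x} → x ∈ L → ¬ Overlap R τ x) → overlapped R? L τ ≡ []
  ¬⇒none R? {L} {τ} h with overlapped R? L τ in eq
  ... | [] = refl
  ... | x ∷ xs = let (x∈ , o) = ∈-filter⁻ (overlap? R? τ) {xs = L} (subst (x ∈_) (sym eq) (here refl)) in contradiction o (h x∈)

  private
    reach-tail : ∀ {n} {σ τ τ′ : Fin n → Fin n} {L : List (Fin n)} → Closed L σ → Closed L τ → (∀ {x} → x ∈ L → τ x ≡ τ′ x) →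
      ∀ {x y} → x ∈ L → Reach σ τ x y → Reach σ τ′ x y × y ∈ L
    reach-tail cσ cτ eq x∈ here = here , x∈
    reach-tail cσ cτ eq x∈ (via-σ r) = let (r′ , y∈) = reach-tail cσ cτ eq x∈ r in via-σ r′ , cσ y∈
    reach-tail {σ = σ} {τ′ = τ′} cσ cτ eq x∈ (via-τ r) = let (r′ , y∈) = reach-tail cσ cτ eq x∈ r in
      subst (Reach σ τ′ _) (sym (eq y∈)) (via-τ r′) , cτ y∈

  -- Paths that start in `L` never leave it, so each step along τ 0 can be read as a step along τ 1.
  solvable-tail : ∀ {n k} {L : List (Fin n)} {τ : Fin (suc (suc k)) → Fin n → Fin n} → State L τ →
    (∀ {x} → x ∈ L → τ zero x ≡ τ (suc zero) x) → Solvable L (τ ∘ suc) → Solvable L τ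
  solvable-tail {L = L} {τ} s eq sol o = proj₁ (sol o) , extend (proj₂ (sol o))
    where
    extend : ∀ {e σ} → Solves L e (τ ∘ suc) σ → Solves L e τ σ
    extend p = record
      { matching = Solves.matching p ; closed = Solves.closed p ; outside = Solves.outside p
      ; connected = λ where
          (suc i) → Solves.connected p i
          zero x∈ y∈ → proj₁ (reach-tail (Solves.closed p) (State.closed s (suc zero)) (sym ∘ eq) x∈ (Solves.connected p zero x∈ y∈)) }

  Solvable-from : ℕ → ℕ → Set
  Solvable-from k m = ∀ {n} t {L : List (Fin n)} {τ : Fin k → Fin n → Fin n} → State L τ → length L ≡ 2 * t →
    overlapped _≢?_ L τ ≡ [] → m ≤ t → Solvable L τ

  solvable-repaired : ∀ {k m} → Solvable-from (suc k) m → ∀ o t {n} {L : List (Fin n)} {τ : Fin (suc k) → Fin n → Fin n} →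
    State L τ → length L ≡ 2 * t → defect L τ ≤ o → ball₆ (suc k) 1 + 2 * o < 2 * t → m + o ≤ t → Solvable L τ
  solvable-repaired {m = m} h o t s len d≤o big le = repair o t s len protected-[] d≤o big
    λ t′ s′ len′ _ none t≤ → h t′ s′ len′ none (+-cancelʳ-≤ o m t′ (≤-trans le t≤))
    where open Merge zero zero _≢?_

  -- The first two matchings are merged into one; the boundedly many coincidences this leaves among
  -- the others are repaired, and the induction hypothesis for one matching fewer applies.
  solvable : ∀ k → ∃[ m ] Solvable-from k m
  solvable zero = 0 , λ t s len _ _ → solvable-few z≤n t s len
  solvable (suc zero) = 0 , λ t s len _ _ → solvable-few ≤-refl t s len
  solvable (suc (suc k)) with solvable (suc k)
  ... | m , ih = suc X , λ t {L} {τ} s len none le → reduce j t s len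
        (¬⇒none (other? zero (suc zero)) {L} {τ} λ x∈ (i , l , (i≢l , _) , e) → none⇒¬ _≢?_ {L} {τ} none x∈ (i , l , i≢l , e))
        (≤-trans le (m≤m+n t (t + 0))) enough
        λ t′ {L′} {τ′} s′ len′ no-single long ov≤ →
          solvable-tail s′ (λ {x} x∈ → all-double s′ no-single x∈)
            (solvable-repaired {m = m} ih o t′ (tail s′) len′ (≤-trans (tail-overlap s′) ov≤)
              (big₁ t′ (≤-trans long (+-monoˡ-≤ loss (≤-reflexive len′)))) (big₂ t′ (≤-trans long (+-monoˡ-≤ loss (≤-reflexive len′)))))
    where
    K = suc (suc k)
    κ = suc K
    loss = ball₃ K * (κ * 2 + κ * 2)
    o = ball₃ K + loss
    -- Room for `merge`, for `repair` and for the induction hypothesis, in this order; `j` adds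
    -- `loss`, since merging may spoil that many of the doubles grown before.
    need = suc (ball₆ K 2) + suc (ball₆ (suc k) 1 + 2 * o) + 2 * (m + o)
    j = need + loss
    X = ball₆ K (3 + (j * 2 + 0)) + 2 * (κ * 2) + 2 * (j * (3 + κ * 2))
    module M {n} = Merged {n} {K} zero (suc zero) (λ ())
    open M using (reduce; singles)
    need≤ : need + loss ≤ j * 2
    need≤ = ≤-trans (m≤m+n j (j + 0)) (≤-reflexive (*-comm 2 j))
    enough : ball₆ K 2 + loss < j * 2
    enough = ≤-trans (+-monoˡ-≤ loss (≤-trans (m≤m+n (suc (ball₆ K 2)) (suc (ball₆ (suc k) 1 + 2 * o))) (m≤m+n _ (2 * (m + o))))) need≤
    need≤2t : ∀ t′ → j * 2 ≤ 2 * t′ + loss → need ≤ 2 * t′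
    need≤2t t′ h = +-cancelʳ-≤ loss _ _ (≤-trans need≤ h)
    big₁ : ∀ t′ → j * 2 ≤ 2 * t′ + loss → ball₆ (suc k) 1 + 2 * o < 2 * t′
    big₁ t′ h = ≤-trans (≤-trans (m≤n+m (suc (ball₆ (suc k) 1 + 2 * o)) (suc (ball₆ K 2))) (m≤m+n _ (2 * (m + o)))) (need≤2t t′ h)
    big₂ : ∀ t′ → j * 2 ≤ 2 * t′ + loss → m + o ≤ t′
    big₂ t′ h = *-cancelˡ-≤ 2 (≤-trans (m≤n+m (2 * (m + o)) (suc (ball₆ K 2) + suc (ball₆ (suc k) 1 + 2 * o))) (need≤2t t′ h))
    tail : ∀ {n} {L : List (Fin n)} {τ : Fin K → Fin n → Fin n} → State L τ → State L (τ ∘ suc)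
    tail s = record { unique = unique ; matching = matching ∘ suc ; closed = λ i → closed (suc i) ; outer = outer }
      where open State s
    all-double : ∀ {n} {L : List (Fin n)} {τ : Fin K → Fin n → Fin n} → State L τ → singles L τ ≡ [] → ∀ {x} → x ∈ L → τ zero x ≡ τ (suc zero) x
    all-double {L = L} {τ} s none {x} x∈ with τ zero x ≟ τ (suc zero) x
    ... | yes p = p
    ... | no ¬p with subst (x ∈_) none (∈-filter⁺ (λ w → ¬? (τ zero w ≟ τ (suc zero) w)) x∈ ¬p)
    ...   | ()
    tail-overlap : ∀ {n} {L : List (Fin n)} {τ : Fin K → Fin n → Fin n} → State L τ →
      defect L (τ ∘ suc) ≤ length (overlapped (other? zero (suc zero)) L τ)
    tail-overlap {L = L} {τ} s = unique-⊆-length _≟_ (Unique.filter⁺ _ (State.unique s)) λ {x} x∈ →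
      let (x∈L , (i , l , i≢l , e)) = ∈-filter⁻ (overlap? _≢?_ (τ ∘ suc)) {xs = L} x∈ in
      ∈-filter⁺ (overlap? (other? zero (suc zero)) τ) x∈L
        (suc i , suc l , ((λ e′ → i≢l (Fin.suc-injective e′)) , (λ where (() , _)) , (λ where (_ , ()))) , e)

-- A size at which the recursion can be stopped.

module Threshold where

  open Switching
  open Counting
  open Overlaps
  open Bounds
  open Theta
  open Merging
  open Existence
  open import Data.Nat hiding (_≟_)
  open import Data.Nat.Properties hiding (_≟_)
  open import Data.Nat.Tactic.RingSolver
  open import Data.Fin using (Fin)
  open import Data.List using (List; length)
  open import Data.Product using (_×_; _,_; proj₁; proj₂; ∃-syntax)
  open import Relation.Binary.PropositionalEquality

  -- Besides the demands of `Large`, the summand `ball₆ k 1` and twice the bound of `solvable` leave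
  -- room to repair the fewer than (t₀ + γ)/2 coincidences that a state at the bottom of the
  -- recursion may still have.
  threshold : ℕ → ℕ
  threshold k = suc (γ-of k) + (2 + 2 * jumpExp k + 3 * k) + ball₆ k 1 + 2 * proj₁ (solvable k)

  threshold-large : ∀ k → Large k (threshold k)
  threshold-large k = record
    { γ<t₀ = ≤-trans (m≤m+n (suc (γ-of k)) B′) (≤-trans (m≤m+n _ (ball₆ k 1)) (m≤m+n _ (2 * proj₁ (solvable k))))
    ; jump≤t₀ = ≤-trans (m≤n+m B′ (suc (γ-of k))) (≤-trans (m≤m+n _ (ball₆ k 1)) (m≤m+n _ (2 * proj₁ (solvable k)))) }
    where B′ = 2 + 2 * jumpExp k + 3 * k

  threshold-solvable : ∀ k → Solvable-at k (threshold k)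
  threshold-solvable zero {L = L} {τ} s len _ = solvable⇒count (threshold 0) s len
    (proj₂ (solvable 0) (threshold 0) s len (¬⇒none _≢?_ {L} {τ} λ _ → λ where (() , _)) z≤n)
  threshold-solvable (suc k) {L = L} {τ} s len small = solvable⇒count t₀ s len
    (solvable-repaired {m = m} (proj₂ (solvable (suc k))) (defect L τ) t₀ s len ≤-refl
      (≤-trans (≤-reflexive (sym (+-suc B (2 * defect L τ)))) (≤-trans (+-monoʳ-≤ B small)
        (≤-trans (≤-reflexive (swap B t₀ γ)) (≤-trans (+-monoʳ-≤ t₀ B+γ≤) (≤-reflexive (cong (t₀ +_) (sym (+-identityʳ t₀))))))))
      (*-cancelˡ-≤ 2 (≤-trans (≤-reflexive (*-distribˡ-+ 2 m _)) (≤-trans (+-monoʳ-≤ (2 * m) (<⇒≤ small))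
        (≤-trans (≤-reflexive (swap (2 * m) t₀ γ)) (≤-trans (+-monoʳ-≤ t₀ m+γ≤) (≤-reflexive (cong (t₀ +_) (sym (+-identityʳ t₀))))))))))
    where
    t₀ = threshold (suc k)
    γ = γ-of (suc k)
    B = ball₆ (suc k) 1
    m = proj₁ (solvable (suc k))
    B′ = 2 + 2 * jumpExp (suc k) + 3 * suc k
    swap : ∀ a b c → a + (b + c) ≡ b + (a + c)
    swap = solve-∀
    regroup : ∀ γ B′ B m → suc γ + B′ + B + m ≡ B + γ + (suc B′ + m)
    regroup = solve-∀
    regroup′ : ∀ γ B′ B m → suc γ + B′ + B + m ≡ m + γ + (suc B′ + B)
    regroup′ = solve-∀
    B+γ≤ : B + γ ≤ t₀
    B+γ≤ = ≤-trans (m≤m+n _ _) (≤-reflexive (sym (regroup γ B′ B (2 * m))))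
    m+γ≤ : 2 * m + γ ≤ t₀
    m+γ≤ = ≤-trans (m≤m+n _ _) (≤-reflexive (sym (regroup′ γ B′ B (2 * m))))

  k<threshold : ∀ k → suc k ≤ threshold k
  k<threshold k = below (jumpExp k) k (Large.jump≤t₀ (threshold-large k))
    where
    below : ∀ j k {t} → 2 + 2 * j + 3 * k ≤ t → suc k ≤ t
    below j k h = ≤-trans (≤-trans (s≤s (≤-trans (m≤m+n k (suc (2 * j + 2 * k))) (≤-reflexive (e j k)))) (≤-reflexive (+-assoc 2 (2 * j) (3 * k)))) h
      where
      e : ∀ j k → k + suc (2 * j + 2 * k) ≡ suc (2 * j + 3 * k)
      e = solve-∀

  -- The number of solutions is comparable to the product of the numbers of options, for 2(d + t₀) vertices.
  Comparable : (k t₀ C : ℕ) → Set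
  Comparable k t₀ C = ∀ d {n} {L : List (Fin n)} {τ : Fin k → Fin n → Fin n} → State L τ → length L ≡ 2 * (d + t₀) →
    4 * suc k * defect L τ ≤ d + t₀ →
    optionsProduct k t₀ d ≤ C * count (d + t₀) L τ × count (d + t₀) L τ ≤ C * optionsProduct k t₀ d

  comparable : ∀ {k t₀} → Large k t₀ → Solvable-at k t₀ → ∃[ C ] Comparable k t₀ C
  comparable {k} {t₀} large solv = A + B , λ d {n} {L} {τ} s len small →
    ≤-trans (lower-Θ large solv d s len small) (*-monoˡ-≤ (count (d + t₀) L τ) (m≤m+n A B)) ,
    ≤-trans (upper-Θ large solv d s len small) (*-monoˡ-≤ (optionsProduct k t₀ d) (m≤n+m B A))
    where
    A = 2 * suc (γ-of k)
    B = 2 * (5 * (t₀ * doubleFactorial t₀)) + 2 * (doubleFactorial t₀ * 3 ^ t₀)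

  threshold-comparable : ∀ k → ∃[ C ] Comparable k (threshold k) C
  threshold-comparable k = comparable (threshold-large k) (threshold-solvable k)

-- Two-sided integer estimates for e and e².

module Stirling where

  open Potential using (^-distribʳ-*)
  open import Data.Nat
  open import Data.Nat.Properties
  open import Data.Nat.Tactic.RingSolver
  open import Relation.Nullary using (yes; no; contradiction)
  open import Relation.Binary.PropositionalEquality
  open ≤-Reasoning

  -- i! times the partial sum of the exponential series.
  expNumerator : ℕ → ℕ
  expNumerator zero = 1
  expNumerator (suc i) = suc i * expNumerator i + 1

  private
    rising falling : ℕ → ℕ → ℕ
    rising zero M = 1
    rising (suc j) M = M * rising j (suc M)
    falling zero M = 1
    falling (suc j) zero = 0
    falling (suc j) (suc M) = suc M * falling j M

    rising-last : ∀ j M → rising (suc j) M ≡ rising j M * (M + j)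
    rising-last zero M = trans (*-identityʳ M) (trans (sym (+-identityʳ M)) (sym (*-identityˡ (M + 0))))
    rising-last (suc j) M = trans (cong (M *_) (rising-last j (suc M)))
      (trans (sym (*-assoc M _ _)) (cong (M * rising j (suc M) *_) (sym (+-suc M j))))

    rising-diff : ∀ j M → rising (suc j) (suc M) ≡ rising (suc j) M + suc j * rising j (suc M)
    rising-diff j M = trans (rising-last j (suc M)) (e (rising j (suc M)) M j)
      where
      e : ∀ r M j → r * (suc M + j) ≡ M * r + suc j * r
      e = solve-∀

    falling-last : ∀ j M → j ≤ M → falling (suc j) M ≡ falling j M * (M ∸ j)
    falling-last zero zero _ = refl
    falling-last zero (suc M) _ = trans (*-identityʳ _) (sym (*-identityˡ _))
    falling-last (suc j) (suc M) (s≤s p) = trans (cong (suc M *_) (falling-last j M p)) (sym (*-assoc (suc M) (falling j M) (M ∸ j)))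

    falling-zero : ∀ j M → M < j → falling j M ≡ 0
    falling-zero (suc j) zero _ = refl
    falling-zero (suc j) (suc M) (s≤s p) = trans (cong (suc M *_) (falling-zero j M p)) (*-zeroʳ (suc M))

    falling-diff : ∀ j M → falling (suc j) (suc M) ≡ falling (suc j) M + suc j * falling j M
    falling-diff j M with j ≤? M
    ... | yes p = trans (cong (λ z → suc z * falling j M) (sym (m∸n+n≡m p)))
        (trans (e (falling j M) (M ∸ j) j) (cong (_+ suc j * falling j M) (sym (falling-last j M p))))
      where
      e : ∀ r d j → suc (d + j) * r ≡ r * d + suc j * r
      e = solve-∀
    ... | no ¬p rewrite falling-zero j M (≰⇒> ¬p) | falling-zero (suc j) M (≤-trans (≰⇒> ¬p) (n≤1+n j)) =
      trans (*-zeroʳ (suc M)) (sym (*-zeroʳ (suc j)))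

    rising≥ : ∀ j {D M} → D ≤ M → D ^ j ≤ rising j M
    rising≥ zero _ = ≤-refl
    rising≥ (suc j) p = *-mono-≤ p (rising≥ j (≤-trans p (n≤1+n _)))

    falling≤ : ∀ j {D M} → M ≤ D → falling j M ≤ D ^ j
    falling≤ zero _ = ≤-refl
    falling≤ (suc j) {M = zero} _ = z≤n
    falling≤ (suc j) {M = suc M} p = *-mono-≤ p (falling≤ j (≤-trans (n≤1+n M) p))

    -- i! Dⁱ times the partial sums of the series of (1 - 1/D)^(-M) and (1 + 1/D)^M.
    negBinomial binomial : ℕ → ℕ → ℕ → ℕ
    negBinomial D zero M = 1
    negBinomial D (suc i) M = suc i * D * negBinomial D i M + rising (suc i) M
    binomial D zero M = 1
    binomial D (suc i) M = suc i * D * binomial D i M + falling (suc i) M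

    negBinomial-step : ∀ D i M → negBinomial D (suc i) (suc M) ≡ negBinomial D (suc i) M + suc i * negBinomial D i (suc M)
    negBinomial-step D zero M = trans (cong (suc zero * D * 1 +_) (rising-diff zero M)) (sym (+-assoc (suc zero * D * 1) (rising 1 M) _))
    negBinomial-step D (suc i) M = begin-equality
      suc (suc i) * D * negBinomial D (suc i) (suc M) + rising (suc (suc i)) (suc M)
        ≡⟨ cong₂ (λ a b → suc (suc i) * D * a + b) (negBinomial-step D i M) (rising-diff (suc i) M) ⟩
      suc (suc i) * D * (negBinomial D (suc i) M + suc i * negBinomial D i (suc M)) + (rising (suc (suc i)) M + suc (suc i) * rising (suc i) (suc M))
        ≡⟨ e i D (negBinomial D (suc i) M) (negBinomial D i (suc M)) (rising (suc (suc i)) M) (rising (suc i) (suc M)) ⟩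
      suc (suc i) * D * negBinomial D (suc i) M + rising (suc (suc i)) M + suc (suc i) * (suc i * D * negBinomial D i (suc M) + rising (suc i) (suc M)) ∎
      where
      e : ∀ i D a b c d → suc (suc i) * D * (a + suc i * b) + (c + suc (suc i) * d) ≡ suc (suc i) * D * a + c + suc (suc i) * (suc i * D * b + d)
      e = solve-∀

    binomial-step : ∀ D i M → binomial D (suc i) (suc M) ≡ binomial D (suc i) M + suc i * binomial D i M
    binomial-step D zero M = trans (cong (suc zero * D * 1 +_) (falling-diff zero M)) (sym (+-assoc (suc zero * D * 1) (falling 1 M) _))
    binomial-step D (suc i) M = begin-equality
      suc (suc i) * D * binomial D (suc i) (suc M) + falling (suc (suc i)) (suc M)
        ≡⟨ cong₂ (λ a b → suc (suc i) * D * a + b) (binomial-step D i M) (falling-diff (suc i) M) ⟩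
      suc (suc i) * D * (binomial D (suc i) M + suc i * binomial D i M) + (falling (suc (suc i)) M + suc (suc i) * falling (suc i) M)
        ≡⟨ e i D (binomial D (suc i) M) (binomial D i M) (falling (suc (suc i)) M) (falling (suc i) M) ⟩
      suc (suc i) * D * binomial D (suc i) M + falling (suc (suc i)) M + suc (suc i) * (suc i * D * binomial D i M + falling (suc i) M) ∎
      where
      e : ∀ i D a b c d → suc (suc i) * D * (a + suc i * b) + (c + suc (suc i) * d) ≡ suc (suc i) * D * a + c + suc (suc i) * (suc i * D * b + d)
      e = solve-∀

    -- Multiplying the truncated series for M + 1 by 1 - 1/D gives that for M minus the contribution
    -- of the last term, which is nonnegative.
    negBinomial-shrink : ∀ d i M → d * negBinomial (suc d) i (suc M) ≤ suc d * negBinomial (suc d) i M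
    negBinomial-shrink d zero M = *-monoˡ-≤ 1 (n≤1+n d)
    negBinomial-shrink d (suc i) M = +-cancelˡ-≤ (negBinomial D (suc i) (suc M)) _ _ (begin
      D * negBinomial D (suc i) (suc M)     ≡⟨ cong (D *_) (negBinomial-step D i M) ⟩
      D * (negBinomial D (suc i) M + suc i * negBinomial D i (suc M)) ≡⟨ e D (negBinomial D (suc i) M) i (negBinomial D i (suc M)) ⟩
      suc i * D * negBinomial D i (suc M) + D * negBinomial D (suc i) M
        ≤⟨ +-monoˡ-≤ _ (m≤m+n (suc i * D * negBinomial D i (suc M)) (rising (suc i) (suc M))) ⟩
      negBinomial D (suc i) (suc M) + D * negBinomial D (suc i) M ∎)
      where
      D = suc d
      e : ∀ D a i b → D * (a + suc i * b) ≡ suc i * D * b + D * a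
      e = solve-∀

    negBinomial-zero : ∀ D i → negBinomial D i 0 ≡ i ! * D ^ i
    negBinomial-zero D zero = refl
    negBinomial-zero D (suc i) = trans (cong (λ z → suc i * D * z + 0) (negBinomial-zero D i)) (e i D (i !) (D ^ i))
      where
      e : ∀ i D f p → suc i * D * (f * p) + 0 ≡ suc i * f * (D * p)
      e = solve-∀

    binomial-zero : ∀ D i → binomial D i 0 ≡ i ! * D ^ i
    binomial-zero D zero = refl
    binomial-zero D (suc i) = trans (cong (λ z → suc i * D * z + 0) (binomial-zero D i)) (e i D (i !) (D ^ i))
      where
      e : ∀ i D f p → suc i * D * (f * p) + 0 ≡ suc i * f * (D * p)
      e = solve-∀

    negBinomial≤ : ∀ d i M → d ^ M * negBinomial (suc d) i M ≤ suc d ^ M * (i ! * suc d ^ i)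
    negBinomial≤ d i zero = +-monoˡ-≤ 0 (≤-reflexive (negBinomial-zero (suc d) i))
    negBinomial≤ d i (suc M) = begin
      d * d ^ M * negBinomial (suc d) i (suc M)      ≡⟨ e₁ d (d ^ M) _ ⟩
      d ^ M * (d * negBinomial (suc d) i (suc M))    ≤⟨ *-monoʳ-≤ (d ^ M) (negBinomial-shrink d i M) ⟩
      d ^ M * (suc d * negBinomial (suc d) i M)      ≡⟨ e₂ (d ^ M) d _ ⟩
      suc d * (d ^ M * negBinomial (suc d) i M)      ≤⟨ *-monoʳ-≤ (suc d) (negBinomial≤ d i M) ⟩
      suc d * (suc d ^ M * (i ! * suc d ^ i))        ≡⟨ *-assoc (suc d) (suc d ^ M) _ ⟨
      suc d ^ suc M * (i ! * suc d ^ i)              ∎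
      where
      e₁ : ∀ d p n → d * p * n ≡ p * (d * n)
      e₁ = solve-∀
      e₂ : ∀ p d n → p * (suc d * n) ≡ suc d * (p * n)
      e₂ = solve-∀

    negBinomial≥ : ∀ D i → D ^ i * expNumerator i ≤ negBinomial D i D
    negBinomial≥ D zero = ≤-refl
    negBinomial≥ D (suc i) = begin
      D * D ^ i * (suc i * expNumerator i + 1)               ≡⟨ e D (D ^ i) i (expNumerator i) ⟩
      suc i * D * (D ^ i * expNumerator i) + D ^ suc i       ≤⟨ +-mono-≤ (*-monoʳ-≤ (suc i * D) (negBinomial≥ D i)) (rising≥ (suc i) {D} ≤-refl) ⟩
      suc i * D * negBinomial D i D + rising (suc i) D       ∎
      where
      e : ∀ D p i x → D * p * (suc i * x + 1) ≡ suc i * D * (p * x) + D * p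
      e = solve-∀

    binomial≤ : ∀ D i → binomial D i D ≤ D ^ i * expNumerator i
    binomial≤ D zero = ≤-refl
    binomial≤ D (suc i) = begin
      suc i * D * binomial D i D + falling (suc i) D         ≤⟨ +-mono-≤ (*-monoʳ-≤ (suc i * D) (binomial≤ D i)) (falling≤ (suc i) {D} ≤-refl) ⟩
      suc i * D * (D ^ i * expNumerator i) + D ^ suc i       ≡⟨ e D (D ^ i) i (expNumerator i) ⟨
      D * D ^ i * (suc i * expNumerator i + 1)               ∎
      where
      e : ∀ D p i x → D * p * (suc i * x + 1) ≡ suc i * D * (p * x) + D * p
      e = solve-∀

    -- Unlike in `negBinomial-shrink` there is no remainder: the term of top degree vanishes when M
    -- < i.
    binomial-grow : ∀ D i M → M < i → suc D * binomial D i M ≡ D * binomial D i (suc M)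
    binomial-grow D (suc i) M (s≤s M≤i) = sym (begin-equality
      D * binomial D (suc i) (suc M)                                    ≡⟨ cong (D *_) (binomial-step D i M) ⟩
      D * (binomial D (suc i) M + suc i * binomial D i M)               ≡⟨ e D (binomial D (suc i) M) i (binomial D i M) ⟩
      (suc i * D * binomial D i M + 0) + D * binomial D (suc i) M       ≡⟨ cong (λ z → (suc i * D * binomial D i M + z) + D * binomial D (suc i) M) (falling-zero (suc i) M (s≤s M≤i)) ⟨
      suc D * binomial D (suc i) M                                      ∎)
      where
      e : ∀ D a i b → D * (a + suc i * b) ≡ suc i * D * b + 0 + D * a
      e = solve-∀

    binomial≡ : ∀ D i M → M ≤ i → suc D ^ M * (i ! * D ^ i) ≡ D ^ M * binomial D i M
    binomial≡ D i zero _ = cong (_+ 0) (sym (binomial-zero D i))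
    binomial≡ D i (suc M) p = begin-equality
      suc D * suc D ^ M * (i ! * D ^ i)          ≡⟨ *-assoc (suc D) (suc D ^ M) _ ⟩
      suc D * (suc D ^ M * (i ! * D ^ i))        ≡⟨ cong (suc D *_) (binomial≡ D i M (≤-trans (n≤1+n M) p)) ⟩
      suc D * (D ^ M * binomial D i M)           ≡⟨ e₁ D (D ^ M) (binomial D i M) ⟩
      D ^ M * (suc D * binomial D i M)           ≡⟨ cong (D ^ M *_) (binomial-grow D i M p) ⟩
      D ^ M * (D * binomial D i (suc M))         ≡⟨ e₂ D (D ^ M) (binomial D i (suc M)) ⟩
      D * D ^ M * binomial D i (suc M)           ∎
      where
      e₁ : ∀ D p b → suc D * (p * b) ≡ p * (suc D * b)
      e₁ = solve-∀
      e₂ : ∀ D p b → p * (D * b) ≡ D * p * b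
      e₂ = solve-∀

  -- With D = m + 1 the series of e is bounded term by term by that of (1 - 1/D)^(-D), because D^j ≤
  -- D(D + 1)...(D + j - 1).
  expNumerator-upper : ∀ m i → m ^ suc m * expNumerator i ≤ suc m ^ suc m * i !
  expNumerator-upper m i = *-cancelʳ-≤ _ _ (suc m ^ i) {{m^n≢0 (suc m) i}} (begin
    m ^ suc m * expNumerator i * suc m ^ i     ≡⟨ e (m ^ suc m) (expNumerator i) (suc m ^ i) ⟩
    m ^ suc m * (suc m ^ i * expNumerator i)   ≤⟨ *-monoʳ-≤ (m ^ suc m) (negBinomial≥ (suc m) i) ⟩
    m ^ suc m * negBinomial (suc m) i (suc m)  ≤⟨ negBinomial≤ m i (suc m) ⟩
    suc m ^ suc m * (i ! * suc m ^ i)          ≡⟨ *-assoc (suc m ^ suc m) _ _ ⟨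
    suc m ^ suc m * i ! * suc m ^ i            ∎)
    where
    e : ∀ a b c → a * b * c ≡ a * (c * b)
    e = solve-∀

  -- For i ≥ m the truncated binomial series of (1 + 1/m)^m is complete, and term by term it is at
  -- most the series of e.
  expNumerator-lower : ∀ m .{{_ : NonZero m}} i → m ≤ i → suc m ^ m * i ! ≤ m ^ m * expNumerator i
  expNumerator-lower m i p = *-cancelʳ-≤ _ _ (m ^ i) {{m^n≢0 m i}} (begin
    suc m ^ m * i ! * m ^ i              ≡⟨ *-assoc (suc m ^ m) _ _ ⟩
    suc m ^ m * (i ! * m ^ i)            ≡⟨ binomial≡ m i m p ⟩
    m ^ m * binomial m i m               ≤⟨ *-monoʳ-≤ (m ^ m) (binomial≤ m i) ⟩
    m ^ m * (m ^ i * expNumerator i)     ≡⟨ e (m ^ m) (m ^ i) (expNumerator i) ⟩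
    m ^ m * expNumerator i * m ^ i       ∎)
    where
    e : ∀ a b c → a * (b * c) ≡ a * c * b
    e = solve-∀

  private
    ^-square : ∀ a p → a ^ (2 * p) ≡ a ^ p * a ^ p
    ^-square a p = trans (^-distribˡ-+-* a p (p + 0)) (cong (λ z → a ^ p * a ^ z) (+-identityʳ p))

    -- (1 + 1/m)^(2p) ≤ (1 + p/m) / (1 - p/m), where m = p + d.
    cayley-upper : ∀ p d → suc (p + d) ^ (2 * p) * d ≤ (p + d) ^ (2 * p) * (p + d + p)
    cayley-upper zero d = ≤-reflexive (cong (_+ 0) (sym (+-identityʳ d)))
    cayley-upper (suc p) d = *-cancelʳ-≤ _ _ (suc d) (begin
      suc m ^ (2 * suc p) * d * suc d                      ≡⟨ cong (λ z → z * d * suc d) (split (suc m)) ⟩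
      suc m * suc m * suc m ^ (2 * p) * d * suc d          ≡⟨ e₁ (suc m) (suc m ^ (2 * p)) d ⟩
      suc m * suc m * d * (suc m ^ (2 * p) * suc d)        ≤⟨ *-monoʳ-≤ (suc m * suc m * d) ih ⟩
      suc m * suc m * d * (m ^ (2 * p) * (m + p))          ≡⟨ e₂ (suc m) d (m ^ (2 * p)) (m + p) ⟩
      m ^ (2 * p) * (suc m * suc m * (m + p) * d)          ≤⟨ *-monoʳ-≤ (m ^ (2 * p)) (≤-trans (m≤m+n _ _) (≤-reflexive (e₃ p d))) ⟩
      m ^ (2 * p) * (m * m * (m + suc p) * suc d)          ≡⟨ e₄ m (m ^ (2 * p)) (m + suc p) (suc d) ⟩
      m * m * m ^ (2 * p) * (m + suc p) * suc d            ≡⟨ cong (λ z → z * (m + suc p) * suc d) (split m) ⟨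
      m ^ (2 * suc p) * (m + suc p) * suc d                ∎)
      where
      m = suc p + d
      split : ∀ a → a ^ (2 * suc p) ≡ a * a * a ^ (2 * p)
      split a = trans (cong (a ^_) (*-suc 2 p)) (sym (*-assoc a a _))
      ih : suc m ^ (2 * p) * suc d ≤ m ^ (2 * p) * (m + p)
      ih = subst (λ z → suc z ^ (2 * p) * suc d ≤ z ^ (2 * p) * (z + p)) (+-suc p d) (cayley-upper p (suc d))
      e₁ : ∀ M q d → M * M * q * d * suc d ≡ M * M * d * (q * suc d)
      e₁ = solve-∀
      e₂ : ∀ M d q r → M * M * d * (q * r) ≡ q * (M * M * r * d)
      e₂ = solve-∀
      e₃ : ∀ p d → suc (suc p + d) * suc (suc p + d) * (suc p + d + p) * d
        + ((suc p + d) * (suc p + d) + (suc p + d) + (2 * (suc p + d) + 1) * (p * p + p))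
        ≡ (suc p + d) * (suc p + d) * (suc p + d + suc p) * suc d
      e₃ = solve-∀
      e₄ : ∀ m q r s → q * (m * m * r * s) ≡ m * m * q * r * s
      e₄ = solve-∀

    -- The first four terms of the binomial expansion of (1 + 1/m)^(2 + r), cleared of denominators
    -- by 6m³.
    bernoulli₃ : ∀ m r → m ^ (2 + r) * (6 * (m * m * m) + 6 * (2 + r) * (m * m) + 3 * (2 + r) * (1 + r) * m + (2 + r) * (1 + r) * r)
      ≤ 6 * suc m ^ (2 + r) * (m * m * m)
    bernoulli₃ m zero = ≤-reflexive (e m)
      where
      e : ∀ m → m * (m * 1) * (6 * (m * m * m) + 6 * 2 * (m * m) + 3 * 2 * 1 * m + 2 * 1 * 0)
        ≡ 6 * (suc m * (suc m * 1)) * (m * m * m)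
      e = solve-∀
    bernoulli₃ m (suc r) = begin
      m * m ^ (2 + r) * (6 * (m * m * m) + 6 * (3 + r) * (m * m) + 3 * (3 + r) * (2 + r) * m + (3 + r) * (2 + r) * (1 + r))
        ≤⟨ m≤m+n _ _ ⟩
      m * m ^ (2 + r) * (6 * (m * m * m) + 6 * (3 + r) * (m * m) + 3 * (3 + r) * (2 + r) * m + (3 + r) * (2 + r) * (1 + r)) + m ^ (2 + r) * ((2 + r) * (1 + r) * r)
        ≡⟨ e₁ m (m ^ (2 + r)) r ⟩
      suc m * (m ^ (2 + r) * (6 * (m * m * m) + 6 * (2 + r) * (m * m) + 3 * (2 + r) * (1 + r) * m + (2 + r) * (1 + r) * r))
        ≤⟨ *-monoʳ-≤ (suc m) (bernoulli₃ m r) ⟩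
      suc m * (6 * suc m ^ (2 + r) * (m * m * m))
        ≡⟨ e₂ (suc m) (suc m ^ (2 + r)) (m * m * m) ⟩
      6 * suc m ^ (3 + r) * (m * m * m) ∎
      where
      e₁ : ∀ m q r → m * q * (6 * (m * m * m) + 6 * (3 + r) * (m * m) + 3 * (3 + r) * (2 + r) * m + (3 + r) * (2 + r) * (1 + r)) + q * ((2 + r) * (1 + r) * r)
        ≡ suc m * (q * (6 * (m * m * m) + 6 * (2 + r) * (m * m) + 3 * (2 + r) * (1 + r) * m + (2 + r) * (1 + r) * r))
      e₁ = solve-∀
      e₂ : ∀ M q c → M * (6 * q * c) ≡ 6 * (M * q) * c
      e₂ = solve-∀

    -- (1 - 1/w)^x ≥ 1 - x/w, where w = suc v.
    bernoulli : ∀ v x → suc v ^ x * suc v ≤ v ^ x * suc v + suc v ^ x * x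
    bernoulli v zero = m≤m+n _ _
    bernoulli v (suc x) = begin
      w * w ^ x * w                              ≡⟨ *-assoc w (w ^ x) w ⟩
      w * (w ^ x * w)                            ≡⟨ e₀ v (w ^ x) ⟩
      v * (w ^ x * w) + w ^ x * w                ≤⟨ +-monoˡ-≤ (w ^ x * w) (*-monoʳ-≤ v (bernoulli v x)) ⟩
      v * (v ^ x * w + w ^ x * x) + w ^ x * w    ≤⟨ m≤m+n _ (w ^ x * x) ⟩
      v * (v ^ x * w + w ^ x * x) + w ^ x * w + w ^ x * x  ≡⟨ e₁ v (v ^ x) (w ^ x) x ⟩
      v * v ^ x * w + w * w ^ x * suc x          ∎
      where
      w = suc v
      e₀ : ∀ v q → suc v * (q * suc v) ≡ v * (q * suc v) + q * suc v
      e₀ = solve-∀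
      e₁ : ∀ v a b x → v * (a * suc v + b * x) + b * suc v + b * x ≡ v * a * suc v + suc v * b * suc x
      e₁ = solve-∀

    -- If A ≥ B + 1, then the hypothesis at some m > 3B gives m² ≤ (2m + 1)B ≤ 3mB < m².
    limit-≤ : ∀ A B x .{{_ : NonZero x}} → (∀ p → let m = x * suc p in m * m * A ≤ suc m * suc m * B) → A ≤ B
    limit-≤ A B x h with A ≤? B
    ... | yes q = q
    ... | no ¬q = contradiction (≤-trans (*-monoʳ-≤ (m * m) (≰⇒> ¬q)) (h (3 * B))) (<⇒≱ (begin-strict
        suc m * suc m * B           ≡⟨ e₁ m B ⟩
        m * m * B + (m * (2 * B) + B)  <⟨ +-monoʳ-< (m * m * B) lt ⟩
        m * m * B + m * m           ≡⟨ e₂ (m * m) B ⟩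
        m * m * suc B               ∎))
      where
      m = x * suc (3 * B)
      3B<m : suc (3 * B) ≤ m
      3B<m = m≤n*m (suc (3 * B)) x
      1≤m : 1 ≤ m
      1≤m = ≤-trans (s≤s z≤n) 3B<m
      e₁ : ∀ m B → suc m * suc m * B ≡ m * m * B + (m * (2 * B) + B)
      e₁ = solve-∀
      e₂ : ∀ q B → q * B + q ≡ q * suc B
      e₂ = solve-∀
      e₃ : ∀ m B → m * (2 * B) + m * B ≡ m * (3 * B)
      e₃ = solve-∀
      lt : m * (2 * B) + B < m * m
      lt = begin-strict
        m * (2 * B) + B          ≤⟨ +-monoʳ-≤ (m * (2 * B)) (m≤n*m B m {{>-nonZero 1≤m}}) ⟩
        m * (2 * B) + m * B      ≡⟨ e₃ m B ⟩
        m * (3 * B)              <⟨ *-monoʳ-< m {{>-nonZero 1≤m}} 3B<m ⟩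
        m * m                    ∎

  -- e² ≤ ((x+1)/(x-1))^x for x = y + 1.
  exp-upper : ∀ y i → expNumerator i * expNumerator i * y ^ suc y ≤ i ! * i ! * suc (suc y) ^ suc y
  -- Bounding e by (1 + 1/m)^(m + 1) leaves a factor ((m + 1)/m)² too much, which tends to 1 along
  -- the multiples m of x.
  exp-upper y i = limit-≤ _ _ x λ p → main (suc p)
    where
    x = suc y
    P = expNumerator i
    F = i !
    main : ∀ p .{{_ : NonZero p}} → let m = x * p in m * m * (P * P * y ^ x) ≤ suc m * suc m * (F * F * suc x ^ x)
    main p = *-cancelʳ-≤ _ _ (m ^ m * m ^ m) {{m*n≢0 (m ^ m) (m ^ m) {{mm≢0}} {{mm≢0}}}} (begin
      m * m * (P * P * y ^ x) * (m ^ m * m ^ m)          ≡⟨ e₁ m P (y ^ x) (m ^ m) ⟩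
      y ^ x * ((m ^ suc m * P) * (m ^ suc m * P))        ≤⟨ *-monoʳ-≤ (y ^ x) (*-mono-≤ (expNumerator-upper m i) (expNumerator-upper m i)) ⟩
      y ^ x * ((suc m ^ suc m * F) * (suc m ^ suc m * F)) ≡⟨ e₂ (suc m) F (y ^ x) (suc m ^ m) ⟩
      suc m * suc m * (F * F) * (suc m ^ m * suc m ^ m * y ^ x) ≤⟨ *-monoʳ-≤ (suc m * suc m * (F * F)) powered ⟩
      suc m * suc m * (F * F) * (m ^ m * m ^ m * suc x ^ x) ≡⟨ e₃ (suc m) F (m ^ m) (suc x ^ x) ⟩
      suc m * suc m * (F * F * suc x ^ x) * (m ^ m * m ^ m) ∎)
      where
      m = x * p
      mm≢0 : NonZero (m ^ m)
      mm≢0 = m^n≢0 m m {{m*n≢0 x p}}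
      e₁ : ∀ m P q r → m * m * (P * P * q) * (r * r) ≡ q * ((m * r * P) * (m * r * P))
      e₁ = solve-∀
      e₂ : ∀ M F q r → q * ((M * r * F) * (M * r * F)) ≡ M * M * (F * F) * (r * r * q)
      e₂ = solve-∀
      e₃ : ∀ M F r q → M * M * (F * F) * (r * r * q) ≡ M * M * (F * F * q) * (r * r)
      e₃ = solve-∀
      -- For m = xp, `cayley-upper` says ((m + 1)/m)^(2p) ≤ (x + 1)/(x - 1); the x-th power has ((m
      -- + 1)/m)^(2m), an approximation of e², on the left.
      base : suc m ^ (2 * p) * y ≤ m ^ (2 * p) * suc x
      base = *-cancelʳ-≤ _ _ p (begin
        suc m ^ (2 * p) * y * p          ≡⟨ *-assoc (suc m ^ (2 * p)) y p ⟩
        suc m ^ (2 * p) * (y * p)        ≤⟨ cayley-upper p (y * p) ⟩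
        m ^ (2 * p) * (m + p)            ≡⟨ cong (m ^ (2 * p) *_) (+-comm m p) ⟩
        m ^ (2 * p) * (suc x * p)        ≡⟨ *-assoc (m ^ (2 * p)) (suc x) p ⟨
        m ^ (2 * p) * suc x * p          ∎)
      pow : ∀ a → (a ^ (2 * p)) ^ x ≡ a ^ m * a ^ m
      pow a = begin-equality
        (a ^ (2 * p)) ^ x      ≡⟨ ^-*-assoc a (2 * p) x ⟩
        a ^ (2 * p * x)        ≡⟨ cong (a ^_) (trans (*-assoc 2 p x) (cong (2 *_) (*-comm p x))) ⟩
        a ^ (2 * m)            ≡⟨ ^-square a m ⟩
        a ^ m * a ^ m          ∎
      powered : suc m ^ m * suc m ^ m * y ^ x ≤ m ^ m * m ^ m * suc x ^ x
      powered = begin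
        suc m ^ m * suc m ^ m * y ^ x      ≡⟨ cong (_* y ^ x) (pow (suc m)) ⟨
        (suc m ^ (2 * p)) ^ x * y ^ x      ≡⟨ ^-distribʳ-* x (suc m ^ (2 * p)) y ⟨
        (suc m ^ (2 * p) * y) ^ x          ≤⟨ ^-monoˡ-≤ x base ⟩
        (m ^ (2 * p) * suc x) ^ x          ≡⟨ ^-distribʳ-* x (m ^ (2 * p)) (suc x) ⟩
        (m ^ (2 * p)) ^ x * suc x ^ x      ≡⟨ cong (_* suc x ^ x) (pow m) ⟩
        m ^ m * m ^ m * suc x ^ x          ∎

  -- (x+1)^(x+1) ≤ e² x² (x-1)^(x-1) for x = y + 1, already for a partial sum of length O(x²).
  exp-lower : ∀ y .{{_ : NonZero y}} i → 3 * (suc y * (y + 3)) ≤ i →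
    suc (suc y) ^ suc (suc y) * (i ! * i !) ≤ suc y * suc y * (expNumerator i * expNumerator i) * y ^ y
  exp-lower y i big = *-cancelʳ-≤ _ _ (m ^ m * m ^ m) {{m*n≢0 (m ^ m) (m ^ m) {{mm≢0}} {{mm≢0}}}} (begin
      suc x ^ suc x * (F * F) * (m ^ m * m ^ m)                 ≡⟨ e₁ (suc x ^ suc x) (F * F) (m ^ m * m ^ m) ⟩
      F * F * (m ^ m * m ^ m * suc x ^ suc x)                   ≤⟨ *-monoʳ-≤ (F * F) rational ⟩
      F * F * (suc m ^ m * suc m ^ m * (x * x * y ^ y))         ≡⟨ e₂ F (suc m ^ m) (x * x * y ^ y) ⟩
      (suc m ^ m * F) * (suc m ^ m * F) * (x * x * y ^ y)       ≤⟨ *-monoˡ-≤ (x * x * y ^ y) (*-mono-≤ lower lower) ⟩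
      (m ^ m * P) * (m ^ m * P) * (x * x * y ^ y)               ≡⟨ e₃ (m ^ m) P (x * x) (y ^ y) ⟩
      x * x * (P * P) * y ^ y * (m ^ m * m ^ m)                 ∎)
    where
    x = suc y
    -- This is 3(x + 2). In `base` the third-order surplus 1/(3x³) of the expansion has to cover the
    -- losses 1/(x²p) and 2/(x³p), that is, p/3 ≥ x + 2.
    p = 3 * (y + 3)
    m = x * p
    P = expNumerator i
    F = i !
    instance
      p≢0 : NonZero p
      p≢0 = >-nonZero (≤-trans (s≤s (z≤n {8})) (*-monoʳ-≤ 3 (m≤n+m 3 y)))
      m≢0 : NonZero m
      m≢0 = m*n≢0 x p
    mm≢0 : NonZero (m ^ m)
    mm≢0 = m^n≢0 m m
    e₁ : ∀ a b c → a * b * c ≡ b * (c * a)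
    e₁ = solve-∀
    e₂ : ∀ F q r → F * F * (q * q * r) ≡ (q * F) * (q * F) * r
    e₂ = solve-∀
    e₃ : ∀ q P r s → (q * P) * (q * P) * (r * s) ≡ r * (P * P) * s * (q * q)
    e₃ = solve-∀
    lower : suc m ^ m * F ≤ m ^ m * P
    lower = expNumerator-lower m i (≤-trans (≤-reflexive (e y)) big)
      where
      e : ∀ y → suc y * (3 * (y + 3)) ≡ 3 * (suc y * (y + 3))
      e = solve-∀
    w = x * x * x
    -- The ratio (x + 1)(x² + x + 1)/x³ = 1 + 2/x + 2/x² + 1/x³ agrees with e^(2/x) to second order
    -- and is smaller in third order, 1 against 4/3; hence the four-term expansion.
    base : m ^ (2 * p) * (suc x * (x * x + x + 1)) ≤ suc m ^ (2 * p) * w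
    base = *-cancelʳ-≤ _ _ (6 * (p * p * p)) {{m*n≢0 6 (p * p * p) {{_}} {{m*n≢0 (p * p) p {{m*n≢0 p p}}}}}} (begin
      m ^ (2 * p) * (suc x * (x * x + x + 1)) * (6 * (p * p * p))   ≡⟨ *-assoc (m ^ (2 * p)) _ _ ⟩
      m ^ (2 * p) * (suc x * (x * x + x + 1) * (6 * (p * p * p)))
        ≤⟨ *-monoʳ-≤ (m ^ (2 * p)) (≤-trans (m≤m+n _ (4 * p)) (≤-reflexive (poly y))) ⟩
      m ^ (2 * p) * (6 * (m * m * m) + 6 * (2 + r) * (m * m) + 3 * (2 + r) * (1 + r) * m + (2 + r) * (1 + r) * r)
        ≡⟨ cong (λ z → m ^ z * (6 * (m * m * m) + 6 * (2 + r) * (m * m) + 3 * (2 + r) * (1 + r) * m + (2 + r) * (1 + r) * r)) 2p ⟩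
      m ^ (2 + r) * (6 * (m * m * m) + 6 * (2 + r) * (m * m) + 3 * (2 + r) * (1 + r) * m + (2 + r) * (1 + r) * r)
        ≤⟨ bernoulli₃ m r ⟩
      6 * suc m ^ (2 + r) * (m * m * m)       ≡⟨ cong (λ z → 6 * suc m ^ z * (m * m * m)) 2p ⟨
      6 * suc m ^ (2 * p) * (m * m * m)       ≡⟨ e₄ (suc m ^ (2 * p)) x p ⟩
      suc m ^ (2 * p) * w * (6 * (p * p * p)) ∎)
      where
      r = 6 * y + 16
      2p : 2 * p ≡ 2 + r
      2p = e y
        where
        e : ∀ y → 2 * (3 * (y + 3)) ≡ 2 + (6 * y + 16)
        e = solve-∀
      poly : ∀ y → (2 + y) * (suc y * suc y + suc y + 1) * (6 * (3 * (y + 3) * (3 * (y + 3)) * (3 * (y + 3)))) + 4 * (3 * (y + 3))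
        ≡ 6 * (suc y * (3 * (y + 3)) * (suc y * (3 * (y + 3))) * (suc y * (3 * (y + 3)))) + 6 * (2 + (6 * y + 16)) * (suc y * (3 * (y + 3)) * (suc y * (3 * (y + 3))))
          + 3 * (2 + (6 * y + 16)) * (1 + (6 * y + 16)) * (suc y * (3 * (y + 3))) + (2 + (6 * y + 16)) * (1 + (6 * y + 16)) * (6 * y + 16)
      poly = solve-∀
      e₄ : ∀ q x p → 6 * q * (x * p * (x * p) * (x * p)) ≡ q * (x * x * x) * (6 * (p * p * p))
      e₄ = solve-∀
    pow : ∀ a → (a ^ (2 * p)) ^ x ≡ a ^ m * a ^ m
    pow a = begin-equality
      (a ^ (2 * p)) ^ x      ≡⟨ ^-*-assoc a (2 * p) x ⟩
      a ^ (2 * p * x)        ≡⟨ cong (a ^_) (trans (*-assoc 2 p x) (cong (2 *_) (*-comm p x))) ⟩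
      a ^ (2 * m)            ≡⟨ ^-square a m ⟩
      a ^ m * a ^ m          ∎
    q = m ^ m * m ^ m
    v = (x * x + x + 1) * y
    w≡ : suc v ≡ w
    w≡ = e y
      where
      e : ∀ y → suc ((suc y * suc y + suc y + 1) * y) ≡ suc y * suc y * suc y
      e = solve-∀
    powered : q * (suc x ^ x * (x * x + x + 1) ^ x) ≤ suc m ^ m * suc m ^ m * w ^ x
    powered = begin
      q * (suc x ^ x * (x * x + x + 1) ^ x)                    ≡⟨ cong₂ _*_ (sym (pow m)) (sym (^-distribʳ-* x (suc x) (x * x + x + 1))) ⟩
      (m ^ (2 * p)) ^ x * (suc x * (x * x + x + 1)) ^ x        ≡⟨ ^-distribʳ-* x (m ^ (2 * p)) _ ⟨
      (m ^ (2 * p) * (suc x * (x * x + x + 1))) ^ x            ≤⟨ ^-monoˡ-≤ x base ⟩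
      (suc m ^ (2 * p) * w) ^ x                                ≡⟨ ^-distribʳ-* x (suc m ^ (2 * p)) w ⟩
      (suc m ^ (2 * p)) ^ x * w ^ x                            ≡⟨ cong (_* w ^ x) (pow (suc m)) ⟩
      suc m ^ m * suc m ^ m * w ^ x                            ∎
    -- Since (x² + x + 1)(x - 1) = x³ - 1, this is (1 - 1/x³)^x ≥ 1 - 1/x² with denominators
    -- cleared.
    w-bernoulli : w ^ x * (x * y * suc x) ≤ v ^ x * w
    w-bernoulli = +-cancelʳ-≤ (w ^ x * x) _ _ (begin
      w ^ x * (x * y * suc x) + w ^ x * x      ≡⟨ e (w ^ x) y ⟩
      w ^ x * w                                ≡⟨ cong (λ z → z ^ x * z) w≡ ⟨
      suc v ^ x * suc v                        ≤⟨ bernoulli v x ⟩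
      v ^ x * suc v + suc v ^ x * x            ≡⟨ cong (λ z → v ^ x * z + z ^ x * x) w≡ ⟩
      v ^ x * w + w ^ x * x                    ∎)
      where
      e : ∀ q y → q * (suc y * y * suc (suc y)) + q * suc y ≡ q * (suc y * suc y * suc y)
      e = solve-∀
    rational : q * suc x ^ suc x ≤ suc m ^ m * suc m ^ m * (x * x * y ^ y)
    rational = *-cancelʳ-≤ _ _ (w ^ x * (x * y)) {{m*n≢0 (w ^ x) (x * y) {{m^n≢0 w x {{m*n≢0 (x * x) x}}}} {{m*n≢0 x y}}}} (begin
      q * (suc x * suc x ^ x) * (w ^ x * (x * y))                       ≡⟨ e₅ q (suc x) (suc x ^ x) (w ^ x) (x * y) ⟩
      q * suc x ^ x * (w ^ x * (x * y * suc x))                         ≤⟨ *-monoʳ-≤ (q * suc x ^ x) w-bernoulli ⟩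
      q * suc x ^ x * (v ^ x * w)                                       ≡⟨ cong (λ z → q * suc x ^ x * (z * w)) (^-distribʳ-* x (x * x + x + 1) y) ⟩
      q * suc x ^ x * ((x * x + x + 1) ^ x * y ^ x * w)                 ≡⟨ e₆ q (suc x ^ x) ((x * x + x + 1) ^ x) (y ^ x) w ⟩
      q * (suc x ^ x * (x * x + x + 1) ^ x) * (y ^ x * w)               ≤⟨ *-monoˡ-≤ (y ^ x * w) powered ⟩
      suc m ^ m * suc m ^ m * w ^ x * (y * y ^ y * (x * x * x))         ≡⟨ e₇ (suc m ^ m * suc m ^ m) (w ^ x) y (y ^ y) x ⟩
      suc m ^ m * suc m ^ m * (x * x * y ^ y) * (w ^ x * (x * y))       ∎)
      where
      e₅ : ∀ q s r u z → q * (s * r) * (u * z) ≡ q * r * (u * (z * s))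
      e₅ = solve-∀
      e₆ : ∀ q s r u z → q * s * (r * u * z) ≡ q * (s * r) * (u * z)
      e₆ = solve-∀
      e₇ : ∀ a u y z x → a * u * (y * z * (x * x * x)) ≡ a * (x * x * z) * (u * (x * y))
      e₇ = solve-∀

-- The product of the option numbers against n^(-k/2) (n/e)^(n/2).

module Products where

  open Potential using (^-distribʳ-*; square-cancel-≤)
  open Bounds using (options; optionsProduct)
  open Stirling
  open import Data.Nat
  open import Data.Nat.Properties
  open import Data.Nat.Tactic.RingSolver
  open import Relation.Binary.PropositionalEquality
  open ≤-Reasoning

  private
    expNumerator≤4! : ∀ i → expNumerator i ≤ 4 * i !
    expNumerator≤4! i = ≤-trans (≤-reflexive (sym (*-identityˡ _))) (expNumerator-upper 1 i)

    !≤expNumerator : ∀ i → i ! ≤ expNumerator i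
    !≤expNumerator zero = ≤-refl
    !≤expNumerator (suc i) = ≤-trans (*-monoʳ-≤ (suc i) (!≤expNumerator i)) (m≤m+n _ 1)

    suc^≤ : ∀ w .{{_ : NonZero w}} → suc w ^ w ≤ 4 * w ^ w
    suc^≤ w = *-cancelʳ-≤ _ _ (w !) {{w !≢0}} (begin
      suc w ^ w * w !            ≤⟨ expNumerator-lower w w ≤-refl ⟩
      w ^ w * expNumerator w     ≤⟨ *-monoʳ-≤ (w ^ w) (expNumerator≤4! w) ⟩
      w ^ w * (4 * w !)          ≡⟨ e (w ^ w) (w !) ⟩
      4 * w ^ w * w !            ∎)
      where
      e : ∀ a b → a * (4 * b) ≡ 4 * a * b
      e = solve-∀

    suc^≤′ : ∀ y j .{{_ : NonZero y}} → suc (j + y) ^ y ≤ 4 * (j + y) ^ y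
    suc^≤′ y j = *-cancelʳ-≤ _ _ (suc w ^ j) {{m^n≢0 (suc w) j}} (begin
      suc w ^ y * suc w ^ j       ≡⟨ trans (cong (suc w ^_) (+-comm j y)) (^-distribˡ-+-* (suc w) y j) ⟨
      suc w ^ w                   ≤⟨ suc^≤ w {{>-nonZero (≤-trans (>-nonZero⁻¹ y) (m≤n+m y j))}} ⟩
      4 * w ^ w                   ≡⟨ cong (4 *_) (trans (cong (w ^_) (+-comm j y)) (^-distribˡ-+-* w y j)) ⟩
      4 * (w ^ y * w ^ j)         ≤⟨ *-monoʳ-≤ 4 (*-monoʳ-≤ (w ^ y) (^-monoˡ-≤ j (n≤1+n w))) ⟩
      4 * (w ^ y * suc w ^ j)     ≡⟨ *-assoc 4 (w ^ y) (suc w ^ j) ⟨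
      4 * w ^ y * suc w ^ j       ∎)
      where w = j + y

    shift^≤ : ∀ y j .{{_ : NonZero y}} → (j + y) ^ y ≤ 4 ^ j * y ^ y
    shift^≤ y zero = ≤-reflexive (sym (*-identityˡ _))
    shift^≤ y (suc j) = begin
      suc (j + y) ^ y        ≤⟨ suc^≤′ y j ⟩
      4 * (j + y) ^ y        ≤⟨ *-monoʳ-≤ 4 (shift^≤ y j) ⟩
      4 * (4 ^ j * y ^ y)    ≡⟨ *-assoc 4 (4 ^ j) (y ^ y) ⟨
      4 ^ suc j * y ^ y      ∎

  module _ {k t₀ : ℕ} (k<t₀ : suc k ≤ t₀) where

    private
      H = optionsProduct k t₀

      z : ℕ → ℕ
      z d = 2 * (d + t₀) ∸ suc k

      -- For n = 2(d + t₀) this is n - k. Consecutive values differ by 2, and the option number y d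
      -- + 1 lies midway, so the square of the product can be compared with y^y step by step.
      y : ℕ → ℕ
      y d = suc (z d)

      k≤2t : ∀ d → suc k ≤ 2 * (d + t₀)
      k≤2t d = ≤-trans k<t₀ (≤-trans (m≤n+m t₀ d) (m≤m+n (d + t₀) _))

      z-suc : ∀ d → z (suc d) ≡ 2 + z d
      z-suc d = trans (cong (_∸ suc k) (*-suc 2 (d + t₀))) (+-∸-assoc 2 (k≤2t d))

      y+k : ∀ d → y d + k ≡ 2 * (d + t₀)
      y+k d = trans (sym (+-suc (z d) k)) (m∸n+n≡m (k≤2t d))

      options≡ : ∀ d → options k (suc (d + t₀)) ≡ suc (y d)
      options≡ = z-suc

      Y₀ = y 0 ^ y 0

    module _ (i : ℕ) where

      private
        P = expNumerator i
        F = i !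

      -- One induction step is `exp-lower`: going from y to y + 2 multiplies y^y by at most e² times
      -- the squared option number.
      product-lower : ∀ d → 3 * (suc (2 * (d + t₀)) * (2 * (d + t₀) + 3)) ≤ i →
        y d ^ y d * (F * F) ^ d ≤ H d * H d * (P * P) ^ d * Y₀
      product-lower zero _ = ≤-reflexive (trans (*-identityʳ _) (sym (*-identityˡ _)))
      product-lower (suc d) big = begin
        y (suc d) ^ y (suc d) * (F * F * (F * F) ^ d)             ≡⟨ cong (λ v → suc v ^ suc v * (F * F * (F * F) ^ d)) (z-suc d) ⟩
        suc (suc w) ^ suc (suc w) * (F * F * (F * F) ^ d)         ≡⟨ *-assoc (suc (suc w) ^ suc (suc w)) (F * F) _ ⟨
        suc (suc w) ^ suc (suc w) * (F * F) * (F * F) ^ d         ≤⟨ *-monoˡ-≤ ((F * F) ^ d) (exp-lower w i (≤-trans (*-monoʳ-≤ 3 (*-mono-≤ (s≤s w≤) (+-monoˡ-≤ 3 w≤))) big)) ⟩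
        suc w * suc w * (P * P) * w ^ w * (F * F) ^ d             ≡⟨ *-assoc (suc w * suc w * (P * P)) (w ^ w) _ ⟩
        suc w * suc w * (P * P) * (w ^ w * (F * F) ^ d)           ≤⟨ *-monoʳ-≤ (suc w * suc w * (P * P)) (product-lower d (≤-trans smaller big)) ⟩
        suc w * suc w * (P * P) * (H d * H d * (P * P) ^ d * Y₀)  ≡⟨ e (suc w) (P * P) (H d) ((P * P) ^ d) Y₀ ⟩
        suc w * H d * (suc w * H d) * (P * P * (P * P) ^ d) * Y₀  ≡⟨ cong (λ v → v * H d * (v * H d) * (P * P * (P * P) ^ d) * Y₀) (options≡ d) ⟨
        H (suc d) * H (suc d) * (P * P * (P * P) ^ d) * Y₀        ∎
        where
        w = y d
        w≤ : w ≤ 2 * suc (d + t₀)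
        w≤ = ≤-trans (≤-trans (m≤m+n w k) (≤-reflexive (y+k d))) (*-monoʳ-≤ 2 (n≤1+n _))
        smaller : 3 * (suc (2 * (d + t₀)) * (2 * (d + t₀) + 3)) ≤ 3 * (suc (2 * suc (d + t₀)) * (2 * suc (d + t₀) + 3))
        smaller = *-monoʳ-≤ 3 (*-mono-≤ (s≤s le) (+-monoˡ-≤ 3 le))
          where le = *-monoʳ-≤ 2 (n≤1+n (d + t₀))
        e : ∀ w p h q Y → w * w * p * (h * h * q * Y) ≡ w * h * (w * h) * (p * q) * Y
        e = solve-∀

      -- The factor 2 - 1/y absorbs the product of the x²/(x² - 1).
      product-upper : ∀ d → H d * H d * (P * P) ^ d * Y₀ * y d ≤ y d ^ y d * (F * F) ^ d * suc (2 * z d)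
      product-upper zero = begin
        1 * 1 * 1 * Y₀ * y 0        ≡⟨ e Y₀ (y 0) ⟩
        Y₀ * 1 * y 0                ≤⟨ *-monoʳ-≤ (Y₀ * 1) (s≤s (m≤m+n (z 0) (z 0 + 0))) ⟩
        Y₀ * 1 * suc (2 * z 0)      ∎
        where
        e : ∀ a b → 1 * 1 * 1 * a * b ≡ a * 1 * b
        e = solve-∀
      product-upper (suc d) = *-cancelʳ-≤ _ _ (w * w) {{_}} (begin
        H (suc d) * H (suc d) * (P * P * (P * P) ^ d) * Y₀ * y (suc d) * (w * w)
          ≡⟨ cong₂ (λ u v → u * H d * (u * H d) * (P * P * (P * P) ^ d) * Y₀ * suc v * (w * w)) (options≡ d) (z-suc d) ⟩
        suc w * H d * (suc w * H d) * (P * P * (P * P) ^ d) * Y₀ * suc (suc w) * (w * w)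
          ≡⟨ e₁ w (P * P) (H d) ((P * P) ^ d) Y₀ ⟩
        suc w * suc w * (P * P) * suc (suc w) * w * (H d * H d * (P * P) ^ d * Y₀ * w)
          ≤⟨ *-monoʳ-≤ (suc w * suc w * (P * P) * suc (suc w) * w) (product-upper d) ⟩
        suc w * suc w * (P * P) * suc (suc w) * w * (w ^ w * (F * F) ^ d * suc (2 * z d))
          ≡⟨ e₂ w (P * P) (w ^ w) ((F * F) ^ d) (z d) ⟩
        P * P * (w * w ^ w) * (suc (suc w) * (F * F) ^ d * (suc w * suc w * suc (2 * z d)))
          ≤⟨ *-mono-≤ (exp-upper w i) (*-monoʳ-≤ (suc (suc w) * (F * F) ^ d) (≤-trans (m≤m+n _ 1) (≤-reflexive (e₃ (z d))))) ⟩
        F * F * suc (suc w) ^ suc w * (suc (suc w) * (F * F) ^ d * (w * w * suc (2 * (2 + z d))))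
          ≡⟨ e₄ (F * F) (suc (suc w) ^ suc w) (suc (suc w)) ((F * F) ^ d) w (suc (2 * (2 + z d))) ⟩
        suc (suc w) ^ suc (suc w) * (F * F * (F * F) ^ d) * suc (2 * (2 + z d)) * (w * w)
          ≡⟨ cong (λ v → suc v ^ suc v * (F * F * (F * F) ^ d) * suc (2 * v) * (w * w)) (z-suc d) ⟨
        y (suc d) ^ y (suc d) * (F * F * (F * F) ^ d) * suc (2 * z (suc d)) * (w * w) ∎)
        where
        w = y d
        e₁ : ∀ w p h q Y → suc w * h * (suc w * h) * (p * q) * Y * suc (suc w) * (w * w) ≡ suc w * suc w * p * suc (suc w) * w * (h * h * q * Y * w)
        e₁ = solve-∀
        e₂ : ∀ w p r q z → suc w * suc w * p * suc (suc w) * w * (r * q * suc (2 * z)) ≡ p * (w * r) * (suc (suc w) * q * (suc w * suc w * suc (2 * z)))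
        e₂ = solve-∀
        e₃ : ∀ z → (2 + z) * (2 + z) * suc (2 * z) + 1 ≡ suc z * suc z * suc (2 * (2 + z))
        e₃ = solve-∀
        e₄ : ∀ f r s q w v → f * r * (s * q * (w * w * v)) ≡ s * r * (f * q) * v * (w * w)
        e₄ = solve-∀

      private
        extend : ∀ a d → (a * a) ^ (d + t₀) ≡ (a * a) ^ d * (a * a) ^ t₀
        extend a d = ^-distribˡ-+-* (a * a) d t₀

      -- With n = 2t: n^(n-k) / e^n is at most a constant times H².
      lower-power : ∀ d → 3 * (suc (2 * (d + t₀)) * (2 * (d + t₀) + 3)) ≤ i →
        (2 * (d + t₀)) ^ y d * (F * F) ^ (d + t₀) ≤ 4 ^ k * Y₀ * (H d * H d * (P * P) ^ (d + t₀))
      lower-power d big = begin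
        (2 * (d + t₀)) ^ y d * (F * F) ^ (d + t₀)
          ≡⟨ cong₂ (λ u v → u ^ y d * v) (trans (sym (y+k d)) (+-comm (y d) k)) (extend F d) ⟩
        (k + y d) ^ y d * ((F * F) ^ d * (F * F) ^ t₀)
          ≤⟨ *-mono-≤ (shift^≤ (y d) k) (*-monoʳ-≤ ((F * F) ^ d) (^-monoˡ-≤ t₀ (*-mono-≤ (!≤expNumerator i) (!≤expNumerator i)))) ⟩
        4 ^ k * y d ^ y d * ((F * F) ^ d * (P * P) ^ t₀)
          ≡⟨ e₁ (4 ^ k) (y d ^ y d) ((F * F) ^ d) ((P * P) ^ t₀) ⟩
        4 ^ k * (P * P) ^ t₀ * (y d ^ y d * (F * F) ^ d)
          ≤⟨ *-monoʳ-≤ (4 ^ k * (P * P) ^ t₀) (product-lower d big) ⟩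
        4 ^ k * (P * P) ^ t₀ * (H d * H d * (P * P) ^ d * Y₀)
          ≡⟨ e₂ (4 ^ k) ((P * P) ^ t₀) (H d) ((P * P) ^ d) Y₀ ⟩
        4 ^ k * Y₀ * (H d * H d * ((P * P) ^ d * (P * P) ^ t₀))
          ≡⟨ cong (λ v → 4 ^ k * Y₀ * (H d * H d * v)) (extend P d) ⟨
        4 ^ k * Y₀ * (H d * H d * (P * P) ^ (d + t₀)) ∎
        where
        e₁ : ∀ a b c f → a * b * (c * f) ≡ a * f * (b * c)
        e₁ = solve-∀
        e₂ : ∀ a p h q Y → a * p * (h * h * q * Y) ≡ a * Y * (h * h * (q * p))
        e₂ = solve-∀

      upper-power : ∀ d → H d * H d * (P * P) ^ (d + t₀) ≤ 2 * 16 ^ t₀ * ((2 * (d + t₀)) ^ y d * (F * F) ^ (d + t₀))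
      upper-power d = *-cancelʳ-≤ _ _ (y d) (begin
        H d * H d * (P * P) ^ (d + t₀) * y d
          ≡⟨ cong (λ v → H d * H d * v * y d) (extend P d) ⟩
        H d * H d * ((P * P) ^ d * (P * P) ^ t₀) * y d
          ≤⟨ *-monoˡ-≤ (y d) (*-monoʳ-≤ (H d * H d) (*-monoʳ-≤ ((P * P) ^ d) Pt₀)) ⟩
        H d * H d * ((P * P) ^ d * (16 ^ t₀ * (F * F) ^ t₀)) * y d
          ≤⟨ m≤m*n _ Y₀ {{m^n≢0 (y 0) (y 0)}} ⟩
        H d * H d * ((P * P) ^ d * (16 ^ t₀ * (F * F) ^ t₀)) * y d * Y₀
          ≡⟨ e₁ (H d) ((P * P) ^ d) (16 ^ t₀) ((F * F) ^ t₀) (y d) Y₀ ⟩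
        16 ^ t₀ * (F * F) ^ t₀ * (H d * H d * (P * P) ^ d * Y₀ * y d)
          ≤⟨ *-monoʳ-≤ (16 ^ t₀ * (F * F) ^ t₀) (product-upper d) ⟩
        16 ^ t₀ * (F * F) ^ t₀ * (y d ^ y d * (F * F) ^ d * suc (2 * z d))
          ≤⟨ *-monoʳ-≤ (16 ^ t₀ * (F * F) ^ t₀) (*-mono-≤ (*-monoˡ-≤ ((F * F) ^ d) (^-monoˡ-≤ (y d) (≤-trans (m≤m+n (y d) k) (≤-reflexive (y+k d)))))
               (≤-trans (n≤1+n _) (≤-reflexive (sym (*-suc 2 (z d)))))) ⟩
        16 ^ t₀ * (F * F) ^ t₀ * ((2 * (d + t₀)) ^ y d * (F * F) ^ d * (2 * y d))
          ≡⟨ e₂ (16 ^ t₀) ((F * F) ^ t₀) ((2 * (d + t₀)) ^ y d) ((F * F) ^ d) (y d) ⟩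
        2 * 16 ^ t₀ * ((2 * (d + t₀)) ^ y d * ((F * F) ^ d * (F * F) ^ t₀)) * y d
          ≡⟨ cong (λ v → 2 * 16 ^ t₀ * ((2 * (d + t₀)) ^ y d * v) * y d) (extend F d) ⟨
        2 * 16 ^ t₀ * ((2 * (d + t₀)) ^ y d * (F * F) ^ (d + t₀)) * y d ∎)
        where
        Pt₀ : (P * P) ^ t₀ ≤ 16 ^ t₀ * (F * F) ^ t₀
        Pt₀ = ≤-trans (^-monoˡ-≤ t₀ (≤-trans (*-mono-≤ (expNumerator≤4! i) (expNumerator≤4! i)) (≤-reflexive (e F))))
          (≤-reflexive (^-distribʳ-* t₀ 16 (F * F)))
          where
          e : ∀ f → 4 * f * (4 * f) ≡ 16 * (f * f)
          e = solve-∀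
        e₁ : ∀ h p a f y Y → h * h * (p * (a * f)) * y * Y ≡ a * f * (h * h * p * Y * y)
        e₁ = solve-∀
        e₂ : ∀ a f n q y → a * f * (n * q * (2 * y)) ≡ 2 * a * (n * (q * f)) * y
        e₂ = solve-∀

    -- The fraction sᵏ (nF)ᵗ / (Aᵏ Pᵗ), where A/s approximates √n and P/F approximates e.
    lowerFactor upperFactor : ℕ
    lowerFactor = 16 ^ k * Y₀
    upperFactor = 2 * 16 ^ t₀

    private
      squared : ∀ a n F k t → a ^ k * (n * F) ^ t * (a ^ k * (n * F) ^ t) ≡ (a * a) ^ k * ((n * n) ^ t * (F * F) ^ t)
      squared a n F k t = begin-equality
        a ^ k * (n * F) ^ t * (a ^ k * (n * F) ^ t)      ≡⟨ e (a ^ k) ((n * F) ^ t) ⟩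
        a ^ k * a ^ k * ((n * F) ^ t * (n * F) ^ t)      ≡⟨ cong₂ _*_ (sym (^-distribʳ-* k a a)) (sym (^-distribʳ-* t (n * F) (n * F))) ⟩
        (a * a) ^ k * (n * F * (n * F)) ^ t              ≡⟨ cong (λ v → (a * a) ^ k * v ^ t) (e (n) F) ⟩
        (a * a) ^ k * (n * n * (F * F)) ^ t              ≡⟨ cong ((a * a) ^ k *_) (^-distribʳ-* t (n * n) (F * F)) ⟩
        (a * a) ^ k * ((n * n) ^ t * (F * F) ^ t)        ∎
        where
        e : ∀ a b → a * b * (a * b) ≡ a * a * (b * b)
        e = solve-∀

      n-power : ∀ d → let n = 2 * (d + t₀) in (n * n) ^ (d + t₀) ≡ n ^ k * n ^ y d
      n-power d = begin-equality
        (n * n) ^ t           ≡⟨ ^-distribʳ-* t n n ⟩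
        n ^ t * n ^ t         ≡⟨ ^-distribˡ-+-* n t t ⟨
        n ^ (t + t)           ≡⟨ cong (n ^_) (trans (cong (t +_) (sym (+-identityʳ t))) (trans (sym (y+k d)) (+-comm (y d) k))) ⟩
        n ^ (k + y d)         ≡⟨ ^-distribˡ-+-* n k (y d) ⟩
        n ^ k * n ^ y d       ∎
        where
        t = d + t₀
        n = 2 * t

    -- In the squared fraction A², which approximates s²n, cancels n^k from n^(2t) = n^n. What is
    -- left is n^(n - k)/e^n, the quantity that `lower-power` compares with H².
    fraction-upper : ∀ i d s A → let t = d + t₀ ; n = 2 * t in 3 * (suc n * (n + 3)) ≤ i → s * s * n ≤ 4 * (A * A) →
      s ^ k * (n * i !) ^ t ≤ lowerFactor * (H d * (A ^ k * expNumerator i ^ t))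
    fraction-upper i d s A big sA = square-cancel-≤ (begin
      s ^ k * (n * F) ^ t * (s ^ k * (n * F) ^ t)             ≡⟨ squared s n F k t ⟩
      (s * s) ^ k * ((n * n) ^ t * (F * F) ^ t)               ≡⟨ cong (λ v → (s * s) ^ k * (v * (F * F) ^ t)) (n-power d) ⟩
      (s * s) ^ k * (n ^ k * n ^ y d * (F * F) ^ t)           ≡⟨ e₁ ((s * s) ^ k) (n ^ k) (n ^ y d) ((F * F) ^ t) ⟩
      (s * s) ^ k * n ^ k * (n ^ y d * (F * F) ^ t)           ≡⟨ cong (_* (n ^ y d * (F * F) ^ t)) (^-distribʳ-* k (s * s) n) ⟨
      (s * s * n) ^ k * (n ^ y d * (F * F) ^ t)               ≤⟨ *-mono-≤ (^-monoˡ-≤ k sA) (lower-power i d big) ⟩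
      (4 * (A * A)) ^ k * (4 ^ k * Y₀ * (H d * H d * (P * P) ^ t))
        ≡⟨ cong₂ (λ u v → u * (4 ^ k * Y₀ * (H d * H d * v))) (trans (^-distribʳ-* k 4 (A * A)) (cong (4 ^ k *_) (^-distribʳ-* k A A))) (^-distribʳ-* t P P) ⟩
      4 ^ k * (A ^ k * A ^ k) * (4 ^ k * Y₀ * (H d * H d * (P ^ t * P ^ t)))
        ≡⟨ e₂ (4 ^ k) (A ^ k) Y₀ (H d) (P ^ t) ⟩
      4 ^ k * 4 ^ k * Y₀ * (H d * (A ^ k * P ^ t) * (H d * (A ^ k * P ^ t)))
        ≡⟨ cong (λ v → v * Y₀ * (H d * (A ^ k * P ^ t) * (H d * (A ^ k * P ^ t)))) (^-distribʳ-* k 4 4) ⟨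
      lowerFactor * (H d * (A ^ k * P ^ t) * (H d * (A ^ k * P ^ t)))
        ≤⟨ *-monoˡ-≤ (H d * (A ^ k * P ^ t) * (H d * (A ^ k * P ^ t))) (m≤m*n lowerFactor lowerFactor {{m*n≢0 (16 ^ k) Y₀ {{m^n≢0 16 k}} {{m^n≢0 (y 0) (y 0)}}}}) ⟩
      lowerFactor * lowerFactor * (H d * (A ^ k * P ^ t) * (H d * (A ^ k * P ^ t)))
        ≡⟨ e₃ lowerFactor (H d * (A ^ k * P ^ t)) ⟩
      lowerFactor * (H d * (A ^ k * P ^ t)) * (lowerFactor * (H d * (A ^ k * P ^ t))) ∎)
      where
      t = d + t₀
      n = 2 * t
      F = i !
      P = expNumerator i
      e₁ : ∀ a b c f → a * (b * c * f) ≡ a * b * (c * f)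
      e₁ = solve-∀
      e₂ : ∀ a A Y h p → a * (A * A) * (a * Y * (h * h * (p * p))) ≡ a * a * Y * (h * (A * p) * (h * (A * p)))
      e₂ = solve-∀
      e₃ : ∀ a b → a * a * (b * b) ≡ a * b * (a * b)
      e₃ = solve-∀

    fraction-lower : ∀ i d s A → let t = d + t₀ ; n = 2 * t in A * A ≤ s * s * n →
      H d * (A ^ k * expNumerator i ^ t) ≤ upperFactor * (s ^ k * (n * i !) ^ t)
    fraction-lower i d s A As = square-cancel-≤ (begin
      H d * (A ^ k * P ^ t) * (H d * (A ^ k * P ^ t))               ≡⟨ e₁ (H d) (A ^ k) (P ^ t) ⟩
      A ^ k * A ^ k * (H d * H d * (P ^ t * P ^ t))                 ≡⟨ cong₂ (λ u v → u * (H d * H d * v)) (sym (^-distribʳ-* k A A)) (sym (^-distribʳ-* t P P)) ⟩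
      (A * A) ^ k * (H d * H d * (P * P) ^ t)                       ≤⟨ *-mono-≤ (^-monoˡ-≤ k As) (upper-power i d) ⟩
      (s * s * n) ^ k * (upperFactor * (n ^ y d * (F * F) ^ t))     ≡⟨ cong (_* (upperFactor * (n ^ y d * (F * F) ^ t))) (^-distribʳ-* k (s * s) n) ⟩
      (s * s) ^ k * n ^ k * (upperFactor * (n ^ y d * (F * F) ^ t)) ≡⟨ e₂ ((s * s) ^ k) (n ^ k) upperFactor (n ^ y d) ((F * F) ^ t) ⟩
      upperFactor * ((s * s) ^ k * (n ^ k * n ^ y d * (F * F) ^ t)) ≡⟨ cong (λ v → upperFactor * ((s * s) ^ k * (v * (F * F) ^ t))) (n-power d) ⟨
      upperFactor * ((s * s) ^ k * ((n * n) ^ t * (F * F) ^ t))     ≡⟨ cong (upperFactor *_) (squared s n F k t) ⟨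
      upperFactor * (s ^ k * (n * F) ^ t * (s ^ k * (n * F) ^ t))
        ≤⟨ *-monoˡ-≤ (s ^ k * (n * F) ^ t * (s ^ k * (n * F) ^ t)) (m≤m*n upperFactor upperFactor {{m*n≢0 2 (16 ^ t₀) {{_}} {{m^n≢0 16 t₀}}}}) ⟩
      upperFactor * upperFactor * (s ^ k * (n * F) ^ t * (s ^ k * (n * F) ^ t))
        ≡⟨ e₃ upperFactor (s ^ k * (n * F) ^ t) ⟩
      upperFactor * (s ^ k * (n * F) ^ t) * (upperFactor * (s ^ k * (n * F) ^ t)) ∎)
      where
      t = d + t₀
      n = 2 * t
      F = i !
      P = expNumerator i
      e₁ : ∀ h a p → h * (a * p) * (h * (a * p)) ≡ a * a * (h * h * (p * p))
      e₁ = solve-∀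
      e₂ : ∀ a b c f g → a * b * (c * (f * g)) ≡ c * (a * (b * f * g))
      e₂ = solve-∀
      e₃ : ∀ a b → a * a * (b * b) ≡ a * b * (a * b)
      e₃ = solve-∀

-- Two matchings with connected union form a single alternating cycle.

module Walk where

  open Switching
  open import Data.Bool using (Bool; true; false; not)
  open import Data.Bool.Properties using (not-involutive)
  open import Data.Nat
  open import Data.Nat.Properties
  open import Data.Fin using (Fin; zero; suc; toℕ; fromℕ<)
  import Data.Fin.Properties as Fin
  open import Data.List using (allFin)
  open import Data.List.Membership.Propositional.Properties using (∈-allFin)
  open import Data.Product using (_×_; _,_; proj₁; proj₂; ∃-syntax)
  open import Data.Sum using (_⊎_; inj₁; inj₂)
  open import Relation.Binary using (tri<; tri≈; tri>)
  open import Relation.Nullary using (yes; no; contradiction)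
  open import Relation.Binary.PropositionalEquality

  open IsMatching

  even : ℕ → Bool
  even zero = true
  even (suc j) = not (even j)

  even-+ : ∀ a {b} → even b ≡ true → even (a + b) ≡ even a
  even-+ zero eb = eb
  even-+ (suc a) eb = cong not (even-+ a eb)

  private
    not≢ : ∀ {b c} → c ≢ b → c ≡ not b
    not≢ {false} {false} p = contradiction refl p
    not≢ {false} {true} _ = refl
    not≢ {true} {false} _ = refl
    not≢ {true} {true} p = contradiction refl p

  module _ {n : ℕ} {σ τ : Fin n → Fin n} (mσ : IsMatching σ) (mτ : IsMatching τ) where

    private V = Fin n

    along : Bool → V → V
    along true = σ
    along false = τ

    along-matching : ∀ b → IsMatching (along b)
    along-matching true = mσ
    along-matching false = mτ

    reach-sym : ∀ {x y} → Reach σ τ x y → Reach σ τ y x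
    reach-sym here = here
    reach-sym (via-σ {y} r) = reach-trans (subst (Reach σ τ (σ y)) (invol mσ y) (via-σ here)) (reach-sym r)
    reach-sym (via-τ {y} r) = reach-trans (subst (Reach σ τ (τ y)) (invol mτ y) (via-τ here)) (reach-sym r)

    module _ (v₀ : V) where

      walk : ℕ → V
      walk zero = v₀
      walk (suc j) = along (even j) (walk j)

      walk-back : ∀ j → along (even j) (walk (suc j)) ≡ walk j
      walk-back j = invol (along-matching (even j)) (walk j)

      -- Two visits of opposite parity would close up to a fixed point of σ or τ.
      walk-odd : ∀ g a → even g ≡ false → walk (g + a) ≢ walk a
      walk-odd (suc zero) a _ eq = nofix (along-matching (even a)) (walk a) eq
      walk-odd (suc (suc g)) a odd eq = walk-odd g (suc a) (trans (sym (not-involutive (even g))) odd) (begin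
        walk (g + suc a)                                  ≡⟨ cong walk (+-suc g a) ⟩
        walk (suc (g + a))                                ≡⟨ walk-back (suc (g + a)) ⟨
        along (even (suc (g + a))) (walk (suc (suc g) + a)) ≡⟨ cong₂ along par eq ⟩
        walk (suc a)                                      ∎)
        where
        open ≡-Reasoning
        par : even (suc (g + a)) ≡ even a
        par = trans (cong even (trans (cong suc (+-comm g a)) (sym (+-suc a g)))) (even-+ a (trans (cong not (sym (not-involutive (even g)))) (cong not odd)))

      -- Both ends are walked back one step at a time; an even gap keeps their parities, and so the
      -- matchings used, the same.
      walk-even : ∀ g a → even g ≡ true → walk (g + a) ≡ walk a → walk g ≡ walk 0
      walk-even g zero eg eq = trans (cong walk (sym (+-identityʳ g))) eq
      walk-even g (suc a) eg eq = walk-even g a eg (begin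
        walk (g + a)                                 ≡⟨ walk-back (g + a) ⟨
        along (even (g + a)) (walk (suc (g + a)))    ≡⟨ cong₂ along par (trans (cong walk (sym (+-suc g a))) eq) ⟩
        along (even a) (walk (suc a))                ≡⟨ walk-back a ⟩
        walk a                                       ∎)
        where
        open ≡-Reasoning
        par : even (g + a) ≡ even a
        par = trans (cong even (+-comm g a)) (even-+ a eg)

      walk-repeat : ∀ g a → walk (g + a) ≡ walk a → even g ≡ true × walk g ≡ walk 0
      walk-repeat g a eq with even g in eg
      ... | true = refl , walk-even g a eg eq
      ... | false = contradiction eq (walk-odd g a eg)

      private
        walk-last : ∀ g → 0 < g → even g ≡ true → walk g ≡ walk 0 → ∃[ i ] suc i ≡ g × along false v₀ ≡ walk i
        walk-last (suc i) _ eg cl = i , refl , trans (cong₂ along par (sym cl)) (walk-back i)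
          where
          par : false ≡ even i
          par = trans (cong not (sym eg)) (not-involutive (even i))

      module _ {g : ℕ} .{{_ : NonZero g}} (even-g : even g ≡ true) (closing : walk g ≡ walk 0) where

        -- The matching c leads forward from position j if c is the parity of j, and backward
        -- otherwise; at the ends of the period `closing` wraps the step around.
        walk-neighbour : ∀ c {j} → j < g → ∃[ i ] i < g × along c (walk j) ≡ walk i ×
          ((i ≡ suc j ⊎ suc j ≡ g × i ≡ 0) ⊎ (j ≡ suc i ⊎ suc i ≡ g × j ≡ 0))
        walk-neighbour c {j} j<g with c Data.Bool.≟ even j
        ... | yes refl with suc j <? g
        ...   | yes lt = suc j , lt , refl , inj₁ (inj₁ refl)
        ...   | no ¬lt = 0 , ≤-trans (s≤s z≤n) j<g , trans (cong walk e) closing , inj₁ (inj₂ (e , refl))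
          where
          e : suc j ≡ g
          e = ≤-antisym j<g (≮⇒≥ ¬lt)
        walk-neighbour c {suc i} j<g | no ¬p = i , ≤-trans (n≤1+n _) j<g ,
          trans (cong (λ b → along b (walk (suc i))) (trans (not≢ ¬p) (not-involutive (even i)))) (walk-back i) , inj₂ (inj₁ refl)
        walk-neighbour c {zero} j<g | no ¬p = let (i , e , eq) = walk-last g j<g even-g closing in
          i , ≤-reflexive e , trans (cong (λ b → along b v₀) (not≢ ¬p)) eq , inj₂ (inj₂ (e , refl))

        walk-covers : Connected (allFin n) σ τ → ∀ y → ∃[ j ] j < g × walk j ≡ y
        walk-covers conn y = go (conn (∈-allFin v₀) (∈-allFin y))
          where
          move : ∀ c {y} → ∃[ j ] j < g × walk j ≡ y → ∃[ j ] j < g × walk j ≡ along c y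
          move c (j , lt , refl) = let (i , lt′ , eq , _) = walk-neighbour c lt in i , lt′ , sym eq
          go : ∀ {y} → Reach σ τ v₀ y → ∃[ j ] j < g × walk j ≡ y
          go here = 0 , >-nonZero⁻¹ g , refl
          go (via-σ r) = move true (go r)
          go (via-τ r) = move false (go r)

        walk-period≥ : Connected (allFin n) σ τ → n ≤ g
        walk-period≥ conn = Fin.injective⇒≤ {f = λ y → fromℕ< (proj₁ (proj₂ (walk-covers conn y)))} λ {x} {y} eq →
          let (i , lt , ex) = walk-covers conn x ; (j , lt′ , ey) = walk-covers conn y in
          trans (sym ex) (trans (cong walk (trans (sym (Fin.toℕ-fromℕ< lt)) (trans (cong toℕ eq) (Fin.toℕ-fromℕ< lt′)))) ey)

      module _ (conn : Connected (allFin n) σ τ) where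

        private
          gap : ∀ {i j} → i < j → walk i ≡ walk j → ∃[ g ] g + i ≡ j × 0 < g × even g ≡ true × walk g ≡ walk 0
          gap {i} {j} lt eq = let e = m∸n+n≡m (<⇒≤ lt) ; (eg , cl) = walk-repeat (j ∸ i) i (trans (cong walk e) (sym eq)) in
            j ∸ i , e , m<n⇒0<n∸m lt , eg , cl

        -- Among n + 1 positions two coincide, which gives an even period of at most n. The
        -- positions within one period are closed under both matchings, so they cover all n vertices
        -- and the period is at least n.
        walk-closes : even n ≡ true × walk n ≡ walk 0
        walk-closes with Fin.pigeonhole ≤-refl (λ (i : Fin (suc n)) → walk (toℕ i))
        ... | i , j , lt , eq with gap lt eq
        ... | g , e , pos , eg , cl = subst (λ m → even m ≡ true × walk m ≡ walk 0) g≡n (eg , cl)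
          where
          g≡n : g ≡ n
          g≡n = ≤-antisym (≤-trans (m≤m+n g (toℕ i)) (≤-trans (≤-reflexive e) (≤-pred (Fin.toℕ<n j))))
            (walk-period≥ {{>-nonZero pos}} eg cl conn)

        private
          walk-injective-< : ∀ {i j} → i < j → j < n → walk i ≢ walk j
          walk-injective-< {i} {j} lt j<n eq with gap lt eq
          ... | g , e , pos , eg , cl = <⇒≱ j<n (≤-trans (walk-period≥ {{>-nonZero pos}} eg cl conn)
              (≤-trans (m≤m+n g i) (≤-reflexive e)))

        walk-injective : ∀ {i j} → i < n → j < n → walk i ≡ walk j → i ≡ j
        walk-injective {i} {j} i<n j<n eq with <-cmp i j
        ... | tri< lt _ _ = contradiction eq (walk-injective-< lt j<n)
        ... | tri≈ _ e _ = e
        ... | tri> _ _ gt = contradiction (sym eq) (walk-injective-< gt i<n)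

-- From involutions and connectivity back to edge sets and Hamilton cycles.

module Translate where

  open Switching
  open Counting
  open Walk
  open Finite
  open Bounds using (defect)
  open import Defs using (EdgeSet; endpoints; Joins; Covers; IsPerfectMatching; next; IsHamiltonCycle; totalIntersection; HasCount)
  open import Data.Bool using (true; false)
  open import Data.Nat hiding (_≟_)
  open import Data.Nat.Properties hiding (_≟_)
  open import Data.Nat.DivMod using (m<n⇒m%n≡m; n%n≡0)
  open import Data.Nat.ListAction using (sum)
  open import Data.Fin as Fin using (Fin; zero; suc; toℕ; fromℕ<)
  import Data.Fin.Properties as Fin
  open import Data.Fin.Permutation using (permutation; _⟨$⟩ʳ_; _⟨$⟩ˡ_; inverseʳ)
  open import Data.Fin.Subset using (Subset; _∈_; _∪_; _∩_; ∣_∣)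
  open import Data.Fin.Subset.Properties using (x∈p∪q⁻; x∈p∪q⁺; x∈p∩q⁺; ⊆-antisym)
  open import Data.List using (List; []; _∷_; _++_; length; lookup; filter; map; allFin; cartesianProduct)
  open import Data.List.Properties using (length-++; length-tabulate)
  open import Data.List.Relation.Unary.Any using (here; there; index)
  open import Data.List.Relation.Unary.Any.Properties using (lookup-index)
  import Data.List.Relation.Unary.All as All
  open import Data.List.Relation.Unary.AllPairs using ([]; _∷_)
  import Data.List.Membership.Propositional as List
  open import Data.List.Membership.Propositional.Properties using (∈-allFin; ∈-filter⁺; ∈-filter⁻; ∈-lookup; ∈-cartesianProduct⁺; ∈-++⁺ˡ; ∈-++⁺ʳ)
  open import Data.List.Relation.Unary.Unique.Propositional using (Unique)
  import Data.List.Relation.Unary.Unique.Propositional.Properties as Unique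
  open import Data.Vec as Vec using (Vec; tabulate; here; there)
  open import Data.Vec.Properties using (lookup∘tabulate; lookup⇒[]=; []=⇒lookup)
  open import Data.Product using (_×_; _,_; proj₁; proj₂; ∃-syntax)
  open import Data.Product.Properties using (,-injective)
  open import Data.Sum using (_⊎_; inj₁; inj₂; swap; [_,_]′)
  open import Function using (_⇔_; mk⇔; Equivalence; _∘_)
  open import Relation.Binary using (tri<; tri≈; tri>)
  open import Relation.Nullary using (¬_; Dec; yes; no; ¬?; does; contradiction)
  open import Relation.Binary.PropositionalEquality

  open IsMatching

  lookup-injective : ∀ {A : Set} {xs : List A} → Unique xs → ∀ i j → lookup xs i ≡ lookup xs j → i ≡ j
  lookup-injective {xs = x ∷ xs} (x∉ ∷ uq) zero zero eq = refl
  lookup-injective {xs = x ∷ xs} (x∉ ∷ uq) zero (suc j) eq = contradiction eq (All.lookup x∉ (∈-lookup j))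
  lookup-injective {xs = x ∷ xs} (x∉ ∷ uq) (suc i) zero eq = contradiction (sym eq) (All.lookup x∉ (∈-lookup i))
  lookup-injective {xs = x ∷ xs} (x∉ ∷ uq) (suc i) (suc j) eq = cong suc (lookup-injective uq i j eq)

  module _ {n : ℕ} where

    private V = Fin n

    endpoints< : ∀ f → proj₁ (endpoints n f) Fin.< proj₂ (endpoints n f)
    endpoints< f = proj₂ (∈-filter⁻ (λ (u , v) → u Fin.<? v) {xs = cartesianProduct (allFin n) (allFin n)} (∈-lookup f))

    joins-≢ : ∀ {f u v} → Joins n f u v → u ≢ v
    joins-≢ {f} (inj₁ e) refl = <-irrefl refl (subst (λ p → proj₁ p Fin.< proj₂ p) e (endpoints< f))
    joins-≢ {f} (inj₂ e) refl = <-irrefl refl (subst (λ p → proj₁ p Fin.< proj₂ p) e (endpoints< f))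

    joins-sym : ∀ {f u v} → Joins n f u v → Joins n f v u
    joins-sym = swap

    private
      edge< : ∀ {u v : V} → u Fin.< v → ∃[ f ] endpoints n f ≡ (u , v)
      edge< {u} {v} lt = let p = ∈-filter⁺ (λ (u , v) → u Fin.<? v) (∈-cartesianProduct⁺ (∈-allFin u) (∈-allFin v)) lt in index p , sym (lookup-index p)

    edge : ∀ {u v : V} → u ≢ v → ∃[ f ] Joins n f u v
    edge {u} {v} u≢v with Fin.<-cmp u v
    ... | tri< lt _ _ = let (f , e) = edge< lt in f , inj₁ e
    ... | tri≈ _ e _ = contradiction e u≢v
    ... | tri> _ _ gt = let (f , e) = edge< gt in f , inj₂ e

    endpoints-injective : ∀ f g → endpoints n f ≡ endpoints n g → f ≡ g
    endpoints-injective = lookup-injective (Unique.filter⁺ (λ (u , v) → u Fin.<? v) (Unique.cartesianProduct⁺ (Unique.allFin⁺ n) (Unique.allFin⁺ n)))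

    joins-unique : ∀ {f g u v} → Joins n f u v → Joins n g u v → f ≡ g
    joins-unique {f} {g} (inj₁ e) (inj₁ e′) = endpoints-injective f g (trans e (sym e′))
    joins-unique {f} {g} (inj₂ e) (inj₂ e′) = endpoints-injective f g (trans e (sym e′))
    joins-unique {f} {g} (inj₁ e) (inj₂ e′) = contradiction (subst (λ p → proj₁ p Fin.< proj₂ p) e (endpoints< f))
      (<-asym (subst (λ p → proj₁ p Fin.< proj₂ p) e′ (endpoints< g)))
    joins-unique {f} {g} (inj₂ e) (inj₁ e′) = contradiction (subst (λ p → proj₁ p Fin.< proj₂ p) e′ (endpoints< g))
      (<-asym (subst (λ p → proj₁ p Fin.< proj₂ p) e (endpoints< f)))

    joins-endpoints : ∀ f → Joins n f (proj₁ (endpoints n f)) (proj₂ (endpoints n f))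
    joins-endpoints f = inj₁ refl

    covers⇒joins : ∀ {f v} → Covers n f v → ∃[ u ] Joins n f v u
    covers⇒joins {f} (inj₁ refl) = proj₂ (endpoints n f) , inj₁ refl
    covers⇒joins {f} (inj₂ refl) = proj₁ (endpoints n f) , inj₂ refl

    joins⇒covers : ∀ {f u v} → Joins n f u v → Covers n f u
    joins⇒covers (inj₁ e) = inj₁ (cong proj₁ (sym e))
    joins⇒covers (inj₂ e) = inj₂ (cong proj₂ (sym e))

    joins-other : ∀ {f u v w} → Joins n f u v → Joins n f u w → v ≡ w
    joins-other (inj₁ e) (inj₁ e′) = proj₂ (,-injective (trans (sym e) e′))
    joins-other (inj₂ e) (inj₂ e′) = proj₁ (,-injective (trans (sym e) e′))
    joins-other {f} (inj₁ e) (inj₂ e′) = let (p , q) = ,-injective (trans (sym e) e′) in trans q p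
    joins-other {f} (inj₂ e) (inj₁ e′) = let (p , q) = ,-injective (trans (sym e) e′) in trans p q

    -- Quantifying over every pair that f joins, in either order, hides the orientation in which the
    -- edge is stored.
    Represents : EdgeSet n → (V → V) → Set
    Represents M τ = ∀ {f u v} → Joins n f u v → f ∈ M ⇔ τ u ≡ v

    represents-≡ : ∀ {M M′ τ} → Represents M τ → Represents M′ τ → M ≡ M′
    represents-≡ r r′ = ⊆-antisym
      (λ {f} f∈ → Equivalence.from (r′ (joins-endpoints f)) (Equivalence.to (r (joins-endpoints f)) f∈))
      (λ {f} f∈ → Equivalence.from (r (joins-endpoints f)) (Equivalence.to (r′ (joins-endpoints f)) f∈))

    represents-matching : ∀ {M τ} → IsMatching τ → Represents M τ → IsPerfectMatching n M
    represents-matching {M} {τ} m r = record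
      { disjoint = λ f g f∈ g∈ f≢g v (cf , cg) → f≢g (same f∈ g∈ (covers⇒joins cf) (covers⇒joins cg))
      ; covering = λ v → let (f , j) = edge (≢-sym (nofix m v)) in f , Equivalence.from (r j) refl , joins⇒covers j }
      where
      same : ∀ {f g v} → f ∈ M → g ∈ M → ∃[ u ] Joins n f v u → ∃[ u ] Joins n g v u → f ≡ g
      same f∈ g∈ (u , j) (u′ , j′) with trans (sym (Equivalence.to (r j) f∈)) (Equivalence.to (r j′) g∈)
      ... | refl = joins-unique j j′

    module _ {M : EdgeSet n} (pm : IsPerfectMatching n M) where
      open IsPerfectMatching pm

      private
        partner′ : ∀ v → ∃[ u ] ∃[ f ] f ∈ M × Joins n f v u
        partner′ v = let (f , f∈ , c) = covering v ; (u , j) = covers⇒joins c in u , f , f∈ , j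

      partner : V → V
      partner v = proj₁ (partner′ v)

      partner-unique : ∀ {f u v} → f ∈ M → Joins n f u v → partner u ≡ v
      partner-unique {f} {u} {v} f∈ j = agree (partner′ u)
        where
        agree : (p : ∃[ w ] ∃[ g ] g ∈ M × Joins n g u w) → proj₁ p ≡ v
        agree (w , g , g∈ , j′) with g Fin.≟ f
        ... | yes refl = joins-other j′ j
        ... | no g≢f = contradiction (joins⇒covers j′ , joins⇒covers j) (disjoint g f g∈ f∈ g≢f u)

      partner-represents : Represents M partner
      partner-represents {f} {u} {v} j = mk⇔ (λ f∈ → partner-unique f∈ j) back
        where
        back : partner u ≡ v → f ∈ M
        back refl = let (_ , g , g∈ , j′) = partner′ u in subst (_∈ M) (joins-unique j′ j) g∈

      partner-matching : IsMatching partner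
      partner-matching .invol v = let (u , f , f∈ , j) = partner′ v in partner-unique f∈ (joins-sym {f} j)
      partner-matching .nofix v e = let (u , f , f∈ , j) = partner′ v in joins-≢ {f} j (sym e)

    edgesOf : Vec V n → EdgeSet n
    edgesOf σ = tabulate (λ f → does (Vec.lookup σ (proj₁ (endpoints n f)) ≟ proj₂ (endpoints n f)))

    edgesOf-represents : ∀ {σ} → IsMatching (Vec.lookup σ) → Represents (edgesOf σ) (Vec.lookup σ)
    edgesOf-represents {σ} m {f} {u} {v} j = mk⇔ (λ f∈ → to j (trans (sym (lookup∘tabulate _ f)) ([]=⇒lookup f∈)))
      (λ e → lookup⇒[]= f _ (trans (lookup∘tabulate _ f) (from j e)))
      where
      s t : V
      s = proj₁ (endpoints n f)
      t = proj₂ (endpoints n f)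
      yes-does : ∀ {A : Set} (d : Dec A) → does d ≡ true → A
      yes-does (yes a) _ = a
      does-yes : ∀ {A : Set} (d : Dec A) → A → does d ≡ true
      does-yes (yes _) _ = refl
      does-yes (no ¬a) a = contradiction a ¬a
      to : Joins n f u v → does (Vec.lookup σ s ≟ t) ≡ true → Vec.lookup σ u ≡ v
      to (inj₁ e) d = let (p , q) = ,-injective e in trans (cong (Vec.lookup σ) (sym p)) (trans (yes-does (Vec.lookup σ s ≟ t) d) q)
      to (inj₂ e) d = let (p , q) = ,-injective e in flip m (trans (cong (Vec.lookup σ) (sym p)) (trans (yes-does (Vec.lookup σ s ≟ t) d) q))
      from : Joins n f u v → Vec.lookup σ u ≡ v → does (Vec.lookup σ s ≟ t) ≡ true
      from (inj₁ e) h = let (p , q) = ,-injective e in does-yes (Vec.lookup σ s ≟ t) (trans (cong (Vec.lookup σ) p) (trans h (sym q)))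
      from (inj₂ e) h = let (p , q) = ,-injective e in does-yes (Vec.lookup σ s ≟ t) (trans (cong (Vec.lookup σ) p) (trans (flip m h) (sym q)))

    module _ {M N : EdgeSet n} {σ τ : V → V} (mσ : IsMatching σ) (mτ : IsMatching τ)
             (rσ : Represents M σ) (rτ : Represents N τ) where

      private
        next-toℕ : ∀ (i : Fin n) → toℕ (next i) ≡ suc (toℕ i) ⊎ suc (toℕ i) ≡ n × toℕ (next i) ≡ 0
        next-toℕ i with suc (toℕ i) <? n
        ... | yes lt = inj₁ (trans (Fin.toℕ-fromℕ< _) (m<n⇒m%n≡m {{Fin.nonZeroIndex i}} lt))
        ... | no ¬lt = inj₂ (e , trans (Fin.toℕ-fromℕ< _) (subst (λ m → (m % n) {{Fin.nonZeroIndex i}} ≡ 0) (sym e) (n%n≡0 n {{Fin.nonZeroIndex i}})))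
          where
          e : suc (toℕ i) ≡ n
          e = ≤-antisym (Fin.toℕ<n i) (≮⇒≥ ¬lt)

      hamilton⇒connected : IsHamiltonCycle n (M ∪ N) → Connected (allFin n) σ τ
      hamilton⇒connected h {x} {y} _ _ = reach-trans (reach-sym mσ mτ (from₀ x)) (from₀ y)
        where
        open IsHamiltonCycle h
        π : Fin n → V
        π i = ordering ⟨$⟩ʳ i
        0<n : 0 < n
        0<n = ≤-trans (s≤s z≤n) 3≤n
        v₀ = π (fromℕ< 0<n)
        next≢ : ∀ i → π i ≢ π (next i)
        next≢ i e = bad (next-toℕ i)
          where
          i≡ : i ≡ next i
          i≡ = trans (sym (Data.Fin.Permutation.inverseˡ ordering)) (trans (cong (ordering ⟨$⟩ˡ_) e) (Data.Fin.Permutation.inverseˡ ordering))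
          bad : ¬ (toℕ (next i) ≡ suc (toℕ i) ⊎ suc (toℕ i) ≡ n × toℕ (next i) ≡ 0)
          bad (inj₁ q) = 1+n≢n (trans (sym q) (cong toℕ (sym i≡)))
          bad (inj₂ (q , z)) = <⇒≱ 3≤n (≤-trans (≤-reflexive (trans (sym q) (cong suc (trans (cong toℕ i≡) z)))) (s≤s z≤n))
        step : ∀ i → Reach σ τ (π i) (π (next i))
        step i = let (f , j) = edge (next≢ i) in
          [ (λ f∈ → subst (Reach σ τ (π i)) (Equivalence.to (rσ j) f∈) (via-σ here))
          , (λ f∈ → subst (Reach σ τ (π i)) (Equivalence.to (rτ j) f∈) (via-τ here)) ]′
            (x∈p∪q⁻ M N (Equivalence.from (edges⇔ f) (i , j)))
        reach-index : ∀ j (lt : j < n) → Reach σ τ v₀ (π (fromℕ< lt))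
        reach-index zero lt = here
        reach-index (suc j) lt = reach-trans (reach-index j (≤-trans (n≤1+n _) lt))
          (subst (λ z → Reach σ τ (π i) (π z)) (next≡ (next-toℕ i)) (step i))
          where
          i = fromℕ< (≤-trans (n≤1+n (suc j)) lt)
          next≡ : toℕ (next i) ≡ suc (toℕ i) ⊎ suc (toℕ i) ≡ n × toℕ (next i) ≡ 0 → next i ≡ fromℕ< lt
          next≡ (inj₁ q) = Fin.toℕ-injective (trans q (trans (cong suc (Fin.toℕ-fromℕ< _)) (sym (Fin.toℕ-fromℕ< lt))))
          next≡ (inj₂ (q , _)) = contradiction (trans (sym (cong suc (Fin.toℕ-fromℕ< _))) q) (<⇒≢ lt)
        from₀ : ∀ y → Reach σ τ v₀ y
        from₀ y = subst (Reach σ τ v₀) (trans (cong π (Fin.fromℕ<-toℕ _ _)) (inverseʳ ordering)) (reach-index (toℕ (ordering ⟨$⟩ˡ y)) (Fin.toℕ<n _))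

      -- The ordering is the alternating walk, which visits n distinct vertices before it closes. An
      -- edge of M or N is the forward or the backward step of the walk at its first end.
      connected⇒hamilton : 3 ≤ n → Connected (allFin n) σ τ → IsHamiltonCycle n (M ∪ N)
      connected⇒hamilton 3≤n conn = record { 3≤n = 3≤n ; ordering = ord ; edges⇔ = λ f → mk⇔ (to f) (from f) }
        where
        0<n : 0 < n
        0<n = ≤-trans (s≤s z≤n) 3≤n
        instance
          n≢0 : NonZero n
          n≢0 = >-nonZero 0<n
        v₀ = fromℕ< 0<n
        w : ℕ → V
        w = walk mσ mτ v₀
        n-even = proj₁ (walk-closes mσ mτ v₀ conn)
        closing = proj₂ (walk-closes mσ mτ v₀ conn)
        covers = walk-covers mσ mτ v₀ {n} n-even closing conn
        pos : V → Fin n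
        pos y = fromℕ< (proj₁ (proj₂ (covers y)))
        w-pos : ∀ y → w (toℕ (pos y)) ≡ y
        w-pos y = trans (cong w (Fin.toℕ-fromℕ< (proj₁ (proj₂ (covers y))))) (proj₂ (proj₂ (covers y)))
        ord = permutation (w ∘ toℕ) pos w-pos
          (λ i → Fin.toℕ-injective (walk-injective mσ mτ v₀ conn (Fin.toℕ<n _) (Fin.toℕ<n i) (w-pos (w (toℕ i)))))
        next-at : ∀ {a b} (lt : a < n) → b < n → b ≡ suc a ⊎ suc a ≡ n × b ≡ 0 → toℕ (next (fromℕ< lt)) ≡ b
        next-at lt b<n p with next-toℕ (fromℕ< lt) | p
        ... | inj₁ q | inj₁ e = trans q (trans (cong suc (Fin.toℕ-fromℕ< lt)) (sym e))
        ... | inj₂ (_ , z) | inj₂ (_ , e) = trans z (sym e)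
        ... | inj₁ q | inj₂ (e , _) = contradiction (trans q (trans (cong suc (Fin.toℕ-fromℕ< lt)) e)) (<⇒≢ (Fin.toℕ<n _))
        ... | inj₂ (q , _) | inj₁ e = contradiction (trans e (trans (cong suc (sym (Fin.toℕ-fromℕ< lt))) q)) (<⇒≢ b<n)
        w-next : ∀ i → w (toℕ (next i)) ≡ along mσ mτ (even (toℕ i)) (w (toℕ i))
        w-next i with next-toℕ i
        ... | inj₁ q = cong w q
        ... | inj₂ (q , z) = trans (cong w z) (trans (sym closing) (cong w (sym q)))
        from : ∀ f → ∃[ i ] Joins n f (ord ⟨$⟩ʳ i) (ord ⟨$⟩ʳ next i) → f ∈ M ∪ N
        from f (i , j) with even (toℕ i) | w-next i
        ... | true | e = x∈p∪q⁺ (inj₁ (Equivalence.from (rσ j) (sym e)))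
        ... | false | e = x∈p∪q⁺ (inj₂ (Equivalence.from (rτ j) (sym e)))
        step : ∀ c f {u v} → Joins n f u v → along mσ mτ c u ≡ v → ∃[ i ] Joins n f (ord ⟨$⟩ʳ i) (ord ⟨$⟩ʳ next i)
        step c f {u} {v} jn e with covers u
        ... | j , j<n , refl with walk-neighbour mσ mτ v₀ {n} n-even closing c j<n
        ... | i , i<n , e′ , inj₁ fwd = fromℕ< j<n , subst₂ (Joins n f) (cong w (sym (Fin.toℕ-fromℕ< j<n)))
                (trans (sym e) (trans e′ (cong w (sym (next-at j<n i<n fwd))))) jn
        ... | i , i<n , e′ , inj₂ bwd = fromℕ< i<n , subst₂ (Joins n f) (trans (sym e) (trans e′ (cong w (sym (Fin.toℕ-fromℕ< i<n)))))
                (cong w (sym (next-at i<n j<n bwd))) (joins-sym {f} jn)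
        to : ∀ f → f ∈ M ∪ N → ∃[ i ] Joins n f (ord ⟨$⟩ʳ i) (ord ⟨$⟩ʳ next i)
        to f f∈ = [ (λ p → step true f (joins-endpoints f) (Equivalence.to (rσ (joins-endpoints f)) p))
                  , (λ p → step false f (joins-endpoints f) (Equivalence.to (rτ (joins-endpoints f)) p)) ]′ (x∈p∪q⁻ M N f∈)

    module _ {k : ℕ} (M : Fin k → EdgeSet n) (pm : ∀ i → IsPerfectMatching n (M i)) where

      partners : Fin k → V → V
      partners i = partner (pm i)

      Completes : EdgeSet n → Set
      Completes M* = IsPerfectMatching n M* × (∀ i → IsHamiltonCycle n (M* ∪ M i))

      initial : State (allFin n) partners
      initial = record
        { unique = Unique.allFin⁺ n ; matching = λ i → partner-matching (pm i) ; closed = λ _ _ → ∈-allFin _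
        -- No vertex is outside the list, so the identity qualifies as outer edges although it fixes
        -- every vertex.
        ; outer = (λ x → x) , initial-outer }
        where
        initial-outer : Outer (allFin n) (λ x → x)
        initial-outer = record
          { leaves = λ x∉ → x∉ ; return = λ _ → refl ; moves = λ x∉ → contradiction (∈-allFin _) x∉ }

      completes-count : ∀ t → n ≡ 2 * t → 3 ≤ n → HasCount Completes (count t (allFin n) partners)
      completes-count t n≡ 3≤n = hasCount-image edgesOf inj pres surj
          (hasCount t initial (proj₂ (State.outer initial)) (trans (length-tabulate (λ x → x)) n≡))
        where
        Sol : Vec V n → Set
        Sol = Solves (allFin n) (λ x → x) partners
        inj : ∀ {σ ρ} → Sol σ → Sol ρ → edgesOf σ ≡ edgesOf ρ → σ ≡ ρ
        inj {σ} {ρ} s s′ eq = vec-ext λ u →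
          let (f , j) = edge (≢-sym (nofix (Solves.matching s) u)) in
          sym (Equivalence.to (edgesOf-represents {ρ} (Solves.matching s′) j)
            (subst (f ∈_) eq (Equivalence.from (edgesOf-represents {σ} (Solves.matching s) j) refl)))
        pres : ∀ {σ} → Sol σ → Completes (edgesOf σ)
        pres {σ} s = represents-matching matching r ,
            λ i → connected⇒hamilton matching (partner-matching (pm i)) r (partner-represents (pm i)) 3≤n (connected i)
          where
          open Solves s
          r : Represents (edgesOf σ) (Vec.lookup σ)
          r = edgesOf-represents {σ} matching
        surj : ∀ {M*} → Completes M* → ∃[ σ ] Sol σ × M* ≡ edgesOf σ
        surj {M*} (p , h) = σ , sol , represents-≡ r (edgesOf-represents {σ} mσ)
          where
          σ = tabulate (partner p)
          at : ∀ x → Vec.lookup σ x ≡ partner p x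
          at = lookup∘tabulate (partner p)
          mσ : IsMatching (Vec.lookup σ)
          mσ .invol x = trans (at _) (trans (cong (partner p) (at x)) (invol (partner-matching p) x))
          mσ .nofix x e = nofix (partner-matching p) x (trans (sym (at x)) e)
          r : Represents M* (Vec.lookup σ)
          r {f} {u} {v} j = mk⇔ (λ f∈ → trans (at u) (Equivalence.to (partner-represents p j) f∈))
            (λ e → Equivalence.from (partner-represents p j) (trans (sym (at u)) e))
          sol : Sol σ
          sol = record
            { matching = mσ ; closed = λ _ → ∈-allFin _ ; outside = λ x∉ → contradiction (∈-allFin _) x∉
            ; connected = λ i → hamilton⇒connected mσ (partner-matching (pm i)) r (partner-represents (pm i)) (h i) }

      private
        covered : ∀ {m} → (Fin m → V × V) → Subset m → List V
        covered g Vec.[] = []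
        covered g (true Vec.∷ S) = proj₁ (g zero) ∷ proj₂ (g zero) ∷ covered (g ∘ suc) S
        covered g (false Vec.∷ S) = covered (g ∘ suc) S

        length-covered : ∀ {m} (g : Fin m → V × V) S → length (covered g S) ≡ 2 * ∣ S ∣
        length-covered g Vec.[] = refl
        length-covered g (true Vec.∷ S) = trans (cong (2 +_) (length-covered (g ∘ suc) S)) (sym (*-suc 2 ∣ S ∣))
        length-covered g (false Vec.∷ S) = length-covered (g ∘ suc) S

        ∈-covered : ∀ {m} (g : Fin m → V × V) S {f} → f ∈ S → proj₁ (g f) List.∈ covered g S × proj₂ (g f) List.∈ covered g S
        ∈-covered g (true Vec.∷ S) here = here refl , there (here refl)
        ∈-covered g (true Vec.∷ S) (there f∈) = let (p , q) = ∈-covered (g ∘ suc) S f∈ in there (there p) , there (there q)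
        ∈-covered g (false Vec.∷ S) (there f∈) = ∈-covered (g ∘ suc) S f∈

        ends : Fin k × Fin k → List V
        ends (i , j) = covered (endpoints n) (M i ∩ M j)

        allEnds : List (Fin k × Fin k) → List V
        allEnds [] = []
        allEnds (p ∷ ps) = ends p ++ allEnds ps

        length-allEnds : ∀ ps → length (allEnds ps) ≡ 2 * sum (map (λ (i , j) → ∣ M i ∩ M j ∣) ps)
        length-allEnds [] = refl
        length-allEnds ((i , j) ∷ ps) = trans (length-++ (ends (i , j))) (trans (cong₂ _+_ (length-covered (endpoints n) (M i ∩ M j)) (length-allEnds ps))
          (sym (*-distribˡ-+ 2 ∣ M i ∩ M j ∣ _)))

        ∈-allEnds : ∀ {ps p x} → p List.∈ ps → x List.∈ ends p → x List.∈ allEnds ps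
        ∈-allEnds (here refl) x∈ = ∈-++⁺ˡ x∈
        ∈-allEnds {p′ ∷ _} (there p∈) x∈ = ∈-++⁺ʳ (ends p′) (∈-allEnds p∈ x∈)

      -- An overlapped vertex is an end of an edge common to two of the matchings, and each edge has
      -- two ends.
      defect≤ : defect (allFin n) partners ≤ 2 * totalIntersection k n M
      defect≤ = ≤-trans (unique-⊆-length _≟_ (Unique.filter⁺ (overlap? _≢?_ partners) (Unique.allFin⁺ n)) sub) (≤-reflexive (length-allEnds pairs))
        where
        pairs = filter (λ (i , j) → ¬? (i Fin.≟ j)) (cartesianProduct (allFin k) (allFin k))
        sub : ∀ {x} → x List.∈ overlapped _≢?_ (allFin n) partners → x List.∈ allEnds pairs
        sub {x} x∈ with proj₂ (∈-filter⁻ (overlap? _≢?_ partners) {xs = allFin n} x∈)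
        ... | i , j , i≢j , e = ∈-allEnds (∈-filter⁺ (λ (i , j) → ¬? (i Fin.≟ j)) (∈-cartesianProduct⁺ (∈-allFin i) (∈-allFin j)) i≢j) (end jn)
          where
          fj = edge (≢-sym (nofix (partner-matching (pm i)) x))
          f = proj₁ fj
          jn = proj₂ fj
          f∈ : f ∈ M i ∩ M j
          f∈ = x∈p∩q⁺ (Equivalence.from (partner-represents (pm i) jn) refl , Equivalence.from (partner-represents (pm j) jn) (sym e))
          end : Joins n f x (partners i x) → x List.∈ ends (i , j)
          end (inj₁ q) = subst (List._∈ ends (i , j)) (cong proj₁ q) (proj₁ (∈-covered (endpoints n) (M i ∩ M j) f∈))
          end (inj₂ q) = subst (List._∈ ends (i , j)) (cong proj₂ q) (proj₂ (∈-covered (endpoints n) (M i ∩ M j) f∈))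

-- Approximating fractions of the real quantities.

module Reals where

  open import Defs
  open Stirling using (expNumerator)
  open Potential using (^-distribʳ-*)
  open import Data.Nat as ℕ using (ℕ; zero; suc; _!)
  import Data.Nat.Properties as ℕ
  import Data.Nat.DivMod as ℕ
  open import Data.Nat.Tactic.RingSolver using () renaming (solve-∀ to solveℕ-∀)
  open import Data.Integer as ℤ using (ℤ; +_)
  import Data.Integer.Properties as ℤ
  open import Data.Integer.Tactic.RingSolver using () renaming (solve-∀ to solveℤ-∀)
  open import Data.Rational.Unnormalised as ℚ using (ℚᵘ; mkℚᵘ; 1ℚᵘ; Positive; *≤*; *≡*; ↥_; ↧_; ↧ₙ_)
  import Data.Rational.Unnormalised.Properties as ℚ
  open import Data.Product using (_,_; ∃-syntax)
  open import Relation.Nullary using (yes; no)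
  open import Relation.Binary.PropositionalEquality

  infix 4 _∼_÷_

  -- Equality with a/b in cross-multiplied form, so that natural numerators and denominators can be
  -- tracked without reducing fractions or proving b nonzero at each step.
  record _∼_÷_ (q : ℚᵘ) (a b : ℕ) : Set where
    constructor cross-multiplied
    field cross : ↥ q ℤ.* + b ≡ + a ℤ.* ↧ q

  ∼-/ : ∀ a b .{{_ : ℕ.NonZero b}} → (+ a) ℚ./ b ∼ a ÷ b
  ∼-/ a (suc b) = cross-multiplied refl

  ∼-* : ∀ {p q a b c d} → p ∼ a ÷ b → q ∼ c ÷ d → p ℚ.* q ∼ a ℕ.* c ÷ b ℕ.* d
  ∼-* {p@(mkℚᵘ _ _)} {q@(mkℚᵘ _ _)} {a} {b} {c} {d} (cross-multiplied hp) (cross-multiplied hq) = cross-multiplied (begin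
    (↥ p ℤ.* ↥ q) ℤ.* + (b ℕ.* d)             ≡⟨ cong ((↥ p ℤ.* ↥ q) ℤ.*_) (ℤ.pos-* b d) ⟩
    (↥ p ℤ.* ↥ q) ℤ.* (+ b ℤ.* + d)           ≡⟨ swap (↥ p) (↥ q) (+ b) (+ d) ⟩
    (↥ p ℤ.* + b) ℤ.* (↥ q ℤ.* + d)           ≡⟨ cong₂ ℤ._*_ hp hq ⟩
    (+ a ℤ.* ↧ p) ℤ.* (+ c ℤ.* ↧ q)           ≡⟨ swap (+ a) (↧ p) (+ c) (↧ q) ⟩
    (+ a ℤ.* + c) ℤ.* (↧ p ℤ.* ↧ q)           ≡⟨ cong₂ ℤ._*_ (ℤ.pos-* a c) (ℤ.pos-* (↧ₙ p) (↧ₙ q)) ⟨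
    + (a ℕ.* c) ℤ.* ↧ (p ℚ.* q)               ∎)
    where
    open ≡-Reasoning
    swap : ∀ x y z w → (x ℤ.* y) ℤ.* (z ℤ.* w) ≡ (x ℤ.* z) ℤ.* (y ℤ.* w)
    swap = solveℤ-∀

  ∼-+ : ∀ {p q a b c} → p ∼ a ÷ b → q ∼ c ÷ b → p ℚ.+ q ∼ a ℕ.+ c ÷ b
  ∼-+ {p@(mkℚᵘ _ _)} {q@(mkℚᵘ _ _)} {a} {b} {c} (cross-multiplied hp) (cross-multiplied hq) = cross-multiplied (begin
    (↥ p ℤ.* ↧ q ℤ.+ ↥ q ℤ.* ↧ p) ℤ.* + b                     ≡⟨ e₁ (↥ p) (↧ q) (↥ q) (↧ p) (+ b) ⟩
    (↥ p ℤ.* + b) ℤ.* ↧ q ℤ.+ (↥ q ℤ.* + b) ℤ.* ↧ p           ≡⟨ cong₂ (λ x y → x ℤ.* ↧ q ℤ.+ y ℤ.* ↧ p) hp hq ⟩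
    (+ a ℤ.* ↧ p) ℤ.* ↧ q ℤ.+ (+ c ℤ.* ↧ q) ℤ.* ↧ p           ≡⟨ e₂ (+ a) (↧ p) (↧ q) (+ c) ⟩
    (+ a ℤ.+ + c) ℤ.* (↧ p ℤ.* ↧ q)                           ≡⟨ cong₂ ℤ._*_ (ℤ.pos-+ a c) (ℤ.pos-* (↧ₙ p) (↧ₙ q)) ⟨
    + (a ℕ.+ c) ℤ.* ↧ (p ℚ.+ q)                               ∎)
    where
    open ≡-Reasoning
    e₁ : ∀ x y z w b → (x ℤ.* y ℤ.+ z ℤ.* w) ℤ.* b ≡ (x ℤ.* b) ℤ.* y ℤ.+ (z ℤ.* b) ℤ.* w
    e₁ = solveℤ-∀
    e₂ : ∀ a x y c → (a ℤ.* x) ℤ.* y ℤ.+ (c ℤ.* y) ℤ.* x ≡ (a ℤ.+ c) ℤ.* (x ℤ.* y)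
    e₂ = solveℤ-∀

  ∼-expand : ∀ m {p a b} → p ∼ a ÷ b → p ∼ m ℕ.* a ÷ m ℕ.* b
  ∼-expand m {p} {a} {b} (cross-multiplied h) = cross-multiplied (begin
    ↥ p ℤ.* + (m ℕ.* b)         ≡⟨ cong (↥ p ℤ.*_) (ℤ.pos-* m b) ⟩
    ↥ p ℤ.* (+ m ℤ.* + b)       ≡⟨ e₀ (↥ p) (+ m) (+ b) ⟩
    + m ℤ.* (↥ p ℤ.* + b)       ≡⟨ cong (+ m ℤ.*_) h ⟩
    + m ℤ.* (+ a ℤ.* ↧ p)       ≡⟨ ℤ.*-assoc (+ m) (+ a) (↧ p) ⟨
    (+ m ℤ.* + a) ℤ.* ↧ p       ≡⟨ cong (ℤ._* ↧ p) (ℤ.pos-* m a) ⟨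
    + (m ℕ.* a) ℤ.* ↧ p         ∎)
    where
    open ≡-Reasoning
    e₀ : ∀ x y z → x ℤ.* (y ℤ.* z) ≡ y ℤ.* (x ℤ.* z)
    e₀ = solveℤ-∀

  ∼-1/ : ∀ {p a b} .{{_ : ℚ.NonZero p}} → Positive p → p ∼ a ÷ b → ℚ.1/ p ∼ b ÷ a
  ∼-1/ {mkℚᵘ (+ suc x) d} {a} {b} _ (cross-multiplied h) = cross-multiplied (trans (ℤ.*-comm (+ suc d) (+ a)) (trans (sym h) (ℤ.*-comm (+ suc x) (+ b))))

  ∼-≤ : ∀ {p q a b c d} .{{_ : ℕ.NonZero b}} .{{_ : ℕ.NonZero d}} → p ∼ a ÷ b → q ∼ c ÷ d → a ℕ.* d ℕ.≤ c ℕ.* b → p ℚ.≤ q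
  ∼-≤ {p} {q} {a} {suc b} {c} {suc d} (cross-multiplied hp) (cross-multiplied hq) h =
    ℚ.≤-respˡ-≃ (ℚ.≃-sym {p} {mkℚᵘ (+ a) b} (*≡* hp)) (ℚ.≤-respʳ-≃ (ℚ.≃-sym {q} {mkℚᵘ (+ c) d} (*≡* hq))
      (*≤* (subst₂ ℤ._≤_ (ℤ.pos-* a (suc d)) (ℤ.pos-* c (suc b)) (ℤ.+≤+ h))))

  ∼-^ : ∀ x i {a b} → seq x i ∼ a ÷ b → ∀ k → seq (x ^ k) i ∼ a ℕ.^ k ÷ b ℕ.^ k
  ∼-^ x i h zero = cross-multiplied refl
  ∼-^ x i h (suc k) = ∼-* {seq x i} {seq (x ^ k) i} h (∼-^ x i h k)

  expSum-∼ : ∀ i → expSum i ∼ expNumerator i ÷ i !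
  expSum-∼ zero = cross-multiplied refl
  expSum-∼ (suc i) = ∼-+ {expSum i} {1/! (suc i)} (∼-expand (suc i) {expSum i} (expSum-∼ i)) (∼-/ 1 (suc i !) {{suc i ℕ.!≢0}})

  -- For s = i + 1 this is ⌊s√n⌋.
  rootNumerator : ℕ → ℕ → ℕ
  rootNumerator n i = floorRoot 2 (n ℕ.* suc i ℕ.^ 2)

  private
    square : ∀ a → a ℕ.^ 2 ≡ a ℕ.* a
    square a = cong (a ℕ.*_) (ℕ.*-identityʳ a)

  rootNumerator-upper : ∀ n i → rootNumerator n i ℕ.* rootNumerator n i ℕ.≤ suc i ℕ.* suc i ℕ.* n
  rootNumerator-upper n i = subst₂ ℕ._≤_ (square (rootNumerator n i)) (trans (ℕ.*-comm n (suc i ℕ.^ 2)) (cong (ℕ._* n) (square (suc i))))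
    (searchRoot-lower 2 (n ℕ.* suc i ℕ.^ 2) (n ℕ.* suc i ℕ.^ 2))

  rootNumerator≥ : ∀ n i .{{_ : ℕ.NonZero n}} → suc i ℕ.≤ rootNumerator n i
  rootNumerator≥ n i = floorRoot-max 2 _ (suc i) (ℕ.m≤n*m (suc i ℕ.^ 2) n)

  rootNumerator-lower : ∀ n i .{{_ : ℕ.NonZero n}} → suc i ℕ.* suc i ℕ.* n ℕ.≤ 4 ℕ.* (rootNumerator n i ℕ.* rootNumerator n i)
  rootNumerator-lower n i = begin
    suc i ℕ.* suc i ℕ.* n         ≡⟨ trans (cong (ℕ._* n) (sym (square (suc i)))) (ℕ.*-comm _ n) ⟩
    n ℕ.* suc i ℕ.^ 2             ≤⟨ ℕ.<⇒≤ (ℕ.≰⇒> λ h → ℕ.<⇒≱ ℕ.≤-refl (floorRoot-max 2 (n ℕ.* suc i ℕ.^ 2) (suc A) h)) ⟩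
    suc A ℕ.^ 2                   ≤⟨ ℕ.^-monoˡ-≤ 2 {suc A} {A ℕ.+ A} (ℕ.+-monoˡ-≤ A (ℕ.≤-trans (ℕ.s≤s ℕ.z≤n) (rootNumerator≥ n i))) ⟩
    (A ℕ.+ A) ℕ.^ 2               ≡⟨ e₀ A ⟩
    4 ℕ.* (A ℕ.* A)               ∎
    where
    open ℕ.≤-Reasoning
    A = rootNumerator n i
    e₀ : ∀ A → (A ℕ.+ A) ℕ.* ((A ℕ.+ A) ℕ.* 1) ≡ 4 ℕ.* (A ℕ.* A)
    e₀ = solveℕ-∀

  -- A record, so that the type checker compares the reals themselves and not their approximants.
  record Approximants (x : ℝ) (a b : ℕ → ℕ) : Set where
    constructor approximants
    field approximant : ∀ i → seq x i ∼ a i ÷ b i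

  asymptotic-approximants : ∀ k n .{{_ : ℕ.NonZero n}} → let t = n ℕ./ 2 in Approximants (asymptotic k n)
    (λ i → suc i ℕ.^ k ℕ.* (n ℕ.* i !) ℕ.^ t) (λ i → rootNumerator n i ℕ.^ k ℕ.* expNumerator i ℕ.^ t)
  asymptotic-approximants k n = approximants λ i → ∼-* {seq (r ^ k) i} {seq (b ^ (n ℕ./ 2)) i}
    (∼-^ r i {suc i} {rootNumerator n i} (∼-1/ {root i} {{ℚ.pos⇒nonZero (root i) {{root>0 i}}}} (root>0 i) (cross-multiplied refl)) k)
    (∼-^ b i {n ℕ.* i !} {expNumerator i} (subst (seq b i ∼ n ℕ.* i ! ÷_) (ℕ.*-identityˡ (expNumerator i))
      (∼-* {(+ n) ℚ./ 1} {seq (recip e e≥1) i} (∼-/ n 1) (∼-1/ {expSum i} {{ℚ.pos⇒nonZero (expSum i) {{exp>0 i}}}} (exp>0 i) (expSum-∼ i)))) (n ℕ./ 2))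
    where
    r = recip (n ^1/ 2) (root≥1 n 2)
    b = fromℕ n * recip e e≥1
    root : ℕ → ℚᵘ
    root i = seq (n ^1/ 2) i
    root>0 : ∀ i → Positive (root i)
    root>0 i = pos≥1 (root≥1 n 2 i)
    exp>0 : ∀ i → Positive (expSum i)
    exp>0 i = pos≥1 (e≥1 i)

  private
    from-pos-≤ : ∀ {a b} → + a ℤ.≤ + b → a ℕ.≤ b
    from-pos-≤ (ℤ.+≤+ h) = h

  private
    power-cancel : ∀ d S s a n .{{_ : ℕ.NonZero s}} → S ℕ.* s ℕ.≤ a ℕ.+ s → a ℕ.^ d ℕ.≤ n ℕ.* s ℕ.^ d → (S ℕ.∸ 1) ℕ.^ d ℕ.≤ n
    power-cancel d S s a n h₁ h₂ = ℕ.*-cancelʳ-≤ ((S ℕ.∸ 1) ℕ.^ d) n (s ℕ.^ d) {{ℕ.m^n≢0 s d}} (begin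
      (S ℕ.∸ 1) ℕ.^ d ℕ.* s ℕ.^ d   ≡⟨ ^-distribʳ-* d (S ℕ.∸ 1) s ⟨
      ((S ℕ.∸ 1) ℕ.* s) ℕ.^ d       ≤⟨ ℕ.^-monoˡ-≤ d below ⟩
      a ℕ.^ d                       ≤⟨ h₂ ⟩
      n ℕ.* s ℕ.^ d                 ∎)
      where
      open ℕ.≤-Reasoning
      below : (S ℕ.∸ 1) ℕ.* s ℕ.≤ a
      below = begin
        (S ℕ.∸ 1) ℕ.* s          ≡⟨ ℕ.*-distribʳ-∸ s S 1 ⟩
        S ℕ.* s ℕ.∸ 1 ℕ.* s      ≡⟨ cong (S ℕ.* s ℕ.∸_) (ℕ.*-identityˡ s) ⟩
        S ℕ.* s ℕ.∸ s            ≤⟨ ℕ.∸-monoˡ-≤ s h₁ ⟩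
        (a ℕ.+ s) ℕ.∸ s          ≡⟨ ℕ.m+n∸n≡m a s ⟩
        a                        ∎

    cleared : ∀ S a N → (+ S) ℚ./ 1 ℚ.≤ (+ a) ℚ./ suc N ℚ.+ 1ℚᵘ → S ℕ.* suc N ℕ.≤ a ℕ.+ suc N
    cleared S a N (*≤* le) = subst₂ ℕ._≤_ (cong (S ℕ.*_) (ℕ.*-identityʳ (suc N))) (e₀ a (suc N))
      (from-pos-≤ (subst₂ ℤ._≤_ (sym (ℤ.pos-* S (suc N ℕ.* 1))) (sym (trans (ℤ.pos-* (a ℕ.* 1 ℕ.+ 1 ℕ.* suc N) 1) (cong (ℤ._* + 1)
        (trans (ℤ.pos-+ (a ℕ.* 1) (1 ℕ.* suc N)) (cong₂ ℤ._+_ (ℤ.pos-* a 1) (ℤ.pos-* 1 (suc N))))))) le))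
      where
      e₀ : ∀ a s → (a ℕ.* 1 ℕ.+ 1 ℕ.* s) ℕ.* 1 ≡ a ℕ.+ s
      e₀ = solveℕ-∀

  -- Taking tolerance 1 in the real inequality gives S ≤ a/s + 1 for some a with a^d ≤ n s^d; this
  -- costs the one unit.
  fromℕ≤root⇒ : ∀ S n d .{{_ : ℕ.NonZero d}} → fromℕ S ≤ n ^1/ d → (S ℕ.∸ 1) ℕ.^ d ℕ.≤ n
  fromℕ≤root⇒ S n d h with h 1ℚᵘ
  ... | N , bounds = power-cancel d S (suc N) (floorRoot d (n ℕ.* suc N ℕ.^ d)) n (cleared S _ N (bounds N ℕ.≤-refl))
    (searchRoot-lower d (n ℕ.* suc N ℕ.^ d) (n ℕ.* suc N ℕ.^ d))

  -- If D ≤ 32κ, the second hypothesis suffices; otherwise 16κ(D + 1) ≤ 32κD ≤ D² ≤ D⁸ ≤ n.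
  root-small : ∀ κ D n → D ℕ.^ 8 ℕ.≤ n → 16 ℕ.* κ ℕ.* suc (32 ℕ.* κ) ℕ.≤ n → 16 ℕ.* κ ℕ.* suc D ℕ.≤ n
  root-small κ D n h₁ h₂ with D ℕ.≤? 32 ℕ.* κ
  ... | yes small = ℕ.≤-trans (ℕ.*-monoʳ-≤ (16 ℕ.* κ) (ℕ.s≤s small)) h₂
  ... | no large = begin
    16 ℕ.* κ ℕ.* suc D       ≤⟨ ℕ.*-monoʳ-≤ (16 ℕ.* κ) (ℕ.+-monoˡ-≤ D 1≤D) ⟩
    16 ℕ.* κ ℕ.* (D ℕ.+ D)   ≡⟨ e₀ κ D ⟩
    32 ℕ.* κ ℕ.* D           ≤⟨ ℕ.*-monoˡ-≤ D (ℕ.<⇒≤ (ℕ.≰⇒> large)) ⟩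
    D ℕ.* D                  ≡⟨ square D ⟨
    D ℕ.^ 2                  ≤⟨ ℕ.^-monoʳ-≤ D {{ℕ.>-nonZero 1≤D}} (ℕ.s≤s (ℕ.s≤s (ℕ.z≤n {6}))) ⟩
    D ℕ.^ 8                  ≤⟨ h₁ ⟩
    n                        ∎
    where
    open ℕ.≤-Reasoning
    1≤D : 1 ℕ.≤ D
    1≤D = ℕ.≤-trans (ℕ.s≤s ℕ.z≤n) (ℕ.≰⇒> large)
    e₀ : ∀ κ D → 16 ℕ.* κ ℕ.* (D ℕ.+ D) ≡ 32 ℕ.* κ ℕ.* D
    e₀ = solveℕ-∀

  private
    scaled-≤ : ∀ q {a b} K N .{{_ : ℕ.NonZero b}} → q ∼ a ÷ b → a ℕ.≤ suc K ℕ.* (N ℕ.* b) → mkℚᵘ (+ 1) K ℚ.* q ℚ.≤ (+ N) ℚ./ 1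
    scaled-≤ q {a} {b} K N h le = ∼-≤ {mkℚᵘ (+ 1) K ℚ.* q} {(+ N) ℚ./ 1} {1 ℕ.* a} {suc K ℕ.* b} {N} {1} {{ℕ.m*n≢0 (suc K) b}}
      (∼-* {mkℚᵘ (+ 1) K} {q} {1} {suc K} {a} {b} (cross-multiplied refl) h) (∼-/ N 1)
      (subst₂ ℕ._≤_ (e₁ a) (e₂ K N b) le)
      where
      e₁ : ∀ x → x ≡ 1 ℕ.* x ℕ.* 1
      e₁ = solveℕ-∀
      e₂ : ∀ K N d → suc K ℕ.* (N ℕ.* d) ≡ N ℕ.* (suc K ℕ.* d)
      e₂ = solveℕ-∀

    ≤-scaled : ∀ q {a b} K N .{{_ : ℕ.NonZero b}} → q ∼ a ÷ b → N ℕ.* b ℕ.≤ K ℕ.* a → (+ N) ℚ./ 1 ℚ.≤ mkℚᵘ (+ suc K) 0 ℚ.* q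
    ≤-scaled q {a} {b} K N h le = ∼-≤ {(+ N) ℚ./ 1} {mkℚᵘ (+ suc K) 0 ℚ.* q} {N} {1} {suc K ℕ.* a} {1 ℕ.* b} {{_}} {{ℕ.m*n≢0 1 b}}
      (∼-/ N 1) (∼-* {mkℚᵘ (+ suc K) 0} {q} {suc K} {1} {a} {b} (cross-multiplied refl) h)
      (subst₂ ℕ._≤_ (cong (N ℕ.*_) (sym (ℕ.*-identityˡ b))) (sym (ℕ.*-identityʳ (suc K ℕ.* a))) (ℕ.≤-trans le (ℕ.m≤n+m (K ℕ.* a) a)))

    expNumerator≢0 : ∀ i → ℕ.NonZero (expNumerator i)
    expNumerator≢0 zero = _
    expNumerator≢0 (suc i) = ℕ.>-nonZero (ℕ.m≤n+m 1 (suc i ℕ.* expNumerator i))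

  denominator≢0 : ∀ k n t i .{{_ : ℕ.NonZero n}} → ℕ.NonZero (rootNumerator n i ℕ.^ k ℕ.* expNumerator i ℕ.^ t)
  denominator≢0 k n t i = ℕ.m*n≢0 (rootNumerator n i ℕ.^ k) (expNumerator i ℕ.^ t)
    {{ℕ.m^n≢0 (rootNumerator n i) k {{ℕ.>-nonZero (ℕ.≤-trans (ℕ.s≤s ℕ.z≤n) (rootNumerator≥ n i))}}}}
    {{ℕ.m^n≢0 (expNumerator i) t {{expNumerator≢0 i}}}}

  module _ {x : ℝ} {a b : ℕ → ℕ} (approx : Approximants x a b) (b≢0 : ∀ i → ℕ.NonZero (b i)) where

    open Approximants approx

    -- The rational factor is 1/(K + 1). The bound is asked only from an index `I` on, because
    -- `exp-lower` needs long partial sums of e.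
    scaled-≤-fromℕ : ∀ K N I → (∀ i → I ℕ.≤ i → a i ℕ.≤ suc K ℕ.* (N ℕ.* b i)) → fromℚ (mkℚᵘ (+ 1) K) * x ≤ fromℕ N
    scaled-≤-fromℕ K N I h ε {{ε>0}} = I , λ i I≤i →
      ℚ.≤-trans {mkℚᵘ (+ 1) K ℚ.* seq x i} {(+ N) ℚ./ 1} (scaled-≤ (seq x i) K N {{b≢0 i}} (approximant i) (h i I≤i))
        (ℚ.p≤p+q ((+ N) ℚ./ 1) ε {{ℚ.pos⇒nonNeg ε}})

    fromℕ-≤-scaled : ∀ K N → (∀ i → N ℕ.* b i ℕ.≤ K ℕ.* a i) → fromℕ N ≤ fromℚ (mkℚᵘ (+ suc K) 0) * x
    fromℕ-≤-scaled K N h ε {{ε>0}} = 0 , λ i _ →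
      ℚ.≤-trans {(+ N) ℚ./ 1} {mkℚᵘ (+ suc K) 0 ℚ.* seq x i} (≤-scaled (seq x i) K N {{b≢0 i}} (approximant i) (h i))
        (ℚ.p≤p+q (mkℚᵘ (+ suc K) 0 ℚ.* seq x i) ε {{ℚ.pos⇒nonNeg ε}})

-- Constants, threshold on n, and assembly.

module Conclusion where

  open Counting using (count)
  open Bounds using (defect; optionsProduct)
  open Threshold using (Comparable)
  open Products
  open Stirling using (expNumerator)
  open Translate
  open Reals
  open import Defs
  open import Data.Nat as ℕ using (ℕ; suc; _!)
  import Data.Nat.Properties as ℕ
  import Data.Nat.DivMod as ℕ
  open import Data.Nat.Divisibility using (_∣_; divides)
  open import Data.Nat.Tactic.RingSolver
  open import Data.Integer using (+_)
  open import Data.Rational.Unnormalised using (mkℚᵘ)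
  open import Data.Fin using (Fin)
  open import Data.List using (allFin)
  open import Data.List.Properties using (length-tabulate)
  open import Data.Product using (_×_; _,_; proj₁; proj₂; ∃-syntax)
  open import Relation.Binary.PropositionalEquality

  module Asymptotics (k t₀ C : ℕ) (κ≤t₀ : suc k ℕ.≤ t₀) (comparison : Comparable k t₀ C) where

    private
      κ = suc k

    -- The final constants are 1/(`lowerScale` + 1) and `upperScale` + 1, positive in any case. In
    -- `minVertices` the 3 is for Hamilton cycles, 2t₀ for the start of the product, and the last
    -- summand for `root-small`; its 16κ arises because at most 2S overlapped vertices must satisfy
    -- 4κ · 2S ≤ n/2.
    lowerScale upperScale minVertices : ℕ
    lowerScale = lowerFactor κ≤t₀ ℕ.* C
    upperScale = C ℕ.* upperFactor κ≤t₀
    minVertices = 3 ℕ.+ 2 ℕ.* t₀ ℕ.+ 16 ℕ.* κ ℕ.* suc (32 ℕ.* κ)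

    private
      half : ∀ t → (2 ℕ.* t) ℕ./ 2 ≡ t
      half t = trans (cong (ℕ._/ 2) (ℕ.*-comm 2 t)) (ℕ.m*n/n≡m t 2)

      few-coincidences : ∀ S D t → D ℕ.≤ 2 ℕ.* S → 16 ℕ.* κ ℕ.* suc (S ℕ.∸ 1) ℕ.≤ 2 ℕ.* t → 4 ℕ.* κ ℕ.* D ℕ.≤ t
      few-coincidences S D t D≤ h = ℕ.*-cancelˡ-≤ 2 (begin
        2 ℕ.* (4 ℕ.* κ ℕ.* D)            ≤⟨ ℕ.*-monoʳ-≤ 2 (ℕ.*-monoʳ-≤ (4 ℕ.* κ) (ℕ.≤-trans D≤ (ℕ.*-monoʳ-≤ 2 (ℕ.m≤n+m∸n S 1)))) ⟩
        2 ℕ.* (4 ℕ.* κ ℕ.* (2 ℕ.* suc (S ℕ.∸ 1)))  ≡⟨ regroup κ (suc (S ℕ.∸ 1)) ⟩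
        16 ℕ.* κ ℕ.* suc (S ℕ.∸ 1)       ≤⟨ h ⟩
        2 ℕ.* t                          ∎)
        where
        open ℕ.≤-Reasoning
        regroup : ∀ κ s → 2 ℕ.* (4 ℕ.* κ ℕ.* (2 ℕ.* s)) ≡ 16 ℕ.* κ ℕ.* s
        regroup = solve-∀

      module _ {n h d : ℕ} (n≡ : n ≡ 2 ℕ.* (d ℕ.+ t₀)) (h≡ : h ≡ d ℕ.+ t₀) {N : ℕ} (i s A : ℕ) where

        private
          H = optionsProduct k t₀ d
          num = s ℕ.^ k ℕ.* (n ℕ.* i !) ℕ.^ h
          den = A ℕ.^ k ℕ.* expNumerator i ℕ.^ h

        numerator-≤ : H ℕ.≤ C ℕ.* N → 3 ℕ.* (suc n ℕ.* (n ℕ.+ 3)) ℕ.≤ i → s ℕ.* s ℕ.* n ℕ.≤ 4 ℕ.* (A ℕ.* A) →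
          num ℕ.≤ suc lowerScale ℕ.* (N ℕ.* den)
        numerator-≤ H≤ big sA = begin
          num                                        ≤⟨ bound′ n≡ h≡ ⟩
          lowerFactor κ≤t₀ ℕ.* (H ℕ.* den)           ≤⟨ ℕ.*-monoʳ-≤ (lowerFactor κ≤t₀) (ℕ.*-monoˡ-≤ den H≤) ⟩
          lowerFactor κ≤t₀ ℕ.* (C ℕ.* N ℕ.* den)     ≡⟨ regroup (lowerFactor κ≤t₀) C N den ⟩
          lowerScale ℕ.* (N ℕ.* den)                 ≤⟨ ℕ.m≤n+m _ (N ℕ.* den) ⟩
          suc lowerScale ℕ.* (N ℕ.* den)             ∎
          where
          open ℕ.≤-Reasoning
          bound′ : n ≡ 2 ℕ.* (d ℕ.+ t₀) → h ≡ d ℕ.+ t₀ → num ℕ.≤ lowerFactor κ≤t₀ ℕ.* (H ℕ.* den)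
          bound′ refl refl = fraction-upper κ≤t₀ i d s A big sA
          regroup : ∀ a c n d → a ℕ.* (c ℕ.* n ℕ.* d) ≡ a ℕ.* c ℕ.* (n ℕ.* d)
          regroup = solve-∀

        denominator-≤ : N ℕ.≤ C ℕ.* H → A ℕ.* A ℕ.≤ s ℕ.* s ℕ.* n → N ℕ.* den ℕ.≤ upperScale ℕ.* num
        denominator-≤ N≤ As = begin
          N ℕ.* den                                  ≤⟨ ℕ.*-monoˡ-≤ den N≤ ⟩
          C ℕ.* H ℕ.* den                            ≡⟨ ℕ.*-assoc C H den ⟩
          C ℕ.* (H ℕ.* den)                          ≤⟨ ℕ.*-monoʳ-≤ C (bound′ n≡ h≡) ⟩
          C ℕ.* (upperFactor κ≤t₀ ℕ.* num)           ≡⟨ ℕ.*-assoc C (upperFactor κ≤t₀) num ⟨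
          upperScale ℕ.* num                         ∎
          where
          open ℕ.≤-Reasoning
          bound′ : n ≡ 2 ℕ.* (d ℕ.+ t₀) → h ≡ d ℕ.+ t₀ → H ℕ.* den ℕ.≤ upperFactor κ≤t₀ ℕ.* num
          bound′ refl refl = fraction-lower κ≤t₀ i d s A As

    count-asymptotic : ∀ n .{{nz : ℕ.NonZero n}} d → n ≡ 2 ℕ.* (d ℕ.+ t₀) → minVertices ℕ.≤ n →
      ∀ (M : Fin k → EdgeSet n) (pm : ∀ i → IsPerfectMatching n (M i)) → fromℕ (totalIntersection k n M) ≤ n ^1/ 8 →
      ∃[ N ] HasCount (Completes M pm) N
        × fromℚ (mkℚᵘ (+ 1) lowerScale) * asymptotic k n {{nz}} ≤ fromℕ N
        × fromℕ N ≤ fromℚ (mkℚᵘ (+ suc upperScale) 0) * asymptotic k n {{nz}}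
    count-asymptotic n {{nz}} d n≡ large M pm total = N , completes-count M pm t n≡ 3≤n ,
      scaled-≤-fromℕ {asymptotic k n {{nz}}} (asymptotic-approximants k n {{nz}}) (λ i → denominator≢0 k n (n ℕ./ 2) i {{nz}}) lowerScale N (3 ℕ.* (suc n ℕ.* (n ℕ.+ 3)))
        (λ i big → numerator-≤ n≡ h≡ {N} i (suc i) (rootNumerator n i) (proj₁ Θ) big (rootNumerator-lower n i {{nz}})) ,
      fromℕ-≤-scaled {asymptotic k n {{nz}}} (asymptotic-approximants k n {{nz}}) (λ i → denominator≢0 k n (n ℕ./ 2) i {{nz}}) upperScale N
        (λ i → denominator-≤ n≡ h≡ {N} i (suc i) (rootNumerator n i) (proj₂ Θ) (rootNumerator-upper n i))
      where
      t = d ℕ.+ t₀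
      h≡ : n ℕ./ 2 ≡ t
      h≡ = trans (cong (ℕ._/ 2) n≡) (half t)
      N = count t (allFin n) (partners M pm)
      num den : ℕ → ℕ
      num i = suc i ℕ.^ k ℕ.* (n ℕ.* i !) ℕ.^ (n ℕ./ 2)
      den i = rootNumerator n i ℕ.^ k ℕ.* expNumerator i ℕ.^ (n ℕ./ 2)
      3≤n : 3 ℕ.≤ n
      3≤n = ℕ.≤-trans (ℕ.≤-trans (ℕ.m≤m+n 3 (2 ℕ.* t₀)) (ℕ.m≤m+n (3 ℕ.+ 2 ℕ.* t₀) _)) large
      small : 4 ℕ.* κ ℕ.* defect (allFin n) (partners M pm) ℕ.≤ t
      small = few-coincidences (totalIntersection k n M) _ t (defect≤ M pm)
        (subst (16 ℕ.* κ ℕ.* suc (totalIntersection k n M ℕ.∸ 1) ℕ.≤_) n≡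
          (root-small κ (totalIntersection k n M ℕ.∸ 1) n (fromℕ≤root⇒ (totalIntersection k n M) n 8 total)
            (ℕ.≤-trans (ℕ.m≤n+m _ (3 ℕ.+ 2 ℕ.* t₀)) large)))
      Θ = comparison d (initial M pm) (trans (length-tabulate (λ x → x)) n≡) small

    even-split : ∀ {n} → minVertices ℕ.≤ n → 2 ∣ n → ∃[ d ] n ≡ 2 ℕ.* (d ℕ.+ t₀)
    even-split large (divides q refl) = q ℕ.∸ t₀ , trans (ℕ.*-comm q 2) (cong (2 ℕ.*_) (sym (ℕ.m∸n+n≡m t₀≤q)))
      where
      t₀≤q : t₀ ℕ.≤ q
      t₀≤q = ℕ.*-cancelˡ-≤ 2 (ℕ.≤-trans (ℕ.m≤n+m (2 ℕ.* t₀) 3) (ℕ.≤-trans (ℕ.m≤m+n _ _) (ℕ.≤-trans large (ℕ.≤-reflexive (ℕ.*-comm q 2)))))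

open import Defs
open import Data.Nat as ℕ using (ℕ; NonZero)
open import Data.Nat.Divisibility using (_∣_)
open import Data.Fin using (Fin)
open import Data.Fin.Subset using (_∪_)
open import Data.Integer using (+_)
open import Data.Product using (_×_; _,_; proj₁; proj₂; ∃-syntax)
open import Data.Rational.Unnormalised using (Positive; mkℚᵘ)
open Threshold using (threshold; threshold-comparable; k<threshold)

theorem4p1 : ∀ (k : ℕ) →
    ∃[ c ] ∃[ C ] ∃[ n₀ ] Positive c × Positive C ×
    (∀ (n : ℕ) .{{_ : NonZero n}} → n₀ ℕ.≤ n → 2 ∣ n →
    ∀ (M : Fin k → EdgeSet n) → (∀ i → IsPerfectMatching n (M i)) →
    fromℕ (totalIntersection k n M) ≤ n ^1/ 8 →
    ∃[ N ] HasCount (λ M* → IsPerfectMatching n M* × (∀ i → IsHamiltonCycle n (M* ∪ M i))) N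
    × fromℚ c * asymptotic k n ≤ fromℕ N
    × fromℕ N ≤ fromℚ C * asymptotic k n)
theorem4p1 k = mkℚᵘ (+ 1) lowerScale , mkℚᵘ (+ ℕ.suc upperScale) 0 , minVertices , _ , _ , λ n {{nz}} large 2∣n M pm total →
  let (d , n≡) = even-split large 2∣n in count-asymptotic n {{nz}} d n≡ large M pm total
  where
  open Conclusion.Asymptotics k (threshold k) (proj₁ (threshold-comparable k)) (k<threshold k) (proj₂ (threshold-comparable k))
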